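{- The shard intersection order $(S_n,\le)$ (for $n\ge 1$) admits a symmetric boolean decomposition $\{P_1,\dots,P_k\}$ with the additional property that each $P_i$ is either contained in or disjoint from the set $S_n(231)$ of $231$-avoiding permutations, and the parts $P_i$ contained in $S_n(231)$ form a symmetric boolean decomposition of the induced subposet $(S_n(231),\le)$ (which is isomorphic to the lattice $NC(n)$ of noncrossing partitions ordered by refinement).
   Context: For $w=w(1)\cdots w(n)\in S_n$ (one-line notation), a descent is an index $i$ with $w(i)>w(i+1)$, and $d(w)$ is the number of descents. The blocks of $w$ are the sets of letters of its maximal decreasing runs (maximal consecutive factors $w(a)>w(a+1)>\cdots>w(b)$); they partition $\{1,\dots,n\}$. Let $V=\{x\in\mathbb R^n:\sum_i x_i=0\}$. The cone $C(w)\subseteq V$ is the set of $x\in V$ such that: (i) $x_i=x_j$ whenever $i,j$ lie in the same block of $w$; (ii) whenever $i<k<j$ with $i,j$ in the same block and $k$ not in that block, $x_k\le x_i$ if $k$ appears to the left of $i$ in $w$, and $x_i\le x_k$ if $k$ appears to the right of $i$ in $w$. The shard intersection order on $S_n$ is defined by $u\le v$ iff $C(v)\subseteq C(u)$; it is a graded poset of rank $n-1$ with $\mathrm{rk}(w)=d(w)$. A permutation $w$ is $231$-avoiding if there are no $i<j<k$ with $w(k)<w(i)<w(j)$. Symmetric boolean decomposition: let $P$ be a graded poset of rank $N$ and $\mathrm B_m$ the boolean lattice of subsets of an $m$-element set. A partition $\{P_1,\dots,P_k\}$ of $P$ is a symmetric boolean decomposition if for each $i$ there is an integer $j$ with $0\le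 j\le N/2$ and a bijection $\rho_i:\mathrm B_{N-2j}\to P_i$ that sends cover relations of $\mathrm B_{N-2j}$ to cover relations of $P$ and sends elements of rank $r$ to elements of rank $j+r$ in $P$. -}

module Defs where

open import Algebra.Bundles using (CommutativeMonoid)
import Algebra.Properties.CommutativeSemigroup as CommutativeSemigroupProperties
open import Level using (Level; 0ℓ; _⊔_; suc)
open import Data.Nat.Base as ℕ using (ℕ; _*_; _∸_)
open import Data.Fin.Base as Fin using (Fin; toℕ)
import Data.Fin.Properties as Fin
open import Data.Fin.Permutation using (Permutation′; _⟨$⟩ʳ_; _⟨$⟩ˡ_; _≈_)
open import Data.Fin.Subset as Subset using (Subset; ∣_∣)
open import Data.List.Base using (length; filter; allFin)
import Data.Nat.Properties as ℕ
open import Data.Product.Base using (Σ; ∃; ∃-syntax; _×_; _,_; proj₁; proj₂)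
open import Data.Rational.Base as ℚ using (ℚ; 0ℚ; ½)
import Data.Rational.Properties as ℚ
open import Data.Vec.Functional using (Vector; foldr)
open import Function.Base using (_on_)
open import Function.Definitions using (Injective)
open import Relation.Binary.Core using (Rel)
open import Relation.Binary.PropositionalEquality
  using (_≡_; refl; trans; sym; cong; subst)
open import Relation.Binary.Structures using (IsPartialOrder; IsDecEquivalence)
import Relation.Binary.Construct.NonStrictToStrict as Strict
open import Relation.Nullary using (¬_; Dec)
open import Relation.Nullary.Decidable using (_×-dec_)
open import Relation.Unary as Pred using (Pred)

------------------------------------------------------------------------
-- Real numbers, as Cauchy sequences of rationals.  Only the additive
-- structure and the order are needed.

IsCauchy : (ℕ → ℚ) → Set
IsCauchy x = ∀ ε → 0ℚ ℚ.< ε →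
  ∃[ N ] ∀ m n → N ℕ.≤ m → N ℕ.≤ n → ℚ.∣ x m ℚ.- x n ∣ ℚ.< ε

record ℝ : Set where
  constructor mkℝ
  field
    seq    : ℕ → ℚ
    cauchy : IsCauchy seq

open ℝ public

infix 4 _≃ᴿ_ _≤ᴿ_
infixl 6 _+ᴿ_

-- Two real numbers are equal when their difference tends to 0.
_≃ᴿ_ : Rel ℝ 0ℓ
x ≃ᴿ y = ∀ ε → 0ℚ ℚ.< ε →
  ∃[ N ] ∀ n → N ℕ.≤ n → ℚ.∣ seq x n ℚ.- seq y n ∣ ℚ.< ε

-- lim x ≤ lim y iff, for each ε > 0, eventually x n ≤ y n + ε.
_≤ᴿ_ : Rel ℝ 0ℓ
x ≤ᴿ y = ∀ ε → 0ℚ ℚ.< ε →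
  ∃[ N ] ∀ n → N ℕ.≤ n → seq x n ℚ.≤ seq y n ℚ.+ ε

0ᴿ : ℝ
0ᴿ = mkℝ (λ _ → 0ℚ) (λ ε 0<ε → 0 , λ _ _ _ _ → 0<ε)

private
  0<½*ε : ∀ {ε} → 0ℚ ℚ.< ε → 0ℚ ℚ.< ½ ℚ.* ε
  0<½*ε {ε} 0<ε =
    subst (ℚ._< ½ ℚ.* ε) (ℚ.*-zeroʳ ½) (ℚ.*-monoʳ-<-pos ½ 0<ε)

  halves : ∀ ε → ½ ℚ.* ε ℚ.+ ½ ℚ.* ε ≡ ε
  halves ε = trans (sym (ℚ.*-distribʳ-+ ε ½ ½)) (ℚ.*-identityˡ ε)

  interchange : ∀ a b c d →
    (a ℚ.+ b) ℚ.- (c ℚ.+ d) ≡ (a ℚ.- c) ℚ.+ (b ℚ.- d)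
  interchange a b c d = trans
    (cong ((a ℚ.+ b) ℚ.+_) (ℚ.neg-distrib-+ c d))
    (medial a b (ℚ.- c) (ℚ.- d))
    where
    open CommutativeSemigroupProperties
      (CommutativeMonoid.commutativeSemigroup ℚ.+-0-commutativeMonoid)
      renaming (interchange to medial)

  +-cauchy : ∀ x y → IsCauchy x → IsCauchy y → IsCauchy (λ n → x n ℚ.+ y n)
  +-cauchy x y cx cy ε 0<ε
    with cx (½ ℚ.* ε) (0<½*ε 0<ε) | cy (½ ℚ.* ε) (0<½*ε 0<ε)
  ... | M , hx | N , hy = M ℕ.⊔ N , λ m n m≥ n≥ → begin-strict
      ℚ.∣ (x m ℚ.+ y m) ℚ.- (x n ℚ.+ y n) ∣
        ≡⟨ cong ℚ.∣_∣ (interchange (x m) (y m) (x n) (y n)) ⟩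
      ℚ.∣ (x m ℚ.- x n) ℚ.+ (y m ℚ.- y n) ∣
        ≤⟨ ℚ.∣p+q∣≤∣p∣+∣q∣ (x m ℚ.- x n) (y m ℚ.- y n) ⟩
      ℚ.∣ x m ℚ.- x n ∣ ℚ.+ ℚ.∣ y m ℚ.- y n ∣
        <⟨ ℚ.+-mono-< (hx m n (ℕ.m⊔n≤o⇒m≤o M N m≥) (ℕ.m⊔n≤o⇒m≤o M N n≥))
                      (hy m n (ℕ.m⊔n≤o⇒n≤o M N m≥) (ℕ.m⊔n≤o⇒n≤o M N n≥)) ⟩
      ½ ℚ.* ε ℚ.+ ½ ℚ.* ε
        ≡⟨ halves ε ⟩
      ε ∎
    where open ℚ.≤-Reasoning

_+ᴿ_ : ℝ → ℝ → ℝ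
x +ᴿ y = mkℝ (λ n → seq x n ℚ.+ seq y n) (+-cauchy (seq x) (seq y) (cauchy x) (cauchy y))

------------------------------------------------------------------------
-- Permutations in one-line notation.  For w : 𝕊 n, the letter at
-- position p is  w ⟨$⟩ʳ p  and the position of the letter a is
-- w ⟨$⟩ˡ a.  Letters and positions are counted from 0.  Permutations are
-- identified by _≈_, since _↔_ also carries proofs.

𝕊 : ℕ → Set
𝕊 = Permutation′

module _ {n : ℕ} where

  IsDescent : 𝕊 n → Fin n → Set
  IsDescent w p = ∃[ q ] (toℕ q ≡ ℕ.suc (toℕ p)) × (w ⟨$⟩ʳ q Fin.< w ⟨$⟩ʳ p)

  isDescent? : ∀ w p → Dec (IsDescent w p)
  isDescent? w p = Fin.any? λ q →
    (toℕ q ℕ.≟ ℕ.suc (toℕ p)) ×-dec (w ⟨$⟩ʳ q Fin.<? w ⟨$⟩ʳ p)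

  des : 𝕊 n → ℕ
  des w = length (filter (isDescent? w) (allFin n))

  DecreasingOn : 𝕊 n → Fin n → Fin n → Set
  DecreasingOn w a b =
    ∀ {p q} → a Fin.≤ p → p Fin.< q → q Fin.≤ b → w ⟨$⟩ʳ q Fin.< w ⟨$⟩ʳ p

  record MaximalDecreasingRun (w : 𝕊 n) (a b : Fin n) : Set where
    field
      nonempty   : a Fin.≤ b
      decreasing : DecreasingOn w a b
      maximal    : ∀ {a′ b′} → a′ Fin.≤ a → b Fin.≤ b′ →
                   DecreasingOn w a′ b′ → (a′ ≡ a) × (b′ ≡ b)

  InRun : 𝕊 n → Fin n → Fin n → Fin n → Set
  InRun w a b i = (a Fin.≤ w ⟨$⟩ˡ i) × (w ⟨$⟩ˡ i Fin.≤ b)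

  SameBlock : 𝕊 n → Rel (Fin n) 0ℓ
  SameBlock w i j =
    ∃[ a ] ∃[ b ] MaximalDecreasingRun w a b × InRun w a b i × InRun w a b j

  record Cone (w : 𝕊 n) (x : Vector ℝ n) : Set where
    field
      sum-zero : foldr _+ᴿ_ 0ᴿ x ≃ᴿ 0ᴿ
      constant : ∀ {i j} → SameBlock w i j → x i ≃ᴿ x j
      left     : ∀ {i k j} → i Fin.< k → k Fin.< j →
                 SameBlock w i j → ¬ SameBlock w i k →
                 w ⟨$⟩ˡ k Fin.< w ⟨$⟩ˡ i → x k ≤ᴿ x i
      right    : ∀ {i k j} → i Fin.< k → k Fin.< j →
                 SameBlock w i j → ¬ SameBlock w i k →
                 w ⟨$⟩ˡ i Fin.< w ⟨$⟩ˡ k → x i ≤ᴿ x k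

  infix 4 _≼_
  _≼_ : Rel (𝕊 n) 0ℓ
  u ≼ v = Cone v Pred.⊆ Cone u

  Avoids231 : Pred (𝕊 n) 0ℓ
  Avoids231 w = ¬ (∃[ i ] ∃[ j ] ∃[ k ]
    (i Fin.< j) × (j Fin.< k) ×
    (w ⟨$⟩ʳ k Fin.< w ⟨$⟩ʳ i) × (w ⟨$⟩ʳ i Fin.< w ⟨$⟩ʳ j))

𝕊231 : ℕ → Set
𝕊231 n = Σ (𝕊 n) Avoids231

module _ {n : ℕ} where

  infix 4 _≈₂₃₁_ _≼₂₃₁_
  _≈₂₃₁_ : Rel (𝕊231 n) 0ℓ
  _≈₂₃₁_ = _≈_ on proj₁

  _≼₂₃₁_ : Rel (𝕊231 n) 0ℓ
  _≼₂₃₁_ = _≼_ on proj₁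

  des₂₃₁ : 𝕊231 n → ℕ
  des₂₃₁ w = des (proj₁ w)

------------------------------------------------------------------------
-- Noncrossing partitions of Fin n, presented by the relation "in the
-- same block".

record NC (n : ℕ) : Set (suc 0ℓ) where
  infix 4 _∼_
  field
    _∼_              : Rel (Fin n) 0ℓ
    isDecEquivalence : IsDecEquivalence _∼_
    noncrossing      : ∀ {a b c d} → a Fin.< b → b Fin.< c → c Fin.< d →
                       a ∼ c → b ∼ d → a ∼ b

module _ {n : ℕ} where

  infix 4 _≤ᴺ_ _≈ᴺ_
  _≤ᴺ_ : Rel (NC n) 0ℓ
  π ≤ᴺ σ = ∀ {i j} → NC._∼_ π i j → NC._∼_ σ i j

  _≈ᴺ_ : Rel (NC n) 0ℓ
  π ≈ᴺ σ = (π ≤ᴺ σ) × (σ ≤ᴺ π)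

------------------------------------------------------------------------
-- Graded posets and symmetric boolean decompositions.

module Order {a ℓ₁ ℓ₂ : Level} {A : Set a}
             (_≈′_ : Rel A ℓ₁) (_≤′_ : Rel A ℓ₂) where

  open Strict _≈′_ _≤′_ public using (_<_)

  infix 4 _⋖_
  _⋖_ : Rel A (a ⊔ ℓ₁ ⊔ ℓ₂)
  x ⋖ y = (x < y) × (∀ z → ¬ ((x < z) × (z < y)))

  record IsGraded (rank : A → ℕ) (N : ℕ) : Set (a ⊔ ℓ₁ ⊔ ℓ₂) where
    field
      isPartialOrder : IsPartialOrder _≈′_ _≤′_
      rank-cong      : ∀ {x y} → x ≈′ y → rank x ≡ rank y
      rank-mono      : ∀ {x y} → x < y → rank x ℕ.< rank y
      rank-cover     : ∀ {x y} → x ⋖ y → rank y ≡ ℕ.suc (rank x)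
      rank-minimal   : ∀ {x} → (∀ y → ¬ (y < x)) → rank x ≡ 0
      rank-maximal   : ∀ {x} → (∀ y → ¬ (x < y)) → rank x ≡ N

module Boolean (m : ℕ) = Order {A = Subset m} _≡_ Subset._⊆_

module _ {a ℓ₁ ℓ₂ : Level} {A : Set a}
         (_≈′_ : Rel A ℓ₁) (_≤′_ : Rel A ℓ₂) (rank : A → ℕ) (N : ℕ) where

  open Order _≈′_ _≤′_

  record IsSymmetricBoolean {p} (Q : Pred A p) : Set (a ⊔ ℓ₁ ⊔ ℓ₂ ⊔ p) where
    field
      j          : ℕ
      j≤N/2      : 2 * j ℕ.≤ N
      ρ          : Subset (N ∸ 2 * j) → A
      into       : ∀ X → Q (ρ X)
      injective  : Injective _≡_ _≈′_ ρ
      surjective : ∀ {x} → Q x → ∃[ X ] ρ X ≈′ x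
      covers     : ∀ {X Y} → Boolean._⋖_ (N ∸ 2 * j) X Y → ρ X ⋖ ρ Y
      ranks      : ∀ X → rank (ρ X) ≡ j ℕ.+ ∣ X ∣

  -- The parts are the P i with I i; the restriction to the indices in I
  -- allows a subfamily of P₁, …, P_k to be considered.  Nonemptiness of
  -- the parts follows from IsSymmetricBoolean.
  record IsSymmetricBooleanDecomposition
           {k : ℕ} {ι p} (I : Pred (Fin k) ι) (P : Fin k → Pred A p)
           : Set (a ⊔ ℓ₁ ⊔ ℓ₂ ⊔ ι ⊔ p) where
    field
      isGraded         : IsGraded rank N
      respects         : ∀ {i x y} → I i → x ≈′ y → P i x → P i y
      disjoint         : ∀ {i i′ x} → I i → I i′ → P i x → P i′ x → i ≡ i′
      exhaustive       : ∀ x → ∃[ i ] I i × P i x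
      symmetricBoolean : ∀ {i} → I i → IsSymmetricBoolean (P i)

{-# OPTIONS --safe #-}

-- On C(w) the coordinates weakly increase along inversions: x_a ≤ x_b whenever a > b
-- and a stands to the left of b.  Together with a vector constant on the blocks of w
-- and increasing from left to right, this shows that u ≼ v iff every inversion of u is
-- an inversion of v and every block of u is contained in a block of v.
--
-- The rank counts the letters that are not the minimum of their block, so it increases
-- strictly; for gradedness, if u ≺ v, two blocks of u inside one block of v are united
-- to a permutation between u and v with one more descent.
--
-- The parts are the orbits of valley hopping.  In the decreasing binary tree of w a
-- letter with exactly one child is free, and hopping moves that child to the other
-- side.  If the tree has j letters with two children, an orbit is a copy of the boolean
-- lattice of the sets of free letters with a right child, of which there are
-- n - 1 - 2j, and the rank is j plus the size of the set.  The letter 3 of a pattern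
-- 231 can be chosen to have two children, so hopping preserves the pattern.
--
-- On 231-avoiding permutations the blocks form a noncrossing partition and determine
-- the order of the letters: blocks are listed by increasing minimum.

module Submission where

open import Defs
open import Data.Bool.Base using (Bool; true; false; if_then_else_)
import Data.Bool.Properties as Bool
open import Data.Empty using (⊥-elim)
open import Data.Fin.Base as Fin using (Fin; zero; suc; toℕ; fromℕ; fromℕ<; inject₁; punchOut; funToFin; finToFun)
import Data.Fin.Induction as Fin
open import Data.Fin.Permutation
  using (permutation; reverse; _⟨$⟩ʳ_; _⟨$⟩ˡ_; _≈_; inverseˡ; inverseʳ)
  renaming (id to idₚ)
import Data.Fin.Properties as Fin
open import Data.Fin.Subset using (Subset; ∣_∣; _∈_; _∪_; ⁅_⁆; inside; outside)
import Data.Fin.Subset.Properties as Subset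
open import Data.List.Base using (length; filter; tabulate)
open import Data.Nat.Base as ℕ using (ℕ; _+_; _*_; _∸_; _≤_; _≥_; z≤n; s≤s)
import Data.Nat.Properties as ℕ
open import Data.Product.Base using (∃-syntax; Σ-syntax; _×_; _,_; proj₁; proj₂)
open import Data.Rational.Base as ℚ using (ℚ; 0ℚ; 1ℚ; ½)
import Data.Rational.Properties as ℚ
open import Data.Sum.Base using (_⊎_; inj₁; inj₂; [_,_]′; swap)
open import Data.Unit.Base using (tt)
open import Data.Vec.Base as Vec using ([]; _∷_; there)
open import Data.Vec.Functional using (Vector; foldr)
import Data.Vec.Properties as Vec
open import Function.Base using (_∘_; _on_)
open import Function.Definitions using (Injective)
open import Induction.WellFounded using (Acc; acc)
open import Level using (0ℓ)
open import Relation.Binary.Core using (Rel)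
open import Relation.Binary.Definitions using (Tri; tri<; tri≈; tri>; Transitive; Trichotomous)
open import Relation.Binary.Morphism.Structures using (IsOrderIsomorphism)
open import Relation.Binary.PropositionalEquality
  using (_≡_; _≢_; refl; sym; trans; cong; cong₂; subst; subst₂; ≢-sym; module ≡-Reasoning)
open import Relation.Binary.Structures using (IsDecEquivalence; IsPartialOrder)
open import Relation.Nullary using (¬_; Dec; yes; no; does; contradiction)
open import Relation.Nullary.Decidable
  using (_×-dec_; _⊎-dec_; _→-dec_; map′; ¬?; decidable-stable; dec-true; dec-false)
open import Relation.Unary using (Pred; Decidable; U; _⊆_; _⊥_)

open import Algebra.Properties.CommutativeMonoid.Sum ℕ.+-0-commutativeMonoid
  using (sum; ∑-comm; ∑-distrib-+; sum-cong-≗; sum-permute; sum-init-last)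
import Algebra.Properties.CommutativeMonoid.Sum ℚ.+-0-commutativeMonoid as ℚΣ

-- All arguments compare letters by value and by position, through `a ◁[ w ] b`; words are never
-- cut, and a permutation is constructed by giving a linear order on its letters. No tree is built
-- either: `b` is below `a` when `b < a` and no letter larger than `a` stands between them.
--
-- Uniting two blocks forces the letters between them to move, and a moved letter might create a
-- descent across blocks. As the first two blocks inside V are taken, no letter left between them
-- lies in V, so `v` assigns each a side. Every pair reversed relative to `u` then stands as in `v`,
-- which yields both comparisons.
--
-- Hopping prescribes the new order of each pair of letters, so transitivity needs a proof: there
-- are no cyclic triples. The orbit is rigid because letters with two children never hop, while the
-- largest letter between two smaller ones always has two children; hence descendants, and with them
-- the free letters, are common to the whole orbit.
--
-- Permutations are equal only up to `_≈_`, but the parts must be indexed by some `Fin k`. Orbits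
-- are therefore named by the code of a canonical member.

private
  variable
    m n k : ℕ
    A B : Set
    P : Pred (Fin n) 0ℓ

-- Finite sums and the counting of decidable subsets

sum-mono-≤ : {f g : Fin n → ℕ} → (∀ i → f i ≤ g i) → sum f ≤ sum g
sum-mono-≤ {ℕ.zero}  f≤g = z≤n
sum-mono-≤ {ℕ.suc n} f≤g = ℕ.+-mono-≤ (f≤g zero) (sum-mono-≤ (f≤g ∘ suc))

sum-mono-< : {f g : Fin n → ℕ} → (∀ i → f i ≤ g i) → ∀ i → f i ℕ.< g i → sum f ℕ.< sum g
sum-mono-< f≤g zero    fi<gi = ℕ.+-mono-<-≤ fi<gi (sum-mono-≤ (f≤g ∘ suc))
sum-mono-< f≤g (suc i) fi<gi = ℕ.+-mono-≤-< (f≤g zero) (sum-mono-< (f≤g ∘ suc) i fi<gi)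

term≤sum : (f : Fin n → ℕ) → ∀ i → f i ≤ sum f
term≤sum f zero    = ℕ.m≤m+n (f zero) _
term≤sum f (suc i) = ℕ.≤-trans (term≤sum (f ∘ suc) i) (ℕ.m≤n+m _ (f zero))

𝟙 : Dec A → ℕ
𝟙 A? = if does A? then 1 else 0

𝟙-mono : (A? : Dec A) (B? : Dec B) → (A → B) → 𝟙 A? ≤ 𝟙 B?
𝟙-mono (yes a) (yes b) A→B = ℕ.≤-refl
𝟙-mono (yes a) (no ¬b) A→B = contradiction (A→B a) ¬b
𝟙-mono (no ¬a) B?      A→B = z≤n

𝟙-true : (A? : Dec A) → A → 𝟙 A? ≡ 1
𝟙-true (yes a) _ = refl
𝟙-true (no ¬a) a = contradiction a ¬a

𝟙-false : (A? : Dec A) → ¬ A → 𝟙 A? ≡ 0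
𝟙-false (yes a) ¬a = contradiction a ¬a
𝟙-false (no _)  _  = refl

card : Decidable P → ℕ
card P? = sum (𝟙 ∘ P?)

module _ {P Q : Pred (Fin n) 0ℓ} (P? : Decidable P) (Q? : Decidable Q) where

  card-mono : (∀ i → P i → Q i) → card P? ≤ card Q?
  card-mono P⊆Q = sum-mono-≤ λ i → 𝟙-mono (P? i) (Q? i) (P⊆Q i)

  card-mono-< : (∀ i → P i → Q i) → ∀ i → ¬ P i → Q i → card P? ℕ.< card Q?
  card-mono-< P⊆Q i ¬Pi Qi = sum-mono-< (λ i → 𝟙-mono (P? i) (Q? i) (P⊆Q i)) i
    (subst₂ ℕ._<_ (sym (𝟙-false (P? i) ¬Pi)) (sym (𝟙-true (Q? i) Qi)) ℕ.≤-refl)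

card-cong : {P Q : Pred (Fin n) 0ℓ} (P? : Decidable P) (Q? : Decidable Q) →
            (∀ i → P i → Q i) → (∀ i → Q i → P i) → card P? ≡ card Q?
card-cong P? Q? P⊆Q Q⊆P = ℕ.≤-antisym (card-mono P? Q? P⊆Q) (card-mono Q? P? Q⊆P)

card-none : (P? : Decidable P) → (∀ i → ¬ P i) → card P? ≡ 0
card-none {ℕ.zero}  P? ¬P = refl
card-none {ℕ.suc n} P? ¬P = cong₂ _+_ (𝟙-false (P? zero) (¬P zero)) (card-none (P? ∘ suc) (¬P ∘ suc))

card-unique : (P? : Decidable P) → (∀ {i j} → P i → P j → i ≡ j) → card P? ≤ 1
card-unique {ℕ.zero}  P? unique = z≤n
card-unique {ℕ.suc n} P? unique with P? zero
... | yes p = ℕ.≤-reflexive (cong ℕ.suc (card-none (P? ∘ suc) λ i q → Fin.0≢1+n (unique p q)))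
... | no _  = card-unique (P? ∘ suc) (λ p q → Fin.suc-injective (unique p q))

-- Double counting of the pairs related by R.
card-matching : {P : Pred (Fin m) 0ℓ} {Q : Pred (Fin n) 0ℓ} {R : Fin m → Fin n → Set}
  (P? : Decidable P) (Q? : Decidable Q) (R? : ∀ i a → Dec (R i a)) →
  (∀ {i} → P i → ∃[ a ] R i a × Q a) → (∀ {i j a} → R i a → R j a → i ≡ j) →
  card P? ≤ card Q?
card-matching {Q = Q} {R} P? Q? R? P⇒RQ injective = begin
  card P?                                 ≤⟨ sum-mono-≤ total ⟩
  sum (λ i → sum (λ a → 𝟙 (RQ? i a)))     ≡⟨ ∑-comm (λ i a → 𝟙 (RQ? i a)) ⟩
  sum (λ a → sum (λ i → 𝟙 (RQ? i a)))     ≤⟨ sum-mono-≤ fibre ⟩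
  card Q?                                 ∎
  where
  open ℕ.≤-Reasoning
  RQ? : ∀ i a → Dec (R i a × Q a)
  RQ? i a = R? i a ×-dec Q? a
  total : ∀ i → 𝟙 (P? i) ≤ sum (λ a → 𝟙 (RQ? i a))
  total i with P? i
  ... | no _  = z≤n
  ... | yes p with P⇒RQ p
  ...   | a , rq = ℕ.≤-trans (ℕ.≤-reflexive (sym (𝟙-true (RQ? i a) rq))) (term≤sum (λ a → 𝟙 (RQ? i a)) a)
  fibre : ∀ a → sum (λ i → 𝟙 (RQ? i a)) ≤ 𝟙 (Q? a)
  fibre a with Q? a
  ... | yes q = card-unique (λ i → R? i a ×-dec yes q) λ (r , _) (r′ , _) → injective r r′
  ... | no ¬q = ℕ.≤-reflexive (card-none (λ i → R? i a ×-dec no ¬q) λ _ (_ , q) → ¬q q)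

length-filter-tabulate : {P : Pred A 0ℓ} (P? : Decidable P) (f : Fin n → A) →
  length (filter P? (tabulate f)) ≡ sum (𝟙 ∘ P? ∘ f)
length-filter-tabulate {n = ℕ.zero}  P? f = refl
length-filter-tabulate {n = ℕ.suc n} P? f with P? (f zero)
... | yes _ = cong ℕ.suc (length-filter-tabulate P? (f ∘ suc))
... | no  _ = length-filter-tabulate P? (f ∘ suc)

-- Serves two purposes: it labels the free letters of an orbit by the atoms of a boolean lattice,
-- and it labels the orbits themselves.
record Enumeration {n} (P : Pred (Fin n) 0ℓ) (k : ℕ) : Set where
  field
    element   : Fin k → Fin n
    holds     : ∀ i → P (element i)
    injective : ∀ {i j} → element i ≡ element j → i ≡ j
    index     : ∀ {a} → P a → ∃[ i ] element i ≡ a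

enumeration : (P? : Decidable P) → Enumeration P (card P?)
enumeration {ℕ.zero}  P? = record
  { element = λ () ; holds = λ () ; injective = λ { {()} } ; index = λ { {()} } }
enumeration {ℕ.suc n} P? with P? zero | enumeration (P? ∘ suc)
... | yes p | e = record
  { element   = λ { zero → zero ; (suc i) → suc (element i) }
  ; holds     = λ { zero → p ; (suc i) → holds i }
  ; injective = λ { {zero}  {zero}  _  → refl
                  ; {suc i} {suc j} eq → cong suc (injective (Fin.suc-injective eq)) }
  ; index     = λ { {zero} _ → zero , refl
                  ; {suc a} q → let i , eq = index q in suc i , cong suc eq }
  }
  where open Enumeration e
... | no ¬p | e = record
  { element   = suc ∘ element
  ; holds     = holds
  ; injective = injective ∘ Fin.suc-injective
  ; index     = λ { {zero} q → contradiction q ¬p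
                  ; {suc a} q → let i , eq = index q in i , cong suc eq }
  }
  where open Enumeration e

-- Permutations as linear orders on letters

infix 4 _◁[_]_ _⊴[_]_

pos : 𝕊 n → Fin n → Fin n
pos w a = w ⟨$⟩ˡ a

_◁[_]_ _⊴[_]_ : Fin n → 𝕊 n → Fin n → Set
a ◁[ w ] b = pos w a Fin.< pos w b
a ⊴[ w ] b = pos w a Fin.≤ pos w b

Adjacent : 𝕊 n → Rel (Fin n) 0ℓ
Adjacent w a b = toℕ (pos w b) ≡ ℕ.suc (toℕ (pos w a))

pos-injective : (w : 𝕊 n) → ∀ {a b} → pos w a ≡ pos w b → a ≡ b
pos-injective w {a} {b} eq = begin
  a                       ≡⟨ inverseʳ w ⟨
  w ⟨$⟩ʳ (w ⟨$⟩ˡ a)       ≡⟨ cong (w ⟨$⟩ʳ_) eq ⟩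
  w ⟨$⟩ʳ (w ⟨$⟩ˡ b)       ≡⟨ inverseʳ w ⟩
  b                       ∎
  where open ≡-Reasoning

◁-cmp : (w : 𝕊 n) → ∀ a b → Tri (a ◁[ w ] b) (a ≡ b) (b ◁[ w ] a)
◁-cmp w a b with Fin.<-cmp (pos w a) (pos w b)
... | tri< p q r = tri< p (q ∘ cong (pos w)) r
... | tri≈ p q r = tri≈ p (pos-injective w q) r
... | tri> p q r = tri> p (q ∘ cong (pos w)) r

◁? : (w : 𝕊 n) → ∀ a b → Dec (a ◁[ w ] b)
◁? w a b = pos w a Fin.<? pos w b

⊴? : (w : 𝕊 n) → ∀ a b → Dec (a ⊴[ w ] b)
⊴? w a b = pos w a Fin.≤? pos w b

⊴⇒◁ : (w : 𝕊 n) → ∀ {a b} → a ⊴[ w ] b → a ≢ b → a ◁[ w ] b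
⊴⇒◁ w a⊴b a≢b = Fin.≤∧≢⇒< a⊴b (a≢b ∘ pos-injective w)

⊴-antisym : (w : 𝕊 n) → ∀ {a b} → a ⊴[ w ] b → b ⊴[ w ] a → a ≡ b
⊴-antisym w a⊴b b⊴a = pos-injective w (Fin.≤-antisym a⊴b b⊴a)

<⊎≡⊎> : (a b : Fin n) → (a Fin.< b) ⊎ (a ≡ b) ⊎ (b Fin.< a)
<⊎≡⊎> a b with Fin.<-cmp a b
... | tri< p _ _ = inj₁ p
... | tri≈ _ p _ = inj₂ (inj₁ p)
... | tri> _ _ p = inj₂ (inj₂ p)

◁⇒≢ : (w : 𝕊 n) → ∀ {a b} → a ◁[ w ] b → a ≢ b
◁⇒≢ w a◁b refl = ℕ.<-irrefl refl a◁b

adjacent-⊴ˡ : (w : 𝕊 n) → ∀ {a b c} → Adjacent w a b → c ◁[ w ] b → c ⊴[ w ] a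
adjacent-⊴ˡ w adj c◁b = ℕ.s≤s⁻¹ (ℕ.≤-trans c◁b (ℕ.≤-reflexive adj))

adjacent-⊴ʳ : (w : 𝕊 n) → ∀ {a b c} → Adjacent w a b → a ◁[ w ] c → b ⊴[ w ] c
adjacent-⊴ʳ w adj a◁c = ℕ.≤-trans (ℕ.≤-reflexive adj) a◁c

adjacent⇒◁ : (w : 𝕊 n) → ∀ {a b} → Adjacent w a b → a ◁[ w ] b
adjacent⇒◁ w adj = ℕ.≤-reflexive (sym adj)

-- A discrete intermediate value principle. Neighbours of a letter, and descents between two given
-- letters, are all found by a choice of `Q`.
crossing : (w : 𝕊 n) {Q : Pred (Fin n) 0ℓ} → Decidable Q → ∀ {a b} → a ◁[ w ] b → Q a → ¬ Q b →
           ∃[ c ] ∃[ d ] Adjacent w c d × (a ⊴[ w ] c) × (d ⊴[ w ] b) × Q c × ¬ Q d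
crossing {n} w {Q} Q? {a} {b} a◁b Qa ¬Qb with ℕ.m≤n⇒∃[o]m+o≡n a◁b
... | k , eq = go k a (trans (sym eq) (cong ℕ.suc (ℕ.+-comm (toℕ (pos w a)) k))) Qa
  where
  -- `k` is the number of letters strictly between `a` and `b`.
  go : ∀ k a → toℕ (pos w b) ≡ ℕ.suc k + toℕ (pos w a) → Q a →
       ∃[ c ] ∃[ d ] Adjacent w c d × (a ⊴[ w ] c) × (d ⊴[ w ] b) × Q c × ¬ Q d
  go k a eq Qa = step k eq (Q? next)
    where
    next≤b : ℕ.suc (toℕ (pos w a)) ≤ toℕ (pos w b)
    next≤b = subst (ℕ.suc (toℕ (pos w a)) ≤_) (sym eq) (s≤s (ℕ.m≤n+m _ k))
    next<n : ℕ.suc (toℕ (pos w a)) ℕ.< n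
    next<n = ℕ.≤-<-trans next≤b (Fin.toℕ<n (pos w b))
    next : Fin n
    next = w ⟨$⟩ʳ fromℕ< next<n
    adj : Adjacent w a next
    adj = trans (cong toℕ (inverseˡ w)) (Fin.toℕ-fromℕ< next<n)
    step : ∀ k → toℕ (pos w b) ≡ ℕ.suc k + toℕ (pos w a) → Dec (Q next) →
           ∃[ c ] ∃[ d ] Adjacent w c d × (a ⊴[ w ] c) × (d ⊴[ w ] b) × Q c × ¬ Q d
    step k eq (no ¬q) = a , next , adj , ℕ.≤-refl ,
      ℕ.≤-trans (ℕ.≤-reflexive adj) next≤b , Qa , ¬q
    step ℕ.zero eq (yes q) = contradiction
      (subst Q (pos-injective w (Fin.toℕ-injective (trans adj (sym eq)))) q) ¬Qb
    step (ℕ.suc k) eq (yes q) with go k next (trans eq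
      (cong ℕ.suc (trans (sym (ℕ.+-suc k _)) (cong (k +_) (sym adj))))) q
    ... | c , d , adj′ , next⊴c , rest = c , d , adj′ ,
      ℕ.≤-trans (ℕ.<⇒≤ (adjacent⇒◁ w adj)) next⊴c , rest

successor : (w : 𝕊 n) → ∀ {a b} → a ◁[ w ] b → ∃[ c ] Adjacent w a c × (c ⊴[ w ] b)
successor w {a} {b} a◁b
  with crossing w (λ c → ⊴? w c a) a◁b ℕ.≤-refl (ℕ.<⇒≱ a◁b)
... | c , d , adj , a⊴c , d⊴b , c⊴a , _ with refl ← ⊴-antisym w a⊴c c⊴a = d , adj , d⊴b

predecessor : (w : 𝕊 n) → ∀ {a b} → a ◁[ w ] b → ∃[ c ] Adjacent w c b × (a ⊴[ w ] c)
predecessor w {a} {b} a◁b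
  with crossing w (λ c → ◁? w c b) a◁b a◁b (ℕ.<-irrefl refl)
... | c , d , adj , a⊴c , d⊴b , _ , d⋪b with refl ← ⊴-antisym w d⊴b (ℕ.≮⇒≥ d⋪b) = c , adj , a⊴c

-- A linear order is generated by its adjacent pairs: if `b` preceded `a` in `u`, then on the way
-- from `a` to `b` in `v` some adjacent step would leave the set of letters weakly after `a` in `u`.
adjacent-agree⇒◁ : (u v : 𝕊 n) → (∀ {a b} → Adjacent v a b → a ◁[ u ] b) →
                   ∀ a b → a ◁[ v ] b → a ◁[ u ] b
adjacent-agree⇒◁ u v agree a b a◁b with ◁? u a b
... | yes p = p
... | no ¬p with crossing v (λ c → ⊴? u a c) a◁b ℕ.≤-refl
                  (λ a⊴b → ¬p (⊴⇒◁ u a⊴b (◁⇒≢ v a◁b)))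
...   | c , d , adj , _ , _ , a⊴c , a⋬d = contradiction (ℕ.≤-trans a⊴c (ℕ.<⇒≤ (agree adj))) a⋬d

increasing⇒inflationary : (f : Fin n → Fin n) → (∀ {i j} → i Fin.< j → f i Fin.< f j) →
                          ∀ i → i Fin.≤ f i
increasing⇒inflationary {n} f f-mono i = go (toℕ i) i refl
  where
  go : ∀ k i → toℕ i ≡ k → k ≤ toℕ (f i)
  go ℕ.zero    i eq = z≤n
  go (ℕ.suc k) i eq = ℕ.≤-<-trans (go k j toℕ-j) (f-mono j<i)
    where
    k<n : k ℕ.< n
    k<n = ℕ.<-trans ℕ.≤-refl (subst (ℕ._< n) eq (Fin.toℕ<n i))
    j : Fin n
    j = fromℕ< k<n
    toℕ-j : toℕ j ≡ k
    toℕ-j = Fin.toℕ-fromℕ< k<n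
    j<i : j Fin.< i
    j<i = ℕ.≤-reflexive (trans (cong ℕ.suc toℕ-j) (sym eq))

-- The map from positions in `u` to positions in `v` and its inverse are both increasing, hence both
-- inflationary, hence the identity.
◁⊆◁⇒≈ : (u v : 𝕊 n) → (∀ a b → a ◁[ u ] b → a ◁[ v ] b) → u ≈ v
◁⊆◁⇒≈ u v u⊆v i = begin
  u ⟨$⟩ʳ i              ≡⟨ inverseʳ v ⟨
  v ⟨$⟩ʳ (pos v (u ⟨$⟩ʳ i)) ≡⟨ cong (v ⟨$⟩ʳ_) (Fin.≤-antisym fi≤i (increasing⇒inflationary f f-mono i)) ⟩
  v ⟨$⟩ʳ i              ∎
  where
  open ≡-Reasoning
  f g : Fin _ → Fin _
  f j = pos v (u ⟨$⟩ʳ j)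
  g j = pos u (v ⟨$⟩ʳ j)
  f-mono : ∀ {i j} → i Fin.< j → f i Fin.< f j
  f-mono {i} {j} i<j = u⊆v _ _ (subst₂ Fin._<_ (sym (inverseˡ u)) (sym (inverseˡ u)) i<j)
  g-mono : ∀ {i j} → i Fin.< j → g i Fin.< g j
  g-mono {i} {j} i<j with ◁-cmp u (v ⟨$⟩ʳ i) (v ⟨$⟩ʳ j)
  ... | tri< p _ _ = p
  ... | tri≈ _ p _ = contradiction
    (trans (sym (inverseˡ v)) (trans (cong (pos v) p) (inverseˡ v))) (Fin.<⇒≢ i<j)
  ... | tri> _ _ p = contradiction
    (subst₂ Fin._<_ (inverseˡ v) (inverseˡ v) (u⊆v _ _ p)) (Fin.<-asym i<j)
  fi≤i : f i Fin.≤ i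
  fi≤i = subst (f i Fin.≤_) (trans (cong (pos u) (inverseʳ v)) (inverseˡ u))
    (increasing⇒inflationary g g-mono (f i))

≈⇒pos : (u v : 𝕊 n) → u ≈ v → ∀ a → pos u a ≡ pos v a
≈⇒pos u v u≈v a = sym (begin
  pos v a                      ≡⟨ cong (pos v) (inverseʳ u) ⟨
  pos v (u ⟨$⟩ʳ pos u a)       ≡⟨ cong (pos v) (u≈v _) ⟩
  pos v (v ⟨$⟩ʳ pos u a)       ≡⟨ inverseˡ v ⟩
  pos u a                      ∎)
  where open ≡-Reasoning

≈⇒◁ : (u v : 𝕊 n) → u ≈ v → ∀ a b → a ◁[ u ] b → a ◁[ v ] b
≈⇒◁ u v u≈v a b = subst₂ Fin._<_ (≈⇒pos u v u≈v a) (≈⇒pos u v u≈v b)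

pos⇒≈ : (u v : 𝕊 n) → (∀ a → pos u a ≡ pos v a) → u ≈ v
pos⇒≈ u v eq = ◁⊆◁⇒≈ u v λ a b → subst₂ Fin._<_ (eq a) (eq b)

≈-refl : (u : 𝕊 n) → u ≈ u
≈-refl u i = refl

≈-sym : (u v : 𝕊 n) → u ≈ v → v ≈ u
≈-sym u v u≈v i = sym (u≈v i)

≈-trans : (u v w : 𝕊 n) → u ≈ v → v ≈ w → u ≈ w
≈-trans u v w u≈v v≈w i = trans (u≈v i) (v≈w i)

≈? : (u v : 𝕊 n) → Dec (u ≈ v)
≈? u v = Fin.all? λ i → u ⟨$⟩ʳ i Fin.≟ v ⟨$⟩ʳ i

-- A missed value could be punched out, leaving an injection into a smaller set.
injective⇒surjective : {f : Fin n → Fin n} → Injective _≡_ _≡_ f → ∀ j → ∃[ i ] f i ≡ j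
injective⇒surjective {ℕ.suc n} {f} f-inj j with Fin.any? (λ i → f i Fin.≟ j)
... | yes p = p
... | no ¬p with Fin.pigeonhole ℕ.≤-refl (λ i → punchOut {i = j} {f i} (λ eq → ¬p (i , sym eq)))
...   | i , i′ , i<i′ , eq = contradiction (f-inj (Fin.punchOut-injective {i = j} _ _ eq)) (Fin.<⇒≢ i<i′)

fromPositions : (f : Fin n → Fin n) → Injective _≡_ _≡_ f → 𝕊 n
fromPositions f f-inj = permutation (proj₁ ∘ surj) f
  (λ a → f-inj (proj₂ (surj (f a)))) (λ i → proj₂ (surj i))
  where surj = injective⇒surjective f-inj

card<n : {P : Pred (Fin n) 0ℓ} (P? : Decidable P) → ∀ a → ¬ P a → card P? ℕ.< n
card<n {n} P? a ¬Pa = subst (card P? ℕ.<_) (card-U n)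
  (card-mono-< P? (λ _ → yes tt) (λ _ _ → tt) a ¬Pa tt)
  where
  card-U : ∀ n → card {n} {U} (λ _ → yes tt) ≡ n
  card-U ℕ.zero    = refl
  card-U (ℕ.suc n) = cong ℕ.suc (card-U n)

-- The position of a letter is the number of letters below it in the given order.
module Linear (_⊏_ : Rel (Fin n) 0ℓ) (⊏-trans : Transitive _⊏_) (⊏-cmp : Trichotomous _≡_ _⊏_) where

  private
    _⊏?_ : ∀ a b → Dec (a ⊏ b)
    a ⊏? b with ⊏-cmp a b
    ... | tri< p _ _ = yes p
    ... | tri≈ p _ _ = no p
    ... | tri> p _ _ = no p

    irrefl : ∀ {a} → ¬ (a ⊏ a)
    irrefl {a} p with ⊏-cmp a a
    ... | tri< _ q _ = q refl
    ... | tri≈ q _ _ = q p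
    ... | tri> _ q _ = q refl

    rank<n : ∀ a → card (_⊏? a) ℕ.< n
    rank<n a = card<n (_⊏? a) a irrefl

    rank : Fin n → Fin n
    rank a = fromℕ< (rank<n a)

    rank-mono : ∀ a b → a ⊏ b → rank a Fin.< rank b
    rank-mono a b a⊏b = subst₂ ℕ._<_ (sym (Fin.toℕ-fromℕ< (rank<n a))) (sym (Fin.toℕ-fromℕ< (rank<n b)))
      (card-mono-< (_⊏? a) (_⊏? b) (λ _ c⊏a → ⊏-trans c⊏a a⊏b) a irrefl a⊏b)

    rank-injective : Injective _≡_ _≡_ rank
    rank-injective {a} {b} eq with ⊏-cmp a b
    ... | tri< p _ _ = contradiction eq (Fin.<⇒≢ (rank-mono a b p))
    ... | tri≈ _ p _ = p
    ... | tri> _ _ p = contradiction (sym eq) (Fin.<⇒≢ (rank-mono b a p))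

  sorted : 𝕊 n
  sorted = fromPositions rank rank-injective

  ⊏⇒◁ : ∀ a b → a ⊏ b → a ◁[ sorted ] b
  ⊏⇒◁ = rank-mono

  ◁⇒⊏ : ∀ a b → a ◁[ sorted ] b → a ⊏ b
  ◁⇒⊏ a b a◁b with ⊏-cmp a b
  ... | tri< p _ _ = p
  ... | tri≈ _ refl _ = contradiction refl (◁⇒≢ sorted a◁b)
  ... | tri> _ _ p = contradiction (rank-mono b a p) (ℕ.<-asym a◁b)

-- Here `r` selects a region of the word and `s` orders the letters inside it. This builds both the
-- united permutation and the listing of a noncrossing partition.
module Lexicographic (r s : Fin n → ℕ)
                     (rs-injective : ∀ {a b} → r a ≡ r b → s a ≡ s b → a ≡ b) where

  _≺_ : Rel (Fin n) 0ℓ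
  a ≺ b = (r a ℕ.< r b) ⊎ (r a ≡ r b × s a ℕ.< s b)

  private
    ≺-trans : Transitive _≺_
    ≺-trans (inj₁ p) (inj₁ q) = inj₁ (ℕ.<-trans p q)
    ≺-trans (inj₁ p) (inj₂ (q , _)) = inj₁ (ℕ.<-≤-trans p (ℕ.≤-reflexive q))
    ≺-trans (inj₂ (p , _)) (inj₁ q) = inj₁ (ℕ.≤-<-trans (ℕ.≤-reflexive p) q)
    ≺-trans (inj₂ (p , p′)) (inj₂ (q , q′)) = inj₂ (trans p q , ℕ.<-trans p′ q′)

    ≺-asym : ∀ {a b} → a ≺ b → ¬ (b ≺ a)
    ≺-asym p q with ≺-trans p q
    ... | inj₁ r = ℕ.<-irrefl refl r
    ... | inj₂ (_ , r) = ℕ.<-irrefl refl r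

    ≺-cmp : Trichotomous _≡_ _≺_
    ≺-cmp a b with ℕ.<-cmp (r a) (r b) | ℕ.<-cmp (s a) (s b)
    ... | tri< p _ _ | _ = tri< (inj₁ p) (λ { refl → ℕ.<-irrefl refl p }) (≺-asym (inj₁ p))
    ... | tri> _ _ p | _ = tri> (≺-asym (inj₁ p)) (λ { refl → ℕ.<-irrefl refl p }) (inj₁ p)
    ... | tri≈ _ p _ | tri< q _ _ = tri< (inj₂ (p , q)) (λ { refl → ℕ.<-irrefl refl q })
        (≺-asym (inj₂ (p , q)))
    ... | tri≈ _ p _ | tri> _ _ q = tri> (≺-asym (inj₂ (sym p , q)))
        (λ { refl → ℕ.<-irrefl refl q }) (inj₂ (sym p , q))
    ... | tri≈ _ p _ | tri≈ _ q _ with refl ← rs-injective p q = tri≈ (λ x → ≺-asym x x) refl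
        (λ x → ≺-asym x x)

  open Linear _≺_ ≺-trans ≺-cmp public
    renaming (⊏⇒◁ to ≺⇒◁; ◁⇒⊏ to ◁⇒≺)

-- Blocks

least : {P : Pred (Fin n) 0ℓ} → Decidable P → ∀ {a} → P a → ∃[ m ] P m × (∀ b → P b → m Fin.≤ b)
least {ℕ.suc n} P? {a} Pa with P? zero
... | yes p = zero , p , λ _ _ → z≤n
least {ℕ.suc n} P? {zero}  Pa | no ¬p = contradiction Pa ¬p
least {ℕ.suc n} P? {suc a} Pa | no ¬p with least (P? ∘ suc) Pa
... | m , Pm , m≤ = suc m , Pm , λ { zero p → contradiction p ¬p ; (suc b) p → s≤s (m≤ b p) }

greatest : {P : Pred (Fin n) 0ℓ} → Decidable P → ∀ {a} → P a → ∃[ m ] P m × (∀ b → P b → b Fin.≤ m)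
greatest {ℕ.suc n} P? {a} Pa with Fin.any? (P? ∘ suc)
... | yes (b , Pb) with greatest (P? ∘ suc) Pb
...   | m , Pm , ≤m = suc m , Pm , λ { zero _ → z≤n ; (suc b) p → s≤s (≤m b p) }
greatest {ℕ.suc n} P? {suc a} Pa | no ¬p = contradiction (a , Pa) ¬p
greatest {ℕ.suc n} P? {zero}  Pa | no ¬p = zero , Pa , λ { zero _ → z≤n ; (suc b) p →
  contradiction (b , p) ¬p }

leftmost : (w : 𝕊 n) {P : Pred (Fin n) 0ℓ} → Decidable P → ∀ {a} → P a →
           ∃[ m ] P m × (∀ b → P b → m ⊴[ w ] b)
leftmost w {P} P? {a} Pa with least (P? ∘ (w ⟨$⟩ʳ_)) (subst P (sym (inverseʳ w)) Pa)
... | p , Pp , p≤ = w ⟨$⟩ʳ p , Pp , λ b Pb →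
  subst (Fin._≤ pos w b) (sym (inverseˡ w)) (p≤ (pos w b) (subst P (sym (inverseʳ w)) Pb))

rightmost : (w : 𝕊 n) {P : Pred (Fin n) 0ℓ} → Decidable P → ∀ {a} → P a →
            ∃[ m ] P m × (∀ b → P b → b ⊴[ w ] m)
rightmost w {P} P? {a} Pa with greatest (P? ∘ (w ⟨$⟩ʳ_)) (subst P (sym (inverseʳ w)) Pa)
... | p , Pp , ≤p = w ⟨$⟩ʳ p , Pp , λ b Pb →
  subst (pos w b Fin.≤_) (sym (inverseˡ w)) (≤p (pos w b) (subst P (sym (inverseʳ w)) Pb))

-- A decreasing factor without maximality: two letters share a block exactly when the factor between
-- them is decreasing, so blocks can be handled without naming the ends of runs.
record Fall (w : 𝕊 n) (a b : Fin n) : Set where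
  constructor fall
  field
    start⊴end  : a ⊴[ w ] b
    decreasing : ∀ c d → a ⊴[ w ] c → c ◁[ w ] d → d ⊴[ w ] b → d Fin.< c

open Fall

Block : 𝕊 n → Rel (Fin n) 0ℓ
Block w a b = Fall w a b ⊎ Fall w b a

abstract

  fall? : (w : 𝕊 n) → ∀ a b → Dec (Fall w a b)
  fall? w a b = map′ (λ (p , q) → fall p q) (λ f → start⊴end f , decreasing f)
    (⊴? w a b ×-dec Fin.all? λ c → Fin.all? λ d →
      ⊴? w a c →-dec (◁? w c d →-dec (⊴? w d b →-dec (d Fin.<? c))))

  block? : (w : 𝕊 n) → ∀ a b → Dec (Block w a b)
  block? w a b = fall? w a b ⊎-dec fall? w b a

fall-within : (w : 𝕊 n) → ∀ {a b c d} → Fall w a b → a ⊴[ w ] c → c ⊴[ w ] d → d ⊴[ w ] b → Fall w c d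
fall-within w f a⊴c c⊴d d⊴b = fall c⊴d λ e g c⊴e e◁g g⊴d →
  decreasing f e g (ℕ.≤-trans a⊴c c⊴e) e◁g (ℕ.≤-trans g⊴d d⊴b)

fall-refl : (w : 𝕊 n) → ∀ a → Fall w a a
fall-refl w a = fall ℕ.≤-refl λ c d a⊴c c◁d d⊴a →
  contradiction (ℕ.<-≤-trans c◁d (ℕ.≤-trans d⊴a a⊴c)) (ℕ.<-irrefl refl)

fall-trans : (w : 𝕊 n) → ∀ {a b c} → Fall w a b → Fall w b c → Fall w a c
fall-trans w {a} {b} {c} f g = fall (ℕ.≤-trans (start⊴end f) (start⊴end g)) dec
  where
  dec : ∀ x y → a ⊴[ w ] x → x ◁[ w ] y → y ⊴[ w ] c → y Fin.< x
  dec x y a⊴x x◁y y⊴c with ℕ.≤-<-connex (toℕ (pos w y)) (toℕ (pos w b))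
                         | ℕ.≤-<-connex (toℕ (pos w b)) (toℕ (pos w x))
  ... | inj₁ y⊴b | _        = decreasing f x y a⊴x x◁y y⊴b
  ... | inj₂ b◁y | inj₁ b⊴x = decreasing g x y b⊴x x◁y y⊴c
  ... | inj₂ b◁y | inj₂ x◁b = ℕ.<-trans
    (decreasing g b y ℕ.≤-refl b◁y y⊴c) (decreasing f x b a⊴x x◁b ℕ.≤-refl)

block-refl : (w : 𝕊 n) → ∀ {a} → Block w a a
block-refl w {a} = inj₁ (fall-refl w a)

block-sym : (w : 𝕊 n) → ∀ {a b} → Block w a b → Block w b a
block-sym w = swap

block-trans : (w : 𝕊 n) → ∀ {a b c} → Block w a b → Block w b c → Block w a c
block-trans w (inj₁ f) (inj₁ g) = inj₁ (fall-trans w f g)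
block-trans w (inj₂ f) (inj₂ g) = inj₂ (fall-trans w g f)
block-trans w {a} {b} {c} (inj₁ f) (inj₂ g) with ℕ.≤-total (toℕ (pos w a)) (toℕ (pos w c))
... | inj₁ a⊴c = inj₁ (fall-within w f ℕ.≤-refl a⊴c (start⊴end g))
... | inj₂ c⊴a = inj₂ (fall-within w g ℕ.≤-refl c⊴a (start⊴end f))
block-trans w {a} {b} {c} (inj₂ f) (inj₁ g) with ℕ.≤-total (toℕ (pos w a)) (toℕ (pos w c))
... | inj₁ a⊴c = inj₁ (fall-within w g (start⊴end f) a⊴c ℕ.≤-refl)
... | inj₂ c⊴a = inj₂ (fall-within w f (start⊴end g) c⊴a ℕ.≤-refl)

block⇒fall : (w : 𝕊 n) → ∀ {a b} → Block w a b → a ⊴[ w ] b → Fall w a b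
block⇒fall w (inj₁ f) a⊴b = f
block⇒fall w (inj₂ f) a⊴b with refl ← ⊴-antisym w a⊴b (start⊴end f) = f

block-decreasing : (w : 𝕊 n) → ∀ {a b} → Block w a b → a ◁[ w ] b → b Fin.< a
block-decreasing w {a} {b} blk a◁b =
  decreasing (block⇒fall w blk (ℕ.<⇒≤ a◁b)) a b ℕ.≤-refl a◁b ℕ.≤-refl

block-order : (w : 𝕊 n) → ∀ {a b} → Block w a b → b Fin.< a → a ◁[ w ] b
block-order w {a} {b} blk b<a with ◁-cmp w a b
... | tri< p _ _ = p
... | tri≈ _ refl _ = contradiction refl (Fin.<⇒≢ b<a)
... | tri> _ _ p = contradiction (block-decreasing w (block-sym w blk) p) (Fin.<-asym b<a)

block-convexˡ : (w : 𝕊 n) → ∀ {a b c} → Block w a b → a ⊴[ w ] c → c ⊴[ w ] b → Block w a c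
block-convexˡ w blk a⊴c c⊴b =
  inj₁ (fall-within w (block⇒fall w blk (ℕ.≤-trans a⊴c c⊴b)) ℕ.≤-refl a⊴c c⊴b)

block-convexʳ : (w : 𝕊 n) → ∀ {a b c} → Block w a b → a ⊴[ w ] c → c ⊴[ w ] b → Block w c b
block-convexʳ w blk a⊴c c⊴b =
  inj₁ (fall-within w (block⇒fall w blk (ℕ.≤-trans a⊴c c⊴b)) a⊴c c⊴b ℕ.≤-refl)

adjacent⇒fall : (w : 𝕊 n) → ∀ {a b} → Adjacent w a b → b Fin.< a → Fall w a b
adjacent⇒fall w {a} {b} adj b<a = fall (ℕ.<⇒≤ (adjacent⇒◁ w adj)) λ c d a⊴c c◁d d⊴b →
  subst₂ Fin._<_ (sym (⊴-antisym w d⊴b (adjacent-⊴ʳ w adj (ℕ.≤-<-trans a⊴c c◁d))))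
                 (⊴-antisym w a⊴c (adjacent-⊴ˡ w adj (ℕ.<-≤-trans c◁d d⊴b)))
                 b<a

outside-block : (w : 𝕊 n) → ∀ {a b c} → Block w a b → ¬ Block w a c → a ◁[ w ] c → b ◁[ w ] c
outside-block w {a} {b} {c} blk ¬blk a◁c with ◁-cmp w b c
... | tri< p _ _ = p
... | tri≈ _ refl _ = contradiction blk ¬blk
... | tri> _ _ p = contradiction (block-convexˡ w blk (ℕ.<⇒≤ a◁c) (ℕ.<⇒≤ p)) ¬blk

≈⇒block : (u v : 𝕊 n) → u ≈ v → ∀ {a b} → Block u a b → Block v a b
≈⇒block u v u≈v = [ inj₁ ∘ go , inj₂ ∘ go ]′
  where
  eq = ≈⇒pos u v u≈v
  go : ∀ {a b} → Fall u a b → Fall v a b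
  go {a} {b} (fall p f) = fall (subst₂ Fin._≤_ (eq a) (eq b) p) λ c d a⊴c c◁d d⊴b →
    f c d (subst₂ Fin._≤_ (sym (eq a)) (sym (eq c)) a⊴c)
          (subst₂ Fin._<_ (sym (eq c)) (sym (eq d)) c◁d)
          (subst₂ Fin._≤_ (sym (eq d)) (sym (eq b)) d⊴b)

sameBlock⇒block : (w : 𝕊 n) → ∀ {i j} → SameBlock w i j → Block w i j
sameBlock⇒block w {i} {j} (a , b , run , (a≤i , i≤b) , (a≤j , j≤b)) =
  [ (λ i⊴j → inj₁ (within a≤i i⊴j j≤b)) , (λ j⊴i → inj₂ (within a≤j j⊴i i≤b)) ]′
    (ℕ.≤-total (toℕ (pos w i)) (toℕ (pos w j)))
  where
  within : ∀ {i j} → a Fin.≤ pos w i → i ⊴[ w ] j → pos w j Fin.≤ b → Fall w i j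
  within a≤i i⊴j j≤b = fall i⊴j λ c d i⊴c c◁d d⊴j → subst₂ Fin._<_ (inverseʳ w) (inverseʳ w)
    (MaximalDecreasingRun.decreasing run (ℕ.≤-trans a≤i i⊴c) c◁d (ℕ.≤-trans d⊴j j≤b))

-- The maximal run through `i` goes from the leftmost letter that falls to `i` to the rightmost
-- letter to which `i` falls.
block⇒sameBlock : (w : 𝕊 n) → ∀ {i j} → Block w i j → SameBlock w i j
block⇒sameBlock {n} w {i} {j} blk
  with leftmost w (λ s → fall? w s i) (fall-refl w i) | rightmost w (fall? w i) (fall-refl w i)
... | s , s↓i , s⊴ | t , i↓t , ⊴t = pos w s , pos w t , run , (start⊴end s↓i , start⊴end i↓t) , j∈ blk
  where
  toDec : ∀ {a b} → Fall w a b → DecreasingOn w (pos w a) (pos w b)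
  toDec f a≤p p<q q≤b = decreasing f _ _ (subst (_ Fin.≤_) (sym (inverseˡ w)) a≤p)
    (subst₂ Fin._<_ (sym (inverseˡ w)) (sym (inverseˡ w)) p<q)
    (subst (Fin._≤ _) (sym (inverseˡ w)) q≤b)
  fromDec : ∀ {a b} p q → DecreasingOn w p q → p Fin.≤ pos w a → a ⊴[ w ] b → pos w b Fin.≤ q → Fall w a b
  fromDec p q f p≤a a⊴b b≤q = fall a⊴b λ c d a⊴c c◁d d⊴b → subst₂ Fin._<_ (inverseʳ w) (inverseʳ w)
    (f (ℕ.≤-trans p≤a a⊴c) c◁d (ℕ.≤-trans d⊴b b≤q))
  run : MaximalDecreasingRun w (pos w s) (pos w t)
  run = record
    { nonempty   = ℕ.≤-trans (start⊴end s↓i) (start⊴end i↓t)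
    ; decreasing = toDec (fall-trans w s↓i i↓t)
    ; maximal    = λ {a′} {b′} a′≤s t≤b′ f →
        let a′≤i = ℕ.≤-trans a′≤s (start⊴end s↓i)
            i≤b′ = ℕ.≤-trans (start⊴end i↓t) t≤b′
        in Fin.≤-antisym a′≤s (subst (pos w s Fin.≤_) (inverseˡ w) (s⊴ (w ⟨$⟩ʳ a′)
             (fromDec a′ b′ f (ℕ.≤-reflexive (cong toℕ (sym (inverseˡ w))))
               (subst (Fin._≤ pos w i) (sym (inverseˡ w)) a′≤i) i≤b′)))
         , Fin.≤-antisym (subst (Fin._≤ pos w t) (inverseˡ w) (⊴t (w ⟨$⟩ʳ b′)
             (fromDec a′ b′ f a′≤i (subst (pos w i Fin.≤_) (sym (inverseˡ w)) i≤b′)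
               (ℕ.≤-reflexive (cong toℕ (inverseˡ w)))))) t≤b′
    }
  j∈ : Block w i j → InRun w (pos w s) (pos w t) j
  j∈ (inj₁ f) = ℕ.≤-trans (start⊴end s↓i) (start⊴end f) , ⊴t j f
  j∈ (inj₂ f) = s⊴ j f , ℕ.≤-trans (start⊴end f) (start⊴end i↓t)

-- The cones and the combinatorial order

half-positive : ∀ {ε} → 0ℚ ℚ.< ε → 0ℚ ℚ.< ½ ℚ.* ε
half-positive {ε} 0<ε = subst (ℚ._< ½ ℚ.* ε) (ℚ.*-zeroʳ ½) (ℚ.*-monoʳ-<-pos ½ 0<ε)

half+half : ∀ ε → ½ ℚ.* ε ℚ.+ ½ ℚ.* ε ≡ ε
half+half ε = trans (sym (ℚ.*-distribʳ-+ ε ½ ½)) (ℚ.*-identityˡ ε)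

p+[q-p]≡q : ∀ p q → p ℚ.+ (q ℚ.- p) ≡ q
p+[q-p]≡q p q = begin
  p ℚ.+ (q ℚ.- p)         ≡⟨ cong (p ℚ.+_) (ℚ.+-comm q (ℚ.- p)) ⟩
  p ℚ.+ (ℚ.- p ℚ.+ q)     ≡⟨ ℚ.+-assoc p (ℚ.- p) q ⟨
  p ℚ.- p ℚ.+ q           ≡⟨ cong (ℚ._+ q) (ℚ.+-inverseʳ p) ⟩
  0ℚ ℚ.+ q                ≡⟨ ℚ.+-identityˡ q ⟩
  q                       ∎
  where open ≡-Reasoning

p≤∣p∣ : ∀ p → p ℚ.≤ ℚ.∣ p ∣
p≤∣p∣ p with ℚ.≤-total 0ℚ p
... | inj₁ 0≤p = ℚ.≤-reflexive (sym (ℚ.0≤p⇒∣p∣≡p 0≤p))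
... | inj₂ p≤0 = ℚ.≤-trans p≤0 (ℚ.0≤∣p∣ p)

≃ᴿ⇒≤ᴿ : ∀ {x y} → x ≃ᴿ y → x ≤ᴿ y
≃ᴿ⇒≤ᴿ {x} {y} x≃y ε 0<ε with x≃y ε 0<ε
... | N , h = N , λ n N≤n → begin
  seq x n                             ≡⟨ p+[q-p]≡q (seq y n) (seq x n) ⟨
  seq y n ℚ.+ (seq x n ℚ.- seq y n)   ≤⟨ ℚ.+-monoʳ-≤ (seq y n) (ℚ.≤-trans (p≤∣p∣ _) (ℚ.<⇒≤ (h n N≤n))) ⟩
  seq y n ℚ.+ ε                       ∎
  where open ℚ.≤-Reasoning

≤ᴿ-trans : ∀ {x y z} → x ≤ᴿ y → y ≤ᴿ z → x ≤ᴿ z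
≤ᴿ-trans {x} {y} {z} x≤y y≤z ε 0<ε
  with x≤y (½ ℚ.* ε) (half-positive 0<ε) | y≤z (½ ℚ.* ε) (half-positive 0<ε)
... | M , f | N , g = M ℕ.⊔ N , λ n M⊔N≤n → begin
  seq x n                                ≤⟨ f n (ℕ.m⊔n≤o⇒m≤o M N M⊔N≤n) ⟩
  seq y n ℚ.+ ½ ℚ.* ε                    ≤⟨ ℚ.+-monoˡ-≤ (½ ℚ.* ε) (g n (ℕ.m⊔n≤o⇒n≤o M N M⊔N≤n)) ⟩
  seq z n ℚ.+ ½ ℚ.* ε ℚ.+ ½ ℚ.* ε        ≡⟨ ℚ.+-assoc (seq z n) (½ ℚ.* ε) (½ ℚ.* ε) ⟩
  seq z n ℚ.+ (½ ℚ.* ε ℚ.+ ½ ℚ.* ε)      ≡⟨ cong (seq z n ℚ.+_) (half+half ε) ⟩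
  seq z n ℚ.+ ε                          ∎
  where open ℚ.≤-Reasoning

constᴿ : ℚ → ℝ
constᴿ q = mkℝ (λ _ → q) λ ε 0<ε → 0 , λ _ _ _ _ → subst (ℚ._< ε) (sym (cong ℚ.∣_∣ (ℚ.+-inverseʳ q))) 0<ε

constᴿ-cong : ∀ {p q} → p ≡ q → constᴿ p ≃ᴿ constᴿ q
constᴿ-cong {p} refl ε 0<ε = 0 , λ _ _ → subst (ℚ._< ε) (sym (cong ℚ.∣_∣ (ℚ.+-inverseʳ p))) 0<ε

constᴿ-mono : ∀ {p q} → p ℚ.≤ q → constᴿ p ≤ᴿ constᴿ q
constᴿ-mono {p} {q} p≤q ε 0<ε = 0 , λ _ _ → begin
  p           ≡⟨ ℚ.+-identityʳ p ⟨
  p ℚ.+ 0ℚ    ≤⟨ ℚ.+-mono-≤ p≤q (ℚ.<⇒≤ 0<ε) ⟩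
  q ℚ.+ ε     ∎
  where open ℚ.≤-Reasoning

constᴿ-cancel : ∀ {p q} → constᴿ p ≤ᴿ constᴿ q → p ℚ.≤ q
constᴿ-cancel {p} {q} p≤q with p ℚ.≤? q
... | yes h = h
... | no ¬h with ℚ.<-dense (ℚ.≰⇒> ¬h)
-- If `q < p`, the tolerance `m - q` for a rational `m` strictly between them is violated.
...   | m , q<m , m<p with p≤q (m ℚ.- q) (subst (ℚ._< m ℚ.- q) (ℚ.+-inverseʳ q) (ℚ.+-monoˡ-< (ℚ.- q) q<m))
...     | N , h = contradiction (ℚ.<-≤-trans m<p (subst (p ℚ.≤_) (p+[q-p]≡q q m) (h N ℕ.≤-refl)))
  (ℚ.<-irrefl refl)

ι : ℕ → ℚ
ι ℕ.zero    = 0ℚ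
ι (ℕ.suc k) = 1ℚ ℚ.+ ι k

ι-step : ∀ k → ι k ℚ.< ι (ℕ.suc k)
ι-step k = subst (ℚ._< ι (ℕ.suc k)) (ℚ.+-identityˡ (ι k)) (ℚ.+-monoˡ-< (ι k) (ℚ.positive⁻¹ 1ℚ))

ι-mono-< : ∀ {k l} → k ℕ.< l → ι k ℚ.< ι l
ι-mono-< {k} k<l = go (ℕ.≤⇒≤′ k<l)
  where
  go : ∀ {l} → ℕ.suc k ℕ.≤′ l → ι k ℚ.< ι l
  go ℕ.≤′-refl              = ι-step k
  go (ℕ.≤′-step {l} k<l) = ℚ.<-trans (go k<l) (ι-step l)

ℚsum-mono-≤ : {f g : Fin n → ℚ} → (∀ i → f i ℚ.≤ g i) → ℚΣ.sum f ℚ.≤ ℚΣ.sum g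
ℚsum-mono-≤ {ℕ.zero}  f≤g = ℚ.≤-refl
ℚsum-mono-≤ {ℕ.suc n} f≤g = ℚ.+-mono-≤ (f≤g zero) (ℚsum-mono-≤ (f≤g ∘ suc))

ℚsum-mono-< : {f g : Fin n → ℚ} → Fin n → (∀ i → f i ℚ.< g i) → ℚΣ.sum f ℚ.< ℚΣ.sum g
ℚsum-mono-< {ℕ.suc n} _ f<g = ℚ.+-mono-<-≤ (f<g zero) (ℚsum-mono-≤ (ℚ.<⇒≤ ∘ f<g ∘ suc))

ℚsum-neg : (f : Fin n → ℚ) → ℚΣ.sum (λ i → ℚ.- f i) ≡ ℚ.- ℚΣ.sum f
ℚsum-neg {ℕ.zero}  f = refl
ℚsum-neg {ℕ.suc n} f = trans (cong (ℚ.- f zero ℚ.+_) (ℚsum-neg (f ∘ suc)))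
  (sym (ℚ.neg-distrib-+ (f zero) _))

-- Σ_b (f a − f b): the values of f shifted and scaled to have sum zero.
centred : (Fin n → ℕ) → Fin n → ℚ
centred f a = ℚΣ.sum λ b → ι (f a) ℚ.- ι (f b)

-- The summand is antisymmetric in `a` and `b`: exchanging the order of summation identifies the two
-- halves of the double sum, which then cancel.
centred-sum : (f : Fin n → ℕ) → ℚΣ.sum (centred f) ≡ 0ℚ
centred-sum {n} f = begin
  Σℚ (λ a → Σℚ λ b → F a ℚ.- F b)
    ≡⟨ ℚΣ.sum-cong-≗ {n} (λ a → ℚΣ.∑-distrib-+ {n} (λ _ → F a) (λ b → ℚ.- F b)) ⟩
  Σℚ (λ a → Σℚ (λ _ → F a) ℚ.+ Σℚ (λ b → ℚ.- F b))
    ≡⟨ ℚΣ.∑-distrib-+ {n} (λ a → Σℚ λ _ → F a) (λ _ → Σℚ λ b → ℚ.- F b) ⟩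
  S ℚ.+ Σℚ (λ _ → Σℚ λ b → ℚ.- F b)
    ≡⟨ cong (S ℚ.+_) (ℚΣ.sum-cong-≗ {n} {λ _ → Σℚ λ b → ℚ.- F b} {λ _ → ℚ.- Σℚ F} (λ _ → ℚsum-neg F)) ⟩
  S ℚ.+ Σℚ (λ _ → ℚ.- Σℚ F)
    ≡⟨ cong (S ℚ.+_) (ℚsum-neg {n} (λ _ → Σℚ F)) ⟩
  S ℚ.- Σℚ (λ _ → Σℚ F)
    ≡⟨ cong (λ T → S ℚ.- T) (ℚΣ.∑-comm {n} {n} (λ _ b → F b)) ⟩
  S ℚ.- S
    ≡⟨ ℚ.+-inverseʳ S ⟩
  0ℚ ∎
  where
  open ≡-Reasoning
  Σℚ : (Fin n → ℚ) → ℚ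
  Σℚ = ℚΣ.sum
  F : Fin n → ℚ
  F a = ι (f a)
  S : ℚ
  S = Σℚ λ a → Σℚ λ _ → F a

centred-cong : (f : Fin n → ℕ) → ∀ {a b} → f a ≡ f b → centred f a ≡ centred f b
centred-cong {n} f eq = cong (λ k → ℚΣ.sum {n} λ c → ι k ℚ.- ι (f c)) eq

centred-mono-< : (f : Fin n → ℕ) → ∀ {a b} → f a ℕ.< f b → centred f a ℚ.< centred f b
centred-mono-< f {a} fa<fb = ℚsum-mono-< a λ c → ℚ.+-monoˡ-< (ℚ.- ι (f c)) (ι-mono-< fa<fb)

foldr-constᴿ : (f : Fin n → ℚ) → ∀ k → seq (foldr _+ᴿ_ 0ᴿ (constᴿ ∘ f)) k ≡ ℚΣ.sum f
foldr-constᴿ {ℕ.zero}  f k = refl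
foldr-constᴿ {ℕ.suc n} f k = cong (f zero ℚ.+_) (foldr-constᴿ (f ∘ suc) k)

infix 4 _⊑_

record _⊑_ (u v : 𝕊 n) : Set where
  field
    inversion : ∀ a b → b Fin.< a → a ◁[ u ] b → a ◁[ v ] b
    block     : ∀ {a b} → Block u a b → Block v a b

open _⊑_

-- Between a and b the letters drop from ≥ a to < a somewhere, at a descent (e , d).
cone-inversion : (w : 𝕊 n) (x : Vector ℝ n) → Cone w x → ∀ a b → b Fin.< a → a ◁[ w ] b → x a ≤ᴿ x b
cone-inversion {n} w x cone a = go a (Fin.<-wellFounded a)
  where
  open Cone cone
  equal : ∀ {i j} → Block w i j → x i ≤ᴿ x j
  equal {i} {j} blk = ≃ᴿ⇒≤ᴿ {x i} {x j} (constant (block⇒sameBlock w blk))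
  go : ∀ a → Acc Fin._<_ a → ∀ b → b Fin.< a → a ◁[ w ] b → x a ≤ᴿ x b
  go a (acc rec) b b<a a◁b with crossing w (λ c → a Fin.≤? c) a◁b ℕ.≤-refl (ℕ.<⇒≱ b<a)
  ... | e , d , adj , a⊴e , d⊴b , a≤e , a≰d = ≤ᴿ-trans {x a} {x d} {x b} xa≤xd xd≤xb
    where
    d<a : d Fin.< a
    d<a = ℕ.≰⇒> a≰d
    d~e : Block w d e
    d~e = inj₂ (adjacent⇒fall w adj (ℕ.<-≤-trans d<a a≤e))
    a◁d : a ◁[ w ] d
    a◁d = ℕ.≤-<-trans a⊴e (adjacent⇒◁ w adj)
    xa≤xd : x a ≤ᴿ x d
    xa≤xd with block? w d a
    ... | yes d~a = equal (block-sym w d~a)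
    ... | no  d≁a = left d<a (Fin.≤∧≢⇒< a≤e λ { refl → d≁a d~e })
                      (block⇒sameBlock w d~e) (d≁a ∘ sameBlock⇒block w) a◁d
    -- If `b < d`, then `(d , b)` is an inversion with a smaller top and recursion applies. If
    -- `d < b`, then `d < b < e` with `d` and `e` in one block, and the cone condition compares `d`
    -- with `b` directly.
    xd≤xb : x d ≤ᴿ x b
    xd≤xb with <⊎≡⊎> d b
    ... | inj₂ (inj₁ refl) = equal (block-refl w)
    ... | inj₂ (inj₂ b<d)  = go d (rec d<a) b b<d (⊴⇒◁ w d⊴b λ { refl → ℕ.<-irrefl refl b<d })
    ... | inj₁ d<b with block? w d b
    ...   | yes d~b = equal d~b
    ...   | no  d≁b = right d<b (ℕ.<-≤-trans b<a a≤e)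
                        (block⇒sameBlock w d~e) (d≁b ∘ sameBlock⇒block w)
                        (⊴⇒◁ w d⊴b λ { refl → ℕ.<-irrefl refl d<b })

⊑⇒≼ : (u v : 𝕊 n) → u ⊑ v → u ≼ v
⊑⇒≼ u v u⊑v {x} cone = record
  { sum-zero = sum-zero
  ; constant = constant ∘ up
  ; left     = λ {i} {k} i<k k<j i~j i≁k k◁i → inv k i i<k k◁i
  -- The inversion comes from the larger block-mate `j`: as `k` is outside the block, `j` also
  -- stands to the left of `k`.
  ; right    = λ {i} {k} {j} i<k k<j i~j i≁k i◁k → ≤ᴿ-trans {x i} {x j} {x k}
      (≃ᴿ⇒≤ᴿ {x i} {x j} (constant (up i~j)))
      (inv j k k<j (outside-block u (sameBlock⇒block u i~j) (i≁k ∘ block⇒sameBlock u) i◁k))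
  }
  where
  open Cone cone
  up : ∀ {i j} → SameBlock u i j → SameBlock v i j
  up = block⇒sameBlock v ∘ block u⊑v ∘ sameBlock⇒block u
  inv : ∀ a b → b Fin.< a → a ◁[ u ] b → x a ≤ᴿ x b
  inv a b b<a a◁b = cone-inversion v x cone a b b<a (inversion u⊑v a b b<a a◁b)

module TestVector (w : 𝕊 n) where

  before? : ∀ a b → Dec ((b ◁[ w ] a) × ¬ Block w b a)
  before? a b = ◁? w b a ×-dec ¬? (block? w b a)

  -- Leaving out the letters of the own block makes the count constant on blocks, while it still
  -- grows strictly from block to block.
  height : Fin n → ℕ
  height a = card (before? a)

  height-mono-< : ∀ {a b} → a ◁[ w ] b → ¬ Block w a b → height a ℕ.< height b
  height-mono-< {a} {b} a◁b a≁b = card-mono-< (before? a) (before? b)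
    (λ c (c◁a , c≁a) → ℕ.<-trans c◁a a◁b ,
      λ c~b → c≁a (block-convexˡ w c~b (ℕ.<⇒≤ c◁a) (ℕ.<⇒≤ a◁b)))
    a (λ (a◁a , _) → ℕ.<-irrefl refl a◁a) (a◁b , a≁b)

  height-cong : ∀ {a b} → Block w a b → height a ≡ height b
  height-cong {a} {b} a~b = card-cong (before? a) (before? b) (shift a~b) (shift (block-sym w a~b))
    where
    shift : ∀ {a b} → Block w a b → ∀ c → (c ◁[ w ] a) × ¬ Block w c a → (c ◁[ w ] b) × ¬ Block w c b
    shift {a} {b} a~b c (c◁a , c≁a) = c◁b , c≁b
      where
      c≁b : ¬ Block w c b
      c≁b c~b = c≁a (block-trans w c~b (block-sym w a~b))
      c◁b : c ◁[ w ] b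
      c◁b with ◁-cmp w c b
      ... | tri< p _ _ = p
      ... | tri≈ _ refl _ = contradiction (block-refl w) c≁b
      ... | tri> _ _ b◁c = contradiction (block-convexʳ w (block-sym w a~b) (ℕ.<⇒≤ b◁c) (ℕ.<⇒≤ c◁a)) c≁a

  vector : Vector ℝ n
  vector = constᴿ ∘ centred height

  height-≤ : ∀ {a b} → vector a ≤ᴿ vector b → height a ≤ height b
  height-≤ va≤vb = ℕ.≮⇒≥ λ hb<ha →
    ℚ.<-irrefl refl (ℚ.<-≤-trans (centred-mono-< height hb<ha) (constᴿ-cancel va≤vb))

  vector∈cone : Cone w vector
  vector∈cone = record
    { sum-zero = λ ε 0<ε → 0 , λ k _ → subst (ℚ._< ε) (sym (cong (λ q → ℚ.∣ q ℚ.- 0ℚ ∣)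
        (trans (foldr-constᴿ (centred height) k) (centred-sum height)))) 0<ε
    ; constant = λ i~j → constᴿ-cong (centred-cong height (height-cong (sameBlock⇒block w i~j)))
    ; left     = λ _ _ _ i≁k k◁i → ordered k◁i (i≁k ∘ block⇒sameBlock w ∘ block-sym w)
    ; right    = λ _ _ _ i≁k i◁k → ordered i◁k (i≁k ∘ block⇒sameBlock w)
    }
    where
    ordered : ∀ {a b} → a ◁[ w ] b → ¬ Block w a b → vector a ≤ᴿ vector b
    ordered a◁b a≁b = constᴿ-mono (ℚ.<⇒≤ (centred-mono-< height (height-mono-< a◁b a≁b)))

-- By hypothesis the test vector of `v` lies in `Cone u`. An inversion or a block of `u` missing in
-- `v` would impose an inequality that its strictly increasing heights refute.
≼⇒⊑ : (u v : 𝕊 n) → u ≼ v → u ⊑ v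
≼⇒⊑ u v u≼v = record
  { inversion = inv
  ; block     = blk
  }
  where
  open TestVector v
  cone : Cone u vector
  cone = u≼v vector∈cone
  inv : ∀ a b → b Fin.< a → a ◁[ u ] b → a ◁[ v ] b
  inv a b b<a a◁b with ◁-cmp v a b
  ... | tri< p _ _ = p
  ... | tri≈ _ refl _ = contradiction b<a (ℕ.<-irrefl refl)
  ... | tri> _ _ b◁a = contradiction (height-≤ (cone-inversion u vector cone a b b<a a◁b))
    (ℕ.<⇒≱ (height-mono-< b◁a λ b~a → Fin.<-asym b<a (block-decreasing v b~a b◁a)))
  blk : ∀ {a b} → Block u a b → Block v a b
  blk {a} {b} a~b with block? v a b | ◁-cmp v a b
  ... | yes p | _ = p
  ... | no ¬p | tri≈ _ refl _ = block-refl v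
  ... | no ¬p | tri< a◁b _ _ = contradiction (height-≤
      (≃ᴿ⇒≤ᴿ {vector b} {vector a} (Cone.constant cone (block⇒sameBlock u (block-sym u a~b)))))
    (ℕ.<⇒≱ (height-mono-< a◁b ¬p))
  ... | no ¬p | tri> _ _ b◁a = contradiction (height-≤
      (≃ᴿ⇒≤ᴿ {vector a} {vector b} (Cone.constant cone (block⇒sameBlock u a~b))))
    (ℕ.<⇒≱ (height-mono-< b◁a (¬p ∘ block-sym v)))

-- Ranks

≈⇒⊑ : (u v : 𝕊 n) → u ≈ v → u ⊑ v
≈⇒⊑ u v u≈v = record
  { inversion = λ a b _ → ≈⇒◁ u v u≈v a b
  ; block     = ≈⇒block u v u≈v
  }

⊑-antisym : {u v : 𝕊 n} → u ⊑ v → v ⊑ u → u ≈ v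
⊑-antisym {u = u} {v} u⊑v v⊑u = ◁⊆◁⇒≈ u v agree
  where
  agree : ∀ a b → a ◁[ u ] b → a ◁[ v ] b
  agree a b a◁b with <⊎≡⊎> a b
  ... | inj₂ (inj₁ refl) = contradiction a◁b (ℕ.<-irrefl refl)
  ... | inj₂ (inj₂ b<a) = inversion u⊑v a b b<a a◁b
  ... | inj₁ a<b with ◁-cmp v a b
  ...   | tri< p _ _ = p
  ...   | tri≈ _ refl _ = contradiction a◁b (ℕ.<-irrefl refl)
  ...   | tri> _ _ b◁a = contradiction (inversion v⊑u b a a<b b◁a) (ℕ.<-asym a◁b)

-- The letters that are not the least of their block; there is one for each descent.
NonMin : 𝕊 n → Pred (Fin n) 0ℓ
NonMin w a = ∃[ b ] (b Fin.< a) × Block w a b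

nonMin? : (w : 𝕊 n) → Decidable (NonMin w)
nonMin? w a = Fin.any? λ b → (b Fin.<? a) ×-dec block? w a b

nonMin⇒descent : (w : 𝕊 n) → ∀ {a} → NonMin w a → ∃[ b ] Adjacent w a b × (b Fin.< a)
nonMin⇒descent w (b , b<a , a~b) with successor w (block-order w a~b b<a)
... | c , adj , c⊴b = c , adj ,
  block-decreasing w (block-convexˡ w a~b (ℕ.<⇒≤ (adjacent⇒◁ w adj)) c⊴b) (adjacent⇒◁ w adj)

descent⇒nonMin : (w : 𝕊 n) → ∀ {a b} → Adjacent w a b → b Fin.< a → NonMin w a
descent⇒nonMin w adj b<a = _ , b<a , inj₁ (adjacent⇒fall w adj b<a)

-- Descents are counted at their larger letter. `P` stays arbitrary because two descriptions of
-- these letters are needed: `NonMin` for the order and `HasRight` for hopping.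
des≡card : (w : 𝕊 n) {P : Pred (Fin n) 0ℓ} (P? : Decidable P) →
           (∀ {a b} → Adjacent w a b → b Fin.< a → P a) →
           (∀ {a} → P a → ∃[ b ] Adjacent w a b × (b Fin.< a)) → des w ≡ card P?
des≡card {n} w {P} P? to from = begin
  des w                    ≡⟨ length-filter-tabulate (isDescent? w) (λ p → p) ⟩
  card (isDescent? w)      ≡⟨ card-cong (isDescent? w) (P? ∘ (w ⟨$⟩ʳ_)) to′ from′ ⟩
  card (P? ∘ (w ⟨$⟩ʳ_))    ≡⟨ sum-permute (𝟙 ∘ P?) w ⟨
  card P?                  ∎
  where
  open ≡-Reasoning
  to′ : ∀ p → IsDescent w p → P (w ⟨$⟩ʳ p)
  to′ p (q , q≡1+p , wq<wp) = to
    (trans (cong toℕ (inverseˡ w)) (trans q≡1+p (cong (ℕ.suc ∘ toℕ) (sym (inverseˡ w))))) wq<wp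
  from′ : ∀ p → P (w ⟨$⟩ʳ p) → IsDescent w p
  from′ p Pwp with from Pwp
  ... | b , adj , b<wp = pos w b , trans adj (cong (ℕ.suc ∘ toℕ) (inverseˡ w)) ,
    subst (Fin._< w ⟨$⟩ʳ p) (sym (inverseʳ w)) b<wp

des≡nonMin : (w : 𝕊 n) → des w ≡ card (nonMin? w)
des≡nonMin w = des≡card w (nonMin? w) (descent⇒nonMin w) (nonMin⇒descent w)

blockMin : (w : 𝕊 n) → ∀ a → ∃[ m ] Block w a m × ¬ NonMin w m
blockMin w a = go a (Fin.<-wellFounded a)
  where
  go : ∀ a → Acc Fin._<_ a → ∃[ m ] Block w a m × ¬ NonMin w m
  go a (acc rec) with nonMin? w a
  ... | no ¬p = a , block-refl w , ¬p
  ... | yes (b , b<a , a~b) with go b (rec b<a)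
  ...   | m , b~m , ¬p = m , block-trans w a~b b~m , ¬p

blockMin-unique : (w : 𝕊 n) → ∀ {a b} → Block w a b → ¬ NonMin w a → ¬ NonMin w b → a ≡ b
blockMin-unique w {a} {b} a~b ¬a ¬b with <⊎≡⊎> a b
... | inj₁ a<b        = contradiction (a , a<b , block-sym w a~b) ¬b
... | inj₂ (inj₁ eq)  = eq
... | inj₂ (inj₂ b<a) = contradiction (b , b<a , a~b) ¬a

nonMin-mono : {u v : 𝕊 n} → u ⊑ v → ∀ a → NonMin u a → NonMin v a
nonMin-mono u⊑v a (b , b<a , a~b) = b , b<a , block u⊑v a~b

-- The minimum of a block of `u` is now also the minimum of its block in `v`, so no block of `v`
-- contains two blocks of `u`. Adjacent letters of `v` are then ordered alike in `u`: a descent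
-- because it lies in a common block, an ascent because `u` has no inversions beyond those of `v`.
sameNonMin⇒≈ : {u v : 𝕊 n} → u ⊑ v → (∀ a → NonMin v a → NonMin u a) → u ≈ v
sameNonMin⇒≈ {u = u} {v} u⊑v v⇒u = ≈-sym v u (◁⊆◁⇒≈ v u (adjacent-agree⇒◁ u v agree))
  where
  v⇒u-block : ∀ {a b} → Block v a b → Block u a b
  v⇒u-block {a} {b} a~b with blockMin u a | blockMin u b
  ... | c , a~c , c-min | d , b~d , d-min
    with refl ← blockMin-unique v (block-trans v (block-sym v (block u⊑v a~c))
      (block-trans v a~b (block u⊑v b~d)))
                  (c-min ∘ v⇒u c) (d-min ∘ v⇒u d) = block-trans u a~c (block-sym u b~d)
  agree : ∀ {a b} → Adjacent v a b → a ◁[ u ] b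
  agree {a} {b} adj with <⊎≡⊎> a b | ◁-cmp u a b
  ... | _               | tri< p _ _ = p
  ... | _               | tri≈ _ refl _ = contradiction (adjacent⇒◁ v {a} {a} adj) (ℕ.<-irrefl refl)
  ... | inj₁ a<b        | tri> _ _ b◁a = contradiction (inversion u⊑v b a a<b b◁a)
      (ℕ.<-asym (adjacent⇒◁ v adj))
  ... | inj₂ (inj₁ eq)  | tri> _ a≢b _ = contradiction eq a≢b
  ... | inj₂ (inj₂ b<a) | tri> _ _ b◁a = contradiction
    (block-order u (v⇒u-block (inj₁ (adjacent⇒fall v adj b<a))) b<a) (ℕ.<-asym b◁a)

newNonMin : {u v : 𝕊 n} → u ⊑ v → ¬ (u ≈ v) → ∃[ a ] NonMin v a × ¬ NonMin u a
newNonMin {u = u} {v} u⊑v u≉v with Fin.any? (λ a → nonMin? v a ×-dec ¬? (nonMin? u a))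
... | yes p = p
... | no ¬p = contradiction (sameNonMin⇒≈ u⊑v λ a q → decidable-stable (nonMin? u a)
    (λ r → ¬p (a , q , r))) u≉v

des-mono-< : {u v : 𝕊 n} → u ⊑ v → ¬ (u ≈ v) → des u ℕ.< des v
des-mono-< {u = u} {v} u⊑v u≉v with newNonMin u⊑v u≉v
... | a , p , q = subst₂ ℕ._<_ (sym (des≡nonMin u)) (sym (des≡nonMin v))
  (card-mono-< (nonMin? u) (nonMin? v) (nonMin-mono u⊑v) a q p)

des-cong : (u v : 𝕊 n) → u ≈ v → des u ≡ des v
des-cong u v u≈v = trans (des≡nonMin u) (trans
  (card-cong (nonMin? u) (nonMin? v) (nonMin-mono (≈⇒⊑ u v u≈v)) (nonMin-mono (≈⇒⊑ v u (≈-sym u v u≈v))))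
  (sym (des≡nonMin v)))

-- Distinct blocks occupy disjoint intervals of positions, so the choice of representatives is
-- immaterial.
blocks-ordered : (w : 𝕊 n) → ∀ {a a′ b b′} → Block w a a′ → Block w b b′ → ¬ Block w a b →
                 a ◁[ w ] b → a′ ◁[ w ] b′
blocks-ordered w {a} {a′} {b} {b′} a~a′ b~b′ a≁b a◁b with ◁-cmp w a′ b′
... | tri< p _ _ = p
... | tri≈ _ refl _ = contradiction (block-trans w a~a′ (block-sym w b~b′)) a≁b
... | tri> _ _ b′◁a′ = contradiction a′◁b (ℕ.<-asym b◁a′)
  where
  a′◁b : a′ ◁[ w ] b
  a′◁b = outside-block w a~a′ a≁b a◁b
  b◁a′ : b ◁[ w ] a′
  b◁a′ = outside-block w (block-sym w b~b′)
    (λ b′~a′ → a≁b (block-sym w (block-trans w b~b′ (block-trans w b′~a′ (block-sym w a~a′))))) b′◁a′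

-- Occurrences of the pattern 231, in terms of letters

Pattern231 : 𝕊 n → Set
Pattern231 w = ∃[ a ] ∃[ b ] ∃[ c ] (a Fin.< b) × (b Fin.< c) × (b ◁[ w ] c) × (c ◁[ w ] a)

avoids⇒¬pattern : (w : 𝕊 n) → Avoids231 w → ¬ Pattern231 w
avoids⇒¬pattern w avoids (a , b , c , a<b , b<c , b◁c , c◁a) =
  avoids (pos w b , pos w c , pos w a , b◁c , c◁a ,
    subst₂ Fin._<_ (sym (inverseʳ w)) (sym (inverseʳ w)) a<b ,
    subst₂ Fin._<_ (sym (inverseʳ w)) (sym (inverseʳ w)) b<c)

¬pattern⇒avoids : (w : 𝕊 n) → ¬ Pattern231 w → Avoids231 w
¬pattern⇒avoids w ¬pattern (i , j , k , i<j , j<k , wk<wi , wi<wj) =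
  ¬pattern (w ⟨$⟩ʳ k , w ⟨$⟩ʳ i , w ⟨$⟩ʳ j , wk<wi , wi<wj ,
    subst₂ Fin._<_ (sym (inverseˡ w)) (sym (inverseˡ w)) i<j ,
    subst₂ Fin._<_ (sym (inverseˡ w)) (sym (inverseˡ w)) j<k)

-- On the way from `c` to `a` the letters drop from above `b` to below `b`; `b` itself stands
-- further left. Taking the pattern at the drop places its largest and smallest letters in one
-- block.
pattern⇒descent : (w : 𝕊 n) → Pattern231 w →
  ∃[ a ] ∃[ b ] ∃[ c ] (a Fin.< b) × (b Fin.< c) × (b ◁[ w ] c) × Adjacent w c a
pattern⇒descent w (a , b , c , a<b , b<c , b◁c , c◁a)
  with crossing w (λ x → b Fin.<? x) c◁a b<c (Fin.<-asym a<b)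
... | e , d , adj , c⊴e , d⊴a , b<e , b≮d = d , b , e ,
  Fin.≤∧≢⇒< (ℕ.≮⇒≥ b≮d) (λ { refl → ℕ.<-asym b◁e (adjacent⇒◁ w adj) }) , b<e , b◁e , adj
  where
  b◁e : b ◁[ w ] e
  b◁e = ℕ.<-≤-trans b◁c c⊴e

-- Interpolation: uniting two blocks

-- With V the block of a₀ in v, the blocks A ∋ a₀ and B ∋ b₀ of u are the first two
-- of those contained in V.  The permutation merged is obtained from u by uniting A
-- and B; the letters of u between A and B move to the left or to the right of the
-- united block according to their position relative to V in v.
module Merge {u v : 𝕊 n} (u⊑v : u ⊑ v) (a₀ b₀ : Fin n)
             (a₀~b₀ : Block v a₀ b₀) (a₀≁b₀ : ¬ Block u a₀ b₀)
             (first : ∀ c → Block v a₀ c → a₀ ⊴[ u ] c)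
             (second : ∀ c → Block v a₀ c × ¬ Block u a₀ c → b₀ ⊴[ u ] c) where

  a₀◁b₀ : a₀ ◁[ u ] b₀
  a₀◁b₀ = ⊴⇒◁ u (first b₀ a₀~b₀) λ { refl → a₀≁b₀ (block-refl u) }

  AB : Pred (Fin n) 0ℓ
  AB c = Block u a₀ c ⊎ Block u b₀ c

  AB? : Decidable AB
  AB? c = block? u a₀ c ⊎-dec block? u b₀ c

  AB⊆V : ∀ {c} → AB c → Block v a₀ c
  AB⊆V (inj₁ a₀~c) = block u⊑v a₀~c
  AB⊆V (inj₂ b₀~c) = block-trans v a₀~b₀ (block u⊑v b₀~c)

  AB-cong : ∀ {a b} → Block u a b → AB a → AB b
  AB-cong a~b (inj₁ x) = inj₁ (block-trans u x a~b)
  AB-cong a~b (inj₂ x) = inj₂ (block-trans u x a~b)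

  -- The choice of `b₀` enters here: a letter of V before `b₀` lies in A. So the letters that have
  -- to move stand on a definite side of V in `v`.
  between⇒∉V : ∀ {c} → ¬ AB c → c ◁[ u ] b₀ → ¬ Block v a₀ c
  between⇒∉V {c} c∉AB c◁b₀ a₀~c = ℕ.<⇒≱ c◁b₀ (second c (a₀~c , c∉AB ∘ inj₁))

  -- The regions are numbered in the order in which they appear in merged.
  region : Fin n → ℕ
  region c with AB? c | ◁? u c a₀ | ◁? u b₀ c | ◁? v c a₀
  ... | yes _ | _     | _     | _     = 2
  ... | no  _ | yes _ | _     | _     = 0
  ... | no  _ | no  _ | yes _ | _     = 4
  ... | no  _ | no  _ | no  _ | yes _ = 1
  ... | no  _ | no  _ | no  _ | no  _ = 3

  data Region (c : Fin n) : ℕ → Set where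
    inAB   : AB c → Region c 2
    before : ¬ AB c → c ◁[ u ] a₀ → Region c 0
    after  : ¬ AB c → b₀ ◁[ u ] c → Region c 4
    left   : ¬ AB c → a₀ ◁[ u ] c → c ◁[ u ] b₀ → c ◁[ v ] a₀ → Region c 1
    right  : ¬ AB c → a₀ ◁[ u ] c → c ◁[ u ] b₀ → a₀ ◁[ v ] c → Region c 3

  private
    a₀∈AB : AB a₀
    a₀∈AB = inj₁ (block-refl u)

    b₀∈AB : AB b₀
    b₀∈AB = inj₂ (block-refl u)

  ∉AB⇒a₀◁ : ∀ {c} → ¬ AB c → ¬ c ◁[ u ] a₀ → a₀ ◁[ u ] c
  ∉AB⇒a₀◁ c∉AB c⋪a₀ = ⊴⇒◁ u (ℕ.≮⇒≥ c⋪a₀) λ { refl → c∉AB a₀∈AB }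

  ∉AB⇒◁b₀ : ∀ {c} → ¬ AB c → ¬ b₀ ◁[ u ] c → c ◁[ u ] b₀
  ∉AB⇒◁b₀ c∉AB b₀⋪c = ⊴⇒◁ u (ℕ.≮⇒≥ b₀⋪c) λ { refl → c∉AB b₀∈AB }

  regionOf : ∀ c → Region c (region c)
  regionOf c with AB? c | ◁? u c a₀ | ◁? u b₀ c | ◁? v c a₀
  ... | yes p | _     | _     | _     = inAB p
  ... | no ¬p | yes q | _     | _     = before ¬p q
  ... | no ¬p | no ¬q | yes r | _     = after ¬p r
  ... | no ¬p | no ¬q | no ¬r | yes s = left ¬p (∉AB⇒a₀◁ ¬p ¬q) (∉AB⇒◁b₀ ¬p ¬r) s
  ... | no ¬p | no ¬q | no ¬r | no ¬s = right ¬p (∉AB⇒a₀◁ ¬p ¬q) (∉AB⇒◁b₀ ¬p ¬r)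
    (⊴⇒◁ v (ℕ.≮⇒≥ ¬s) λ { refl → ¬p a₀∈AB })

  region≡ : ∀ {c r} → Region c r → region c ≡ r
  region≡ {c} x with AB? c | ◁? u c a₀ | ◁? u b₀ c | ◁? v c a₀
  region≡ (inAB p)        | yes _ | _ | _ | _ = refl
  region≡ (inAB p)        | no ¬p | _ | _ | _ = contradiction p ¬p
  region≡ (before ¬p _)   | yes p | _ | _ | _ = contradiction p ¬p
  region≡ (before _ q)    | no _  | yes _ | _ | _ = refl
  region≡ (before _ q)    | no _  | no ¬q | _ | _ = contradiction q ¬q
  region≡ (after ¬p _)    | yes p | _ | _ | _ = contradiction p ¬p
  region≡ (after _ r)     | no _  | yes q | _ | _ = contradiction (ℕ.<-trans q a₀◁b₀) (ℕ.<-asym r)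
  region≡ (after _ r)     | no _  | no _  | yes _ | _ = refl
  region≡ (after _ r)     | no _  | no _  | no ¬r | _ = contradiction r ¬r
  region≡ (left ¬p _ _ _) | yes p | _ | _ | _ = contradiction p ¬p
  region≡ (left _ q _ _)  | no _  | yes q′ | _ | _ = contradiction q′ (ℕ.<-asym q)
  region≡ (left _ _ r _)  | no _  | no _ | yes r′ | _ = contradiction r′ (ℕ.<-asym r)
  region≡ (left _ _ _ s)  | no _  | no _ | no _ | yes _ = refl
  region≡ (left _ _ _ s)  | no _  | no _ | no _ | no ¬s = contradiction s ¬s
  region≡ (right ¬p _ _ _) | yes p | _ | _ | _ = contradiction p ¬p
  region≡ (right _ q _ _)  | no _  | yes q′ | _ | _ = contradiction q′ (ℕ.<-asym q)
  region≡ (right _ _ r _)  | no _  | no _ | yes r′ | _ = contradiction r′ (ℕ.<-asym r)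
  region≡ (right _ _ _ s)  | no _  | no _ | no _ | yes s′ = contradiction s′ (ℕ.<-asym s)
  region≡ (right _ _ _ s)  | no _  | no _ | no _ | no _ = refl

  region-block : ∀ {a b} → Block u a b → region a ≡ region b
  region-block {a} {b} a~b = sym (region≡ (transport (regionOf a)))
    where
    b∉AB : ¬ AB a → ¬ AB b
    b∉AB a∉AB b∈AB = a∉AB (AB-cong (block-sym u a~b) b∈AB)
    a₀≁ : ∀ {c} → ¬ AB c → ¬ Block u a₀ c
    a₀≁ c∉AB = c∉AB ∘ inj₁
    b₀≁ : ∀ {c} → ¬ AB c → ¬ Block u b₀ c
    b₀≁ c∉AB = c∉AB ∘ inj₂
    a₀◁ : ¬ AB a → a₀ ◁[ u ] a → a₀ ◁[ u ] b
    a₀◁ a∉AB = blocks-ordered u (block-refl u) a~b (a₀≁ a∉AB)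
    ◁b₀ : ¬ AB a → a ◁[ u ] b₀ → b ◁[ u ] b₀
    ◁b₀ a∉AB = blocks-ordered u a~b (block-refl u) (b₀≁ a∉AB ∘ block-sym u)
    transport : ∀ {r} → Region a r → Region b r
    transport (inAB a∈AB) = inAB (AB-cong a~b a∈AB)
    transport (before a∉AB a◁a₀) = before (b∉AB a∉AB)
      (blocks-ordered u a~b (block-refl u) (a₀≁ a∉AB ∘ block-sym u) a◁a₀)
    transport (after a∉AB b₀◁a) = after (b∉AB a∉AB)
      (blocks-ordered u (block-refl u) a~b (b₀≁ a∉AB) b₀◁a)
    transport (left a∉AB a₀◁a a◁b₀ s) = left (b∉AB a∉AB) (a₀◁ a∉AB a₀◁a) (◁b₀ a∉AB a◁b₀)
      (blocks-ordered v (block u⊑v a~b) (block-refl v) (between⇒∉V a∉AB a◁b₀ ∘ block-sym v) s)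
    transport (right a∉AB a₀◁a a◁b₀ s) = right (b∉AB a∉AB) (a₀◁ a∉AB a₀◁a) (◁b₀ a∉AB a◁b₀)
      (blocks-ordered v (block-refl v) (block u⊑v a~b) (between⇒∉V a∉AB a◁b₀) s)

  -- The order inside a region: the united block is listed decreasingly, whence the complement
  -- `n ∸ toℕ c`; all other letters keep their order from `u`.
  rank : Fin n → ℕ
  rank c with AB? c
  ... | yes _ = n ∸ toℕ c
  ... | no  _ = toℕ (pos u c)

  rank-∈ : ∀ {c} → AB c → rank c ≡ n ∸ toℕ c
  rank-∈ {c} c∈AB with AB? c
  ... | yes _ = refl
  ... | no ¬p = contradiction c∈AB ¬p

  rank-∉ : ∀ {c} → ¬ AB c → rank c ≡ toℕ (pos u c)
  rank-∉ {c} c∉AB with AB? c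
  ... | yes p = contradiction p c∉AB
  ... | no  _ = refl

  region≡2⇒∈ : ∀ {c} → region c ≡ 2 → AB c
  region≡2⇒∈ {c} eq with region c | regionOf c
  region≡2⇒∈ refl | _ | inAB p = p

  key-injective : ∀ {a b} → region a ≡ region b → rank a ≡ rank b → a ≡ b
  key-injective {a} {b} r s = go (AB? a) (AB? b)
    where
    go : Dec (AB a) → Dec (AB b) → a ≡ b
    go (yes p) (yes q) = Fin.toℕ-injective (ℕ.∸-cancelˡ-≡ (ℕ.<⇒≤ (Fin.toℕ<n a)) (ℕ.<⇒≤ (Fin.toℕ<n b))
      (trans (sym (rank-∈ p)) (trans s (rank-∈ q))))
    go (no ¬p) (no ¬q) = pos-injective u (Fin.toℕ-injective
      (trans (sym (rank-∉ ¬p)) (trans s (rank-∉ ¬q))))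
    go (yes p) (no ¬q) = contradiction (region≡2⇒∈ (trans (sym r) (region≡ (inAB p)))) ¬q
    go (no ¬p) (yes q) = contradiction (region≡2⇒∈ (trans r (region≡ (inAB q)))) ¬p

  open Lexicographic region rank key-injective using (_≺_)

  abstract

    merged : 𝕊 n
    merged = Lexicographic.sorted region rank key-injective

    ≺⇒◁ : ∀ a b → a ≺ b → a ◁[ merged ] b
    ≺⇒◁ = Lexicographic.≺⇒◁ region rank key-injective

    ◁⇒≺ : ∀ a b → a ◁[ merged ] b → a ≺ b
    ◁⇒≺ = Lexicographic.◁⇒≺ region rank key-injective

  region-◁ : ∀ {a b r s} → Region a r → Region b s → r ℕ.< s → a ◁[ merged ] b
  region-◁ {a} {b} ra rb r<s = ≺⇒◁ a b (inj₁ (subst₂ ℕ._<_ (sym (region≡ ra)) (sym (region≡ rb)) r<s))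

  region-mono : ∀ {a b} → a ⊴[ merged ] b → region a ≤ region b
  region-mono {a} {b} a⊴b with a Fin.≟ b
  ... | yes refl = ℕ.≤-refl
  ... | no a≢b with ◁⇒≺ a b (⊴⇒◁ merged a⊴b a≢b)
  ...   | inj₁ p       = ℕ.<⇒≤ p
  ...   | inj₂ (p , _) = ℕ.≤-reflexive p

  AB-order : ∀ {a b} → AB a → AB b → b Fin.< a → a ◁[ merged ] b
  AB-order {a} {b} a∈AB b∈AB b<a = ≺⇒◁ a b (inj₂
    (trans (region≡ (inAB a∈AB)) (sym (region≡ (inAB b∈AB))) ,
    subst₂ ℕ._<_ (sym (rank-∈ a∈AB)) (sym (rank-∈ b∈AB)) (ℕ.∸-monoʳ-< b<a (ℕ.<⇒≤ (Fin.toℕ<n a)))))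

  AB-decreasing : ∀ {a b} → AB a → AB b → a ◁[ merged ] b → b Fin.< a
  AB-decreasing {a} {b} a∈AB b∈AB a◁b with <⊎≡⊎> a b
  ... | inj₁ a<b         = contradiction (AB-order b∈AB a∈AB a<b) (ℕ.<-asym a◁b)
  ... | inj₂ (inj₁ refl) = contradiction a◁b (ℕ.<-irrefl refl)
  ... | inj₂ (inj₂ b<a)  = b<a

  same-region-order : ∀ {a b} → region a ≡ region b → ¬ AB a → ¬ AB b → a ◁[ merged ] b → a ◁[ u ] b
  same-region-order {a} {b} eq a∉AB b∉AB a◁b with ◁⇒≺ a b a◁b
  ... | inj₁ p       = contradiction p (ℕ.<-irrefl eq)
  ... | inj₂ (_ , p) = subst₂ ℕ._<_ (rank-∉ a∉AB) (rank-∉ b∉AB) p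

  -- The pairs whose order `a`, `b` in `u` can be reversed: a left letter jumps over A, a right
  -- letter and a left letter are exchanged, a right letter is overtaken by B, or a letter of B goes
  -- before a smaller letter of A.
  data Swapped (a b : Fin n) : Set where
    A-left     : Block u a₀ a → Region b 1 → Swapped a b
    right-left : Region a 3 → Region b 1 → Swapped a b
    right-B    : Region a 3 → Block u b₀ b → Swapped a b
    A-B        : Block u a₀ a → Block u b₀ b → a Fin.< b → Swapped a b

  swapped : ∀ {a b} → a ◁[ u ] b → b ◁[ merged ] a → Swapped a b
  swapped {a} {b} a◁b b◁a = go (regionOf a) (regionOf b) (◁⇒≺ b a b◁a)
    where
    absurd : b ◁[ u ] a → Swapped a b
    absurd p = contradiction a◁b (ℕ.<-asym p)
    ◁A : ∀ {c d} → ¬ AB c → c ◁[ u ] a₀ → Block u a₀ d → c ◁[ u ] d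
    ◁A c∉AB c◁a₀ a₀~d = blocks-ordered u (block-refl u) a₀~d (c∉AB ∘ inj₁ ∘ block-sym u) c◁a₀
    ◁B : ∀ {c d} → ¬ AB c → c ◁[ u ] b₀ → Block u b₀ d → c ◁[ u ] d
    ◁B c∉AB c◁b₀ b₀~d = blocks-ordered u (block-refl u) b₀~d (c∉AB ∘ inj₂ ∘ block-sym u) c◁b₀
    A◁ : ∀ {c d} → ¬ AB c → a₀ ◁[ u ] c → Block u a₀ d → d ◁[ u ] c
    A◁ c∉AB a₀◁c a₀~d = blocks-ordered u a₀~d (block-refl u) (c∉AB ∘ inj₁) a₀◁c
    B◁ : ∀ {c d} → ¬ AB c → b₀ ◁[ u ] c → Block u b₀ d → d ◁[ u ] c
    B◁ c∉AB b₀◁c b₀~d = blocks-ordered u b₀~d (block-refl u) (c∉AB ∘ inj₂) b₀◁c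
    within : ∀ {c} → Block u c a → Block u c b → AB a → AB b → Swapped a b
    within c~a c~b a∈AB b∈AB = contradiction
      (block-decreasing u (block-trans u (block-sym u c~a) c~b) a◁b)
      (Fin.<-asym (AB-decreasing b∈AB a∈AB b◁a))
    go : ∀ {r s} → Region a r → Region b s → b ≺ a → Swapped a b
    go ra rb (inj₁ p) with subst₂ ℕ._<_ (region≡ rb) (region≡ ra) p
    go (inAB (inj₁ a∈A)) (before b∉ b◁a₀) (inj₁ _) | _ = absurd (◁A b∉ b◁a₀ a∈A)
    go (inAB (inj₂ a∈B)) (before b∉ b◁a₀) (inj₁ _) | _ = absurd (◁B b∉ (ℕ.<-trans b◁a₀ a₀◁b₀) a∈B)
    go (inAB (inj₁ a∈A)) rb@(left _ _ _ _) (inj₁ _) | _ = A-left a∈A rb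
    go (inAB (inj₂ a∈B)) (left b∉ _ b◁b₀ _) (inj₁ _) | _ = absurd (◁B b∉ b◁b₀ a∈B)
    go (left _ a₀◁a _ _) (before _ b◁a₀) (inj₁ _) | _ = absurd (ℕ.<-trans b◁a₀ a₀◁a)
    go (right _ a₀◁a _ _) (before _ b◁a₀) (inj₁ _) | _ = absurd (ℕ.<-trans b◁a₀ a₀◁a)
    go ra@(right _ _ _ _) rb@(left _ _ _ _) (inj₁ _) | _ = right-left ra rb
    go (right a∉ a₀◁a _ _) (inAB (inj₁ b∈A)) (inj₁ _) | _ = absurd (A◁ a∉ a₀◁a b∈A)
    go ra@(right _ _ _ _) (inAB (inj₂ b∈B)) (inj₁ _) | _ = right-B ra b∈B
    go (after _ b₀◁a) (before _ b◁a₀) (inj₁ _) | _ = absurd (ℕ.<-trans b◁a₀ (ℕ.<-trans a₀◁b₀ b₀◁a))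
    go (after _ b₀◁a) (left _ _ b◁b₀ _) (inj₁ _) | _ = absurd (ℕ.<-trans b◁b₀ b₀◁a)
    go (after _ b₀◁a) (right _ _ b◁b₀ _) (inj₁ _) | _ = absurd (ℕ.<-trans b◁b₀ b₀◁a)
    go (after a∉ b₀◁a) (inAB (inj₁ b∈A)) (inj₁ _) | _ = absurd (A◁ a∉ (ℕ.<-trans a₀◁b₀ b₀◁a) b∈A)
    go (after a∉ b₀◁a) (inAB (inj₂ b∈B)) (inj₁ _) | _ = absurd (B◁ a∉ b₀◁a b∈B)
    go (inAB _) (inAB _) (inj₁ _) | s≤s (s≤s ())
    go (inAB _) (right _ _ _ _) (inj₁ _) | s≤s (s≤s ())
    go (inAB _) (after _ _) (inj₁ _) | s≤s (s≤s ())
    go (left _ _ _ _) (inAB _) (inj₁ _) | s≤s ()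
    go (left _ _ _ _) (left _ _ _ _) (inj₁ _) | s≤s ()
    go (left _ _ _ _) (right _ _ _ _) (inj₁ _) | s≤s ()
    go (left _ _ _ _) (after _ _) (inj₁ _) | s≤s ()
    go (right _ _ _ _) (right _ _ _ _) (inj₁ _) | s≤s (s≤s (s≤s ()))
    go (right _ _ _ _) (after _ _) (inj₁ _) | s≤s (s≤s (s≤s ()))
    go (after _ _) (after _ _) (inj₁ _) | s≤s (s≤s (s≤s (s≤s ())))
    go ra rb (inj₂ (eq , p)) = same (AB? a) (AB? b)
      where
      same : Dec (AB a) → Dec (AB b) → Swapped a b
      same (no ¬a)  (no ¬b)  = absurd (subst₂ ℕ._<_ (rank-∉ ¬b) (rank-∉ ¬a) p)
      same (yes a∈) (no ¬b)  = contradiction (region≡2⇒∈ (trans eq (region≡ (inAB a∈)))) ¬b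
      same (no ¬a)  (yes b∈) = contradiction (region≡2⇒∈ (trans (sym eq) (region≡ (inAB b∈)))) ¬a
      same (yes a∈@(inj₁ x)) (yes b∈@(inj₁ y)) = within x y a∈ b∈
      same (yes a∈@(inj₂ x)) (yes b∈@(inj₂ y)) = within x y a∈ b∈
      same (yes a∈@(inj₁ x)) (yes b∈@(inj₂ y)) = A-B x y (AB-decreasing b∈ a∈ b◁a)
      same (yes a∈@(inj₂ x)) (yes b∈@(inj₁ y)) = absurd (blocks-ordered u y x a₀≁b₀ a₀◁b₀)

  -- Every change made to `u` goes towards `v`. Hence no inversion of `u` is lost, and every
  -- inversion gained is one of `v`.
  swapped⇒◁v : ∀ {a b} → Swapped a b → b ◁[ v ] a
  swapped⇒◁v (A-left a₀~a (left b∉ _ b◁b₀ b◁a₀)) = blocks-ordered v (block-refl v) (block u⊑v a₀~a)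
    (between⇒∉V b∉ b◁b₀ ∘ block-sym v) b◁a₀
  swapped⇒◁v (right-left (right _ _ _ a₀◁a) (left _ _ _ b◁a₀)) = ℕ.<-trans b◁a₀ a₀◁a
  swapped⇒◁v (right-B (right a∉ _ a◁b₀ a₀◁a) b₀~b) = blocks-ordered v
    (block-trans v a₀~b₀ (block u⊑v b₀~b)) (block-refl v) (between⇒∉V a∉ a◁b₀) a₀◁a
  swapped⇒◁v (A-B a₀~a b₀~b a<b) = block-order v
    (block-trans v (block-sym v (AB⊆V (inj₂ b₀~b))) (AB⊆V (inj₁ a₀~a))) a<b

  u-inversion : ∀ a b → b Fin.< a → a ◁[ u ] b → a ◁[ merged ] b
  u-inversion a b b<a a◁b with ◁-cmp merged a b
  ... | tri< p _ _ = p
  ... | tri≈ _ refl _ = contradiction b<a (ℕ.<-irrefl refl)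
  ... | tri> _ _ b◁a = contradiction (swapped⇒◁v (swapped a◁b b◁a)) (ℕ.<-asym (inversion u⊑v a b b<a a◁b))

  inversion-v : ∀ a b → b Fin.< a → a ◁[ merged ] b → a ◁[ v ] b
  inversion-v a b b<a a◁b with ◁-cmp u a b
  ... | tri< p _ _ = inversion u⊑v a b b<a p
  ... | tri≈ _ refl _ = contradiction b<a (ℕ.<-irrefl refl)
  ... | tri> _ _ b◁a = swapped⇒◁v (swapped b◁a a◁b)

  -- The intended block relation of `merged`. The harder inclusion is that `merged` has no descent
  -- across two classes of `K`.
  K : Rel (Fin n) 0ℓ
  K a b = Block u a b ⊎ (AB a × AB b)

  K? : ∀ a b → Dec (K a b)
  K? a b = block? u a b ⊎-dec (AB? a ×-dec AB? b)

  K-sym : ∀ {a b} → K a b → K b a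
  K-sym (inj₁ p)       = inj₁ (block-sym u p)
  K-sym (inj₂ (p , q)) = inj₂ (q , p)

  K-trans : ∀ {a b c} → K a b → K b c → K a c
  K-trans (inj₁ p)       (inj₁ q)       = inj₁ (block-trans u p q)
  K-trans (inj₁ p)       (inj₂ (q , r)) = inj₂ (AB-cong (block-sym u p) q , r)
  K-trans (inj₂ (p , q)) (inj₁ r)       = inj₂ (p , AB-cong r q)
  K-trans (inj₂ (p , _)) (inj₂ (_ , r)) = inj₂ (p , r)

  K⇒region : ∀ {a b} → K a b → region a ≡ region b
  K⇒region (inj₁ p)       = region-block p
  K⇒region (inj₂ (p , q)) = trans (region≡ (inAB p)) (sym (region≡ (inAB q)))

  K-convex : ∀ {a b c} → K a b → a ⊴[ merged ] c → c ⊴[ merged ] b → K a c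
  K-convex {a} {b} {c} Kab a⊴c c⊴b = go (AB? a)
    where
    ra≡rc : region a ≡ region c
    ra≡rc = ℕ.≤-antisym (region-mono a⊴c) (ℕ.≤-trans (region-mono c⊴b)
      (ℕ.≤-reflexive (sym (K⇒region Kab))))
    u-⊴ : ∀ {d e} → region d ≡ region e → ¬ AB d → ¬ AB e → d ⊴[ merged ] e → d ⊴[ u ] e
    u-⊴ {d} {e} eq d∉ e∉ d⊴e with d Fin.≟ e
    ... | yes refl = ℕ.≤-refl
    ... | no d≢e = ℕ.<⇒≤ (same-region-order eq d∉ e∉ (⊴⇒◁ merged d⊴e d≢e))
    go : Dec (AB a) → K a c
    go (yes a∈) = inj₂ (a∈ , region≡2⇒∈ (trans (sym ra≡rc) (region≡ (inAB a∈))))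
    go (no a∉) = inj₁ (convex Kab)
      where
      c∉ : ¬ AB c
      c∉ c∈ = a∉ (region≡2⇒∈ (trans ra≡rc (region≡ (inAB c∈))))
      convex : K a b → Block u a c
      convex (inj₂ (a∈ , _)) = contradiction a∈ a∉
      convex (inj₁ a~b) = block-convexˡ u a~b (u-⊴ ra≡rc a∉ c∉ a⊴c)
        (u-⊴ (trans (sym ra≡rc) (region-block a~b)) c∉ (a∉ ∘ AB-cong (block-sym u a~b)) c⊴b)

  K-decreasing : ∀ {a b} → K a b → a ◁[ merged ] b → b Fin.< a
  K-decreasing (inj₂ (p , q)) a◁b = AB-decreasing p q a◁b
  K-decreasing {a} {b} (inj₁ a~b) a◁b with <⊎≡⊎> a b
  ... | inj₁ a<b         = contradiction
    (u-inversion b a a<b (block-order u (block-sym u a~b) a<b)) (ℕ.<-asym a◁b)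
  ... | inj₂ (inj₁ refl) = contradiction a◁b (ℕ.<-irrefl refl)
  ... | inj₂ (inj₂ b<a)  = b<a

  K⇒block : ∀ {a b} → K a b → Block merged a b
  K⇒block {a} {b} Kab = [ (λ a⊴b → inj₁ (toFall Kab a⊴b)) , (λ b⊴a → inj₂ (toFall (K-sym Kab) b⊴a)) ]′
    (ℕ.≤-total (toℕ (pos merged a)) (toℕ (pos merged b)))
    where
    toFall : ∀ {a b} → K a b → a ⊴[ merged ] b → Fall merged a b
    toFall Kab a⊴b = fall a⊴b λ c d a⊴c c◁d d⊴b → K-decreasing
      (K-trans (K-sym (K-convex Kab a⊴c (ℕ.<⇒≤ (ℕ.<-≤-trans c◁d d⊴b))))
               (K-convex Kab (ℕ.<⇒≤ (ℕ.≤-<-trans a⊴c c◁d)) d⊴b)) c◁d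

  -- A supposed descent of `merged` across two classes. Each case produces a letter strictly between
  -- the neighbours `a` and `b`, a cycle of inequalities, or a pair in `K`.
  module _ {a b : Fin n} (adj : Adjacent merged a b) (b<a : b Fin.< a) (¬Kab : ¬ K a b) where

    private
      a◁b : a ◁[ merged ] b
      a◁b = adjacent⇒◁ merged adj

      none-between : ∀ {c} → a ◁[ merged ] c → c ◁[ merged ] b → ∀ {A : Set} → A
      none-between a◁c c◁b = contradiction (adjacent-⊴ˡ merged adj c◁b) (ℕ.<⇒≱ a◁c)

      -- If `m < a`, then `m` would share the block of `a` and still follow `a` in `merged`, hence
      -- come no earlier than `b`; convexity of the class would then include `b`.
      ascent-after : ∀ {m} → Adjacent u a m → a Fin.< m
      ascent-after {m} adj′ with <⊎≡⊎> a m
      ... | inj₁ a<m         = a<m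
      ... | inj₂ (inj₁ refl) = contradiction (adjacent⇒◁ u {a} {a} adj′) (ℕ.<-irrefl refl)
      ... | inj₂ (inj₂ m<a)  = contradiction
        (K-convex (inj₁ (inj₁ (adjacent⇒fall u adj′ m<a))) (ℕ.<⇒≤ a◁b)
          (adjacent-⊴ʳ merged adj (u-inversion a m m<a (adjacent⇒◁ u adj′)))) ¬Kab

      ascent-before : ∀ {m} → Adjacent u m b → m Fin.< b
      ascent-before {m} adj′ with <⊎≡⊎> m b
      ... | inj₁ m<b         = m<b
      ... | inj₂ (inj₁ refl) = contradiction (adjacent⇒◁ u {b} {b} adj′) (ℕ.<-irrefl refl)
      ... | inj₂ (inj₂ b<m)  = contradiction
        (K-trans (K-sym (K-convex Kmb (adjacent-⊴ˡ merged adj (u-inversion m b b<m (adjacent⇒◁ u adj′)))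
          (ℕ.<⇒≤ a◁b))) Kmb) ¬Kab
        where
        Kmb : K m b
        Kmb = inj₁ (inj₁ (adjacent⇒fall u adj′ b<m))

      -- Let `m` follow `a` and `k` precede `b` in `u`, so that `k < b < a < m`. The inversions
      -- `(m , b)` and `(a , k)` of `u` survive in `merged`, where nothing separates `a` from `b`;
      -- so `m` moves before `a`, and `k` moves after `b`.
      inverted⇒⊥ : a ◁[ u ] b → ∀ {A : Set} → A
      inverted⇒⊥ a◁ub with successor u a◁ub | predecessor u a◁ub
      ... | m , a-m , m⊴b | k , k-b , a⊴k = clash (swapped (adjacent⇒◁ u a-m) m◁a)
          (swapped (adjacent⇒◁ u k-b) b◁k)
        where
        a<m = ascent-after a-m
        k<b = ascent-before k-b
        m◁a : m ◁[ merged ] a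
        m◁a = ⊴⇒◁ merged (adjacent-⊴ˡ merged adj (u-inversion m b (ℕ.<-trans b<a a<m)
          (⊴⇒◁ u m⊴b λ { refl → ℕ.<-asym a<m b<a }))) λ { refl → ℕ.<-irrefl refl a<m }
        b◁k : b ◁[ merged ] k
        b◁k = ⊴⇒◁ merged (adjacent-⊴ʳ merged adj (u-inversion a k (ℕ.<-trans k<b b<a)
          (⊴⇒◁ u a⊴k λ { refl → ℕ.<-asym k<b b<a }))) λ { refl → ℕ.<-irrefl refl k<b }
        out-of-order : ∀ {r s} → Region a r → Region b s → s ℕ.< r → ∀ {A : Set} → A
        out-of-order ra rb s<r = contradiction (region-◁ rb ra s<r) (ℕ.<-asym a◁b)
        -- The first swap puts `a` in A or on the right, the second puts `b` on the left or in B.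
        -- Either both are in the united block, or `b` comes before `a`.
        clash : Swapped a m → Swapped k b → ∀ {A : Set} → A
        clash (A-left p _)      (A-left _ q)      = out-of-order (inAB (inj₁ p)) q (s≤s (s≤s z≤n))
        clash (A-left p _)      (right-left _ q)  = out-of-order (inAB (inj₁ p)) q (s≤s (s≤s z≤n))
        clash (A-left p _)      (right-B _ q)     = contradiction (inj₂ (inj₁ p , inj₂ q)) ¬Kab
        clash (A-left p _)      (A-B _ q _)       = contradiction (inj₂ (inj₁ p , inj₂ q)) ¬Kab
        clash (A-B p _ _)       (A-left _ q)      = out-of-order (inAB (inj₁ p)) q (s≤s (s≤s z≤n))
        clash (A-B p _ _)       (right-left _ q)  = out-of-order (inAB (inj₁ p)) q (s≤s (s≤s z≤n))
        clash (A-B p _ _)       (right-B _ q)     = contradiction (inj₂ (inj₁ p , inj₂ q)) ¬Kab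
        clash (A-B p _ _)       (A-B _ q _)       = contradiction (inj₂ (inj₁ p , inj₂ q)) ¬Kab
        clash (right-left p _)  (A-left _ q)      = out-of-order p q (s≤s (s≤s z≤n))
        clash (right-left p _)  (right-left _ q)  = out-of-order p q (s≤s (s≤s z≤n))
        clash (right-left p _)  (right-B _ q)     = out-of-order p (inAB (inj₂ q)) (s≤s (s≤s (s≤s z≤n)))
        clash (right-left p _)  (A-B _ q _)       = out-of-order p (inAB (inj₂ q)) (s≤s (s≤s (s≤s z≤n)))
        clash (right-B p _)     (A-left _ q)      = out-of-order p q (s≤s (s≤s z≤n))
        clash (right-B p _)     (right-left _ q)  = out-of-order p q (s≤s (s≤s z≤n))
        clash (right-B p _)     (right-B _ q)     = out-of-order p (inAB (inj₂ q)) (s≤s (s≤s (s≤s z≤n)))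
        clash (right-B p _)     (A-B _ q _)       = out-of-order p (inAB (inj₂ q)) (s≤s (s≤s (s≤s z≤n)))

      -- Here `a` is a left letter and `b` is in A. The letter `m` after `a` in `u` exceeds `a`; if
      -- it is a left letter or in B, it separates `a` from `b` in `merged`. If it is a right
      -- letter, it precedes `b₀` in `u` but not in `v`, so `m < b₀`; and `b₀ ≤ b`, as otherwise
      -- `b₀` would separate `a` from `b`. This gives `m < b₀ ≤ b < a < m`.
      A-left⇒⊥ : Block u a₀ b → Region a 1 → ∀ {A : Set} → A
      A-left⇒⊥ a₀~b ra@(left a∉ a₀◁a a◁b₀ _) with successor u a◁b₀
      ... | m , a-m , m⊴b₀ = go (regionOf m)
        where
        a<m = ascent-after a-m
        a◁m = adjacent⇒◁ u a-m
        rb : Region b 2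
        rb = inAB (inj₁ a₀~b)
        go : ∀ {r} → Region m r → ∀ {A : Set} → A
        go (inAB (inj₁ a₀~m)) = contradiction
          (blocks-ordered u a₀~m (block-refl u) (a∉ ∘ inj₁) a₀◁a) (ℕ.<-asym a◁m)
        go rm@(inAB (inj₂ b₀~m)) = none-between (region-◁ ra rm (s≤s (s≤s z≤n)))
          (AB-order (inj₂ b₀~m) (inj₁ a₀~b) (ℕ.<-trans b<a a<m))
        go (before _ m◁a₀) = contradiction (ℕ.<-trans a◁m m◁a₀) (ℕ.<-asym a₀◁a)
        go (after _ b₀◁m) = contradiction m⊴b₀ (ℕ.<⇒≱ b₀◁m)
        go rm@(left m∉ _ _ _) = none-between a◁m′ (region-◁ rm rb (s≤s (s≤s z≤n)))
          where
          a◁m′ : a ◁[ merged ] m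
          a◁m′ with ◁-cmp merged a m
          ... | tri< p _ _ = p
          ... | tri≈ _ refl _ = contradiction a<m (ℕ.<-irrefl refl)
          ... | tri> _ _ p = contradiction a◁m
            (ℕ.<-asym (same-region-order (trans (region≡ rm) (sym (region≡ ra))) m∉ a∉ p))
        go (right m∉ _ m◁b₀ a₀◁m) = contradiction (ℕ.<-≤-trans a<m (ℕ.<⇒≤ m<b₀))
          (ℕ.≤⇒≯ (ℕ.≤-trans b₀≤b (ℕ.<⇒≤ b<a)))
          where
          m<b₀ : m Fin.< b₀
          m<b₀ with <⊎≡⊎> m b₀
          ... | inj₁ p           = p
          ... | inj₂ (inj₁ refl) = contradiction b₀∈AB m∉
          ... | inj₂ (inj₂ p)    = contradiction (inversion u⊑v m b₀ p m◁b₀)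
            (ℕ.<-asym (outside-block v a₀~b₀ (between⇒∉V m∉ m◁b₀) a₀◁m))
          b₀≤b : b₀ Fin.≤ b
          b₀≤b = ℕ.≮⇒≥ λ b<b₀ → none-between (region-◁ ra (inAB b₀∈AB) (s≤s (s≤s z≤n)))
            (AB-order b₀∈AB (inj₁ a₀~b) b<b₀)

      -- The mirror image, with the letter `m` before `b` in `u` and with `a₀` in place of `b₀`; the
      -- cycle is `a₀ < m < b < a ≤ a₀`.
      right-B⇒⊥ : Region b 3 → Block u b₀ a → ∀ {A : Set} → A
      right-B⇒⊥ rb@(right b∉ a₀◁b b◁b₀ _) b₀~a with predecessor u a₀◁b
      ... | m , m-b , a₀⊴m = go (regionOf m)
        where
        m<b = ascent-before m-b
        m◁b = adjacent⇒◁ u m-b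
        ra : Region a 2
        ra = inAB (inj₂ b₀~a)
        go : ∀ {r} → Region m r → ∀ {A : Set} → A
        go (inAB (inj₂ b₀~m)) = contradiction
          (blocks-ordered u (block-refl u) b₀~m (b∉ ∘ inj₂ ∘ block-sym u) b◁b₀) (ℕ.<-asym m◁b)
        go rm@(inAB (inj₁ a₀~m)) = none-between
          (AB-order (inj₂ b₀~a) (inj₁ a₀~m) (ℕ.<-trans m<b b<a)) (region-◁ rm rb (s≤s (s≤s (s≤s z≤n))))
        go (before _ m◁a₀) = contradiction a₀⊴m (ℕ.<⇒≱ m◁a₀)
        go (after _ b₀◁m) = contradiction (ℕ.<-trans b₀◁m m◁b) (ℕ.<-asym b◁b₀)
        go rm@(right m∉ _ _ _) = none-between (region-◁ ra rm (s≤s (s≤s (s≤s z≤n)))) m◁b′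
          where
          m◁b′ : m ◁[ merged ] b
          m◁b′ with ◁-cmp merged m b
          ... | tri< p _ _ = p
          ... | tri≈ _ refl _ = contradiction m<b (ℕ.<-irrefl refl)
          ... | tri> _ _ p = contradiction m◁b
            (ℕ.<-asym (same-region-order (trans (region≡ rb) (sym (region≡ rm))) b∉ m∉ p))
        go (left m∉ a₀◁m m◁b₀ m◁a₀) = contradiction (ℕ.<-trans m<b b<a)
          (ℕ.≤⇒≯ (ℕ.≤-trans a≤a₀ (ℕ.<⇒≤ a₀<m)))
          where
          a₀<m : a₀ Fin.< m
          a₀<m with <⊎≡⊎> a₀ m
          ... | inj₁ p           = p
          ... | inj₂ (inj₁ refl) = contradiction a₀∈AB m∉
          ... | inj₂ (inj₂ p)    = contradiction (inversion u⊑v a₀ m p a₀◁m) (ℕ.<-asym m◁a₀)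
          a≤a₀ : a Fin.≤ a₀
          a≤a₀ = ℕ.≮⇒≥ λ a₀<a → none-between (AB-order (inj₂ b₀~a) a₀∈AB a₀<a)
            (region-◁ (inAB a₀∈AB) rb (s≤s (s≤s (s≤s z≤n))))

    descent-across⇒⊥ : ∀ {A : Set} → A
    descent-across⇒⊥ with ◁-cmp u a b
    ... | tri< p _ _ = inverted⇒⊥ p
    ... | tri≈ _ refl _ = contradiction b<a (ℕ.<-irrefl refl)
    ... | tri> _ _ b◁ua with swapped b◁ua a◁b
    ...   | A-left a₀~b ra   = A-left⇒⊥ a₀~b ra
    ...   | right-left rb ra = none-between (region-◁ ra (inAB a₀∈AB) (s≤s (s≤s z≤n)))
                                 (region-◁ (inAB a₀∈AB) rb (s≤s (s≤s (s≤s z≤n))))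
    ...   | right-B rb b₀~a  = right-B⇒⊥ rb b₀~a
    ...   | A-B p q _        = contradiction (inj₂ (inj₂ q , inj₁ p)) ¬Kab

  descent⇒K : ∀ {a b} → Adjacent merged a b → b Fin.< a → K a b
  descent⇒K {a} {b} adj b<a with K? a b
  ... | yes p = p
  ... | no ¬p = descent-across⇒⊥ adj b<a ¬p

  block⇒K : ∀ {a b} → Block merged a b → K a b
  block⇒K (inj₁ f) = fall⇒K f
    where
    fall⇒K : ∀ {a b} → Fall merged a b → K a b
    fall⇒K {a} {b} f with K? a b
    ... | yes p = p
    ... | no ¬p with crossing merged (K? a) (⊴⇒◁ merged (start⊴end f)
        λ { refl → ¬p (inj₁ (block-refl u)) })
                       (inj₁ (block-refl u)) ¬p
    ...   | c , d , adj , a⊴c , d⊴b , Kac , ¬Kad = contradiction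
      (K-trans Kac (descent⇒K adj (decreasing f c d a⊴c (adjacent⇒◁ merged adj) d⊴b))) ¬Kad
  block⇒K (inj₂ f) = K-sym (block⇒K (inj₁ f))

  u⊑merged : u ⊑ merged
  u⊑merged = record { inversion = u-inversion ; block = K⇒block ∘ inj₁ }

  merged⊑v : merged ⊑ v
  merged⊑v = record { inversion = inversion-v ; block = K⇒V ∘ block⇒K }
    where
    K⇒V : ∀ {a b} → K a b → Block v a b
    K⇒V (inj₁ p)       = block u⊑v p
    K⇒V (inj₂ (p , q)) = block-trans v (block-sym v (AB⊆V p)) (AB⊆V q)

  u≉merged : ¬ (u ≈ merged)
  u≉merged u≈m = a₀≁b₀ (≈⇒block merged u (≈-sym u merged u≈m) (K⇒block (inj₂ (a₀∈AB , b₀∈AB))))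

  -- Only the larger of the minima of A and B ceases to be the least of its block, so at most one
  -- descent is added; strict monotonicity gives at least one.
  des-merged : des merged ≡ ℕ.suc (des u)
  des-merged = ℕ.≤-antisym (subst₂ _≤_ (sym (des≡nonMin merged)) (cong ℕ.suc (sym (des≡nonMin u))) bound)
    (des-mono-< u⊑merged u≉merged)
    where
    new? : Decidable (λ c → NonMin merged c × ¬ NonMin u c)
    new? c = nonMin? merged c ×-dec ¬? (nonMin? u c)
    least-in : ∀ {c d} → ¬ NonMin u c → Block u c d → c Fin.≤ d
    least-in c-min c~d = ℕ.≮⇒≥ λ d<c → c-min (_ , d<c , c~d)
    other : ∀ {c} → NonMin merged c × ¬ NonMin u c →
      ∃[ d ] d Fin.< c × ((Block u a₀ c × Block u b₀ d) ⊎ (Block u b₀ c × Block u a₀ d))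
    other ((d , d<c , c~d) , c-min) with block⇒K c~d
    ... | inj₁ c~d′ = contradiction (d , d<c , c~d′) c-min
    ... | inj₂ (inj₁ p , inj₂ q) = d , d<c , inj₁ (p , q)
    ... | inj₂ (inj₂ p , inj₁ q) = d , d<c , inj₂ (p , q)
    ... | inj₂ (inj₁ p , inj₁ q) = contradiction (d , d<c , block-trans u (block-sym u p) q) c-min
    ... | inj₂ (inj₂ p , inj₂ q) = contradiction (d , d<c , block-trans u (block-sym u p) q) c-min
    crossed : ∀ {c c′ d d′ : Fin n} {A : Set} → d Fin.< c → d′ Fin.< c′ → c Fin.≤ d′ → c′ Fin.≤ d → A
    crossed d<c d′<c′ c≤d′ c′≤d =
      contradiction (ℕ.<-≤-trans d<c (ℕ.≤-trans c≤d′ (ℕ.<⇒≤ (ℕ.<-≤-trans d′<c′ c′≤d)))) (ℕ.<-irrefl refl)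
    unique : ∀ {c c′} → NonMin merged c × ¬ NonMin u c → NonMin merged c′ × ¬ NonMin u c′ → c ≡ c′
    unique x@(_ , c-min) y@(_ , c′-min) with other x | other y
    ... | _ , _ , inj₁ (p , _) | _ , _ , inj₁ (q , _) =
      blockMin-unique u (block-trans u (block-sym u p) q) c-min c′-min
    ... | _ , _ , inj₂ (p , _) | _ , _ , inj₂ (q , _) =
      blockMin-unique u (block-trans u (block-sym u p) q) c-min c′-min
    ... | d , d<c , inj₁ (p , q) | d′ , d′<c′ , inj₂ (p′ , q′) = crossed d<c d′<c′
      (least-in c-min (block-trans u (block-sym u p) q′)) (least-in c′-min (block-trans u (block-sym u p′) q))
    ... | d , d<c , inj₂ (p , q) | d′ , d′<c′ , inj₁ (p′ , q′) = crossed d<c d′<c′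
      (least-in c-min (block-trans u (block-sym u p) q′)) (least-in c′-min (block-trans u (block-sym u p′) q))
    split : ∀ c → 𝟙 (nonMin? merged c) ≤ 𝟙 (new? c) + 𝟙 (nonMin? u c)
    split c with nonMin? u c
    ... | yes _ = ℕ.≤-trans (𝟙-mono (nonMin? merged c) (yes tt) _) (ℕ.m≤n+m 1 _)
    ... | no ¬q = ℕ.≤-trans (𝟙-mono (nonMin? merged c) (nonMin? merged c ×-dec yes ¬q) (_, ¬q))
        (ℕ.m≤m+n _ 0)
    bound : card (nonMin? merged) ≤ ℕ.suc (card (nonMin? u))
    bound = begin
      card (nonMin? merged)                       ≤⟨ sum-mono-≤ split ⟩
      sum (λ c → 𝟙 (new? c) + 𝟙 (nonMin? u c))    ≡⟨ ∑-distrib-+ (𝟙 ∘ new?) (𝟙 ∘ nonMin? u) ⟩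
      card new? + card (nonMin? u)                ≤⟨ ℕ.+-monoˡ-≤ _ (card-unique new? unique) ⟩
      ℕ.suc (card (nonMin? u))                    ∎
      where open ℕ.≤-Reasoning

  -- Take a pattern `b`, `c`, `a` with `c` and `a` in one class of `K`, hence in one block of `v`.
  -- Since `v` avoids 231, `b` stands after `c` in `v`, and before `a` because it does so in
  -- `merged`; so `b` is in that block of `v` too. If `c` and `a` share a block of `u`, avoidance in
  -- `u` forces `b` after `a` there, a swapped pair, and every kind of swap is excluded. Otherwise V
  -- contains `b`, and no region can.
  merged-avoids : Avoids231 u → Avoids231 v → Avoids231 merged
  merged-avoids u-av v-av = ¬pattern⇒avoids merged λ p → impossible (pattern⇒descent merged p)
    where
    impossible : ¬ (∃[ a ] ∃[ b ] ∃[ c ] (a Fin.< b) × (b Fin.< c)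
      × (b ◁[ merged ] c) × Adjacent merged c a)
    impossible (a , b , c , a<b , b<c , b◁c , c-a) = go (descent⇒K c-a (ℕ.<-trans a<b b<c))
      where
      b◁a : b ◁[ merged ] a
      b◁a = ℕ.<-trans b◁c (adjacent⇒◁ merged c-a)
      ¬Kcb : ¬ K c b
      ¬Kcb Kcb = Fin.<-asym b<c (K-decreasing (K-sym Kcb) b◁c)
      right-of : (w : 𝕊 n) → Avoids231 w → Block w c a → c ◁[ w ] b
      right-of w w-av c~a with ◁-cmp w b c
      ... | tri< p _ _ = contradiction
        (a , b , c , a<b , b<c , p , block-order w c~a (ℕ.<-trans a<b b<c)) (avoids⇒¬pattern w w-av)
      ... | tri≈ _ refl _ = contradiction b<c (ℕ.<-irrefl refl)
      ... | tri> _ _ p = p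
      a~b-in-v : Block v c a → b ◁[ v ] a → Block v a b
      a~b-in-v c~a b◁va = block-sym v (block-convexʳ v c~a (ℕ.<⇒≤ (right-of v v-av c~a)) (ℕ.<⇒≤ b◁va))
      ∉V : ∀ {d} → Block v a₀ d → Block v d b → ¬ AB b → b ◁[ u ] b₀ → ∀ {A : Set} → A
      ∉V a₀~d d~b b∉ b◁b₀ = contradiction (block-trans v a₀~d d~b) (between⇒∉V b∉ b◁b₀)
      go : ¬ K c a
      go (inj₁ c~a) = [ (λ b◁ua → ¬Kcb (inj₁ (block-convexˡ u c~a (ℕ.<⇒≤ (right-of u u-av c~a))
        (ℕ.<⇒≤ b◁ua))))
                      , (λ a◁ub → sw (swapped a◁ub b◁a)) ]′ (order (◁-cmp u b a))
        where
        order : Tri (b ◁[ u ] a) (b ≡ a) (a ◁[ u ] b) → b ◁[ u ] a ⊎ a ◁[ u ] b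
        order (tri< p _ _) = inj₁ p
        order (tri≈ _ refl _) = contradiction a<b (ℕ.<-irrefl refl)
        order (tri> _ _ p) = inj₂ p
        sw : ¬ Swapped a b
        sw s with a~b-in-v (block u⊑v c~a) (swapped⇒◁v s)
        sw (A-left a₀~a (left b∉ _ b◁b₀ _)) | a~b = ∉V (block u⊑v a₀~a) a~b b∉ b◁b₀
        sw (right-left (right _ _ _ a₀◁a) (left b∉ _ b◁b₀ b◁a₀)) | a~b = between⇒∉V b∉ b◁b₀
          (block-sym v (block-convexˡ v (block-sym v a~b) (ℕ.<⇒≤ b◁a₀) (ℕ.<⇒≤ a₀◁a)))
        sw (right-B (right a∉ _ a◁b₀ _) b₀~b) | a~b = between⇒∉V a∉ a◁b₀
          (block-trans v (AB⊆V (inj₂ b₀~b)) (block-sym v a~b))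
        sw (A-B a₀~a b₀~b _) | a~b = ¬Kcb (inj₂ (inj₁ (block-trans u a₀~a (block-sym u c~a)) , inj₂ b₀~b))
      go (inj₂ (c∈ , a∈)) = elsewhere (regionOf b)
        where
        c~a : Block v c a
        c~a = block-trans v (block-sym v (AB⊆V c∈)) (AB⊆V a∈)
        a~b : Block v a b
        a~b = a~b-in-v c~a (inversion-v b a a<b b◁a)
        elsewhere : ∀ {r} → Region b r → ∀ {A : Set} → A
        elsewhere (inAB b∈) = contradiction (inj₂ (c∈ , b∈)) ¬Kcb
        elsewhere (before _ b◁a₀) = contradiction (first b (block-trans v (AB⊆V a∈) a~b)) (ℕ.<⇒≱ b◁a₀)
        elsewhere rb@(after _ _) = contradiction (region-◁ (inAB c∈) rb (s≤s (s≤s (s≤s z≤n))))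
          (ℕ.<-asym b◁c)
        elsewhere (left b∉ _ b◁b₀ _) = ∉V (AB⊆V a∈) a~b b∉ b◁b₀
        elsewhere (right b∉ _ b◁b₀ _) = ∉V (AB⊆V a∈) a~b b∉ b◁b₀

interpolate : {u v : 𝕊 n} → u ⊑ v → ¬ (u ≈ v) →
  ∃[ z ] u ⊑ z × z ⊑ v × ¬ (u ≈ z) × des z ≡ ℕ.suc (des u) × (Avoids231 u → Avoids231 v → Avoids231 z)
interpolate {n} {u} {v} u⊑v u≉v with newNonMin u⊑v u≉v
... | x , (y , y<x , x~y) , x-min with leftmost u (block? v x) (block-refl v)
...   | a₀ , x~a₀ , first with leftmost u (λ c → block? v a₀ c ×-dec ¬? (block? u a₀ c)) (proj₂ witness)
  where
  -- `x` and `y` lie in different blocks of `u`, so at least one of them is outside the block of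
  -- `a₀`.
  witness : ∃[ c ] Block v a₀ c × ¬ Block u a₀ c
  witness with block? u a₀ x
  ... | no a₀≁x = x , block-sym v x~a₀ , a₀≁x
  ... | yes a₀~x = y , block-trans v (block-sym v x~a₀) x~y ,
    λ a₀~y → x-min (y , y<x , block-trans u (block-sym u a₀~x) a₀~y)
...     | b₀ , (a₀~b₀ , a₀≁b₀) , second =
  merged , u⊑merged , merged⊑v , u≉merged , des-merged , merged-avoids
  where open Merge u⊑v a₀ b₀ a₀~b₀ a₀≁b₀ (λ c a₀~c → first c (block-trans v x~a₀ a₀~c)) second

-- Valley hopping

Between : 𝕊 n → Fin n → Fin n → Fin n → Set
Between w a c b = (a ◁[ w ] c × c ◁[ w ] b) ⊎ (b ◁[ w ] c × c ◁[ w ] a)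

between? : (w : 𝕊 n) → ∀ a c b → Dec (Between w a c b)
between? w a c b = (◁? w a c ×-dec ◁? w c b) ⊎-dec (◁? w b c ×-dec ◁? w c a)

between-sym : (w : 𝕊 n) → ∀ {a b c} → Between w a c b → Between w b c a
between-sym w = swap

between-split : (w : 𝕊 n) → ∀ {a b c} d → Between w a d b → d ≢ c → Between w a d c ⊎ Between w c d b
between-split w {c = c} d betw d≢c with betw | ◁-cmp w d c
... | _              | tri≈ _ eq _ = contradiction eq d≢c
... | inj₁ (a◁d , _) | tri< d◁c _ _ = inj₁ (inj₁ (a◁d , d◁c))
... | inj₁ (_ , d◁b) | tri> _ _ c◁d = inj₂ (inj₁ (c◁d , d◁b))
... | inj₂ (b◁d , _) | tri< d◁c _ _ = inj₂ (inj₂ (b◁d , d◁c))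
... | inj₂ (_ , d◁a) | tri> _ _ c◁d = inj₁ (inj₂ (c◁d , d◁a))

-- b is a proper descendant of a in the decreasing binary tree of w.
infix 4 _⊏[_]_

record _⊏[_]_ (b : Fin n) (w : 𝕊 n) (a : Fin n) : Set where
  constructor descendant
  field
    smaller : b Fin.< a
    visible : ∀ c → a Fin.< c → ¬ Between w a c b

open _⊏[_]_

abstract

  ⊏? : (w : 𝕊 n) → ∀ b a → Dec (b ⊏[ w ] a)
  ⊏? w b a = map′ (λ (p , q) → descendant p q) (λ r → smaller r , visible r)
    (b Fin.<? a ×-dec Fin.all? λ c → (a Fin.<? c) →-dec ¬? (between? w a c b))

⋢⇒blocked : (w : 𝕊 n) → ∀ {a b} → b Fin.< a → ¬ b ⊏[ w ] a → ∃[ c ] a Fin.< c × Between w a c b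
⋢⇒blocked w {a} {b} b<a b⋢a with Fin.any? (λ c → (a Fin.<? c) ×-dec between? w a c b)
... | yes p = p
... | no ¬p = contradiction (descendant b<a λ c a<c betw → ¬p (c , a<c , betw)) b⋢a

⊏-trans : (w : 𝕊 n) → ∀ {a b c} → b ⊏[ w ] a → a ⊏[ w ] c → b ⊏[ w ] c
⊏-trans w {a} b⊏a a⊏c = descendant (ℕ.<-trans (smaller b⊏a) (smaller a⊏c)) λ d c<d betw →
  [ visible a⊏c d c<d , visible b⊏a d (ℕ.<-trans (smaller a⊏c) c<d) ]′
    (between-split w {c = a} d betw (λ { refl → ℕ.<-asym c<d (smaller a⊏c) }))

ancestors-chain : (w : 𝕊 n) → ∀ {a b c} → b ⊏[ w ] a → b ⊏[ w ] c → a Fin.< c → a ⊏[ w ] c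
ancestors-chain w {a} {b} {c} b⊏a b⊏c a<c = descendant a<c λ d c<d betw →
  [ visible b⊏c d c<d , visible b⊏a d (ℕ.<-trans a<c c<d) ∘ between-sym w ]′
    (between-split w {c = b} d betw (λ { refl → ℕ.<-asym c<d (smaller b⊏c) }))

adjacent-descendantʳ : (w : 𝕊 n) → ∀ {a b} → Adjacent w a b → b Fin.< a → b ⊏[ w ] a
adjacent-descendantʳ w adj b<a = descendant b<a λ
  { c _ (inj₁ (a◁c , c◁b)) → ℕ.<⇒≱ c◁b (adjacent-⊴ʳ w adj a◁c)
  ; c _ (inj₂ (b◁c , c◁a)) → ℕ.<-asym (ℕ.<-trans b◁c c◁a) (adjacent⇒◁ w adj) }

adjacent-descendantˡ : (w : 𝕊 n) → ∀ {a b} → Adjacent w b a → b Fin.< a → b ⊏[ w ] a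
adjacent-descendantˡ w adj b<a = descendant b<a λ
  { c _ (inj₂ (b◁c , c◁a)) → ℕ.<⇒≱ c◁a (adjacent-⊴ʳ w adj b◁c)
  ; c _ (inj₁ (a◁c , c◁b)) → ℕ.<-asym (ℕ.<-trans a◁c c◁b) (adjacent⇒◁ w adj) }

-- A node has a child on a side exactly when it has a descendant there, so `Peak` means two children
-- and `Free` exactly one.
HasRight HasLeft Peak Free : 𝕊 n → Pred (Fin n) 0ℓ
HasRight w a = ∃[ b ] b ⊏[ w ] a × a ◁[ w ] b
HasLeft  w a = ∃[ b ] b ⊏[ w ] a × b ◁[ w ] a
Peak     w a = HasRight w a × HasLeft w a
Free     w a = (HasRight w a × ¬ HasLeft w a) ⊎ (¬ HasRight w a × HasLeft w a)

abstract

  hasRight? : (w : 𝕊 n) → Decidable (HasRight w)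
  hasRight? w a = Fin.any? λ b → ⊏? w b a ×-dec ◁? w a b

  hasLeft? : (w : 𝕊 n) → Decidable (HasLeft w)
  hasLeft? w a = Fin.any? λ b → ⊏? w b a ×-dec ◁? w b a

  peak? : (w : 𝕊 n) → Decidable (Peak w)
  peak? w a = hasRight? w a ×-dec hasLeft? w a

  free? : (w : 𝕊 n) → Decidable (Free w)
  free? w a = (hasRight? w a ×-dec ¬? (hasLeft? w a)) ⊎-dec (¬? (hasRight? w a) ×-dec hasLeft? w a)

peak⇒¬free : (w : 𝕊 n) → ∀ {a} → Peak w a → ¬ Free w a
peak⇒¬free w (_ , l) (inj₁ (_ , ¬l)) = ¬l l
peak⇒¬free w (r , _) (inj₂ (¬r , _)) = ¬r r

-- A right neighbour larger than `a` would hide `b` from `a`.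
hasRight⇒descent : (w : 𝕊 n) → ∀ {a} → HasRight w a → ∃[ b ] Adjacent w a b × b Fin.< a
hasRight⇒descent w {a} (b , b⊏a , a◁b) with successor w a◁b
... | c , adj , c⊴b = c , adj , c<a
  where
  c<a : c Fin.< a
  c<a with c Fin.≟ b
  ... | yes refl = smaller b⊏a
  ... | no c≢b with <⊎≡⊎> c a
  ...   | inj₁ p           = p
  ...   | inj₂ (inj₁ refl) = contradiction (adjacent⇒◁ w {a} {a} adj) (ℕ.<-irrefl refl)
  ...   | inj₂ (inj₂ a<c)  = contradiction (inj₁ (adjacent⇒◁ w adj , ⊴⇒◁ w c⊴b c≢b)) (visible b⊏a c a<c)

hasLeft⇒ascent : (w : 𝕊 n) → ∀ {a} → HasLeft w a → ∃[ b ] Adjacent w b a × b Fin.< a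
hasLeft⇒ascent w {a} (b , b⊏a , b◁a) with predecessor w b◁a
... | c , adj , b⊴c = c , adj , c<a
  where
  c<a : c Fin.< a
  c<a with b Fin.≟ c
  ... | yes refl = smaller b⊏a
  ... | no b≢c with <⊎≡⊎> c a
  ...   | inj₁ p           = p
  ...   | inj₂ (inj₁ refl) = contradiction (adjacent⇒◁ w {a} {a} adj) (ℕ.<-irrefl refl)
  ...   | inj₂ (inj₂ a<c)  = contradiction (inj₂ (⊴⇒◁ w b⊴c b≢c , adjacent⇒◁ w adj)) (visible b⊏a c a<c)

-- The largest letter between a and b has both of them as descendants, on different sides.
peak-between : (w : 𝕊 n) → ∀ {a b c} → a Fin.< c → b Fin.< c → Between w a c b →
               ∃[ p ] c Fin.≤ p × Between w a p b × Peak w p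
peak-between w {a} {b} {c} a<c b<c betw with greatest (λ p → between? w a p b) betw
... | p , betw-p , ≤p = p , c≤p , betw-p , sides betw-p
  where
  c≤p : c Fin.≤ p
  c≤p = ≤p c betw
  a⊏p : a ⊏[ w ] p
  a⊏p = descendant (ℕ.<-≤-trans a<c c≤p) λ d p<d betw-d → ℕ.<⇒≱ p<d (≤p d (extend betw-p betw-d))
    where
    extend : ∀ {d} → Between w a p b → Between w p d a → Between w a d b
    extend (inj₁ (a◁p , p◁b)) (inj₁ (p◁d , d◁a)) = contradiction (ℕ.<-trans p◁d d◁a) (ℕ.<-asym a◁p)
    extend (inj₁ (a◁p , p◁b)) (inj₂ (a◁d , d◁p)) = inj₁ (a◁d , ℕ.<-trans d◁p p◁b)
    extend (inj₂ (b◁p , p◁a)) (inj₁ (p◁d , d◁a)) = inj₂ (ℕ.<-trans b◁p p◁d , d◁a)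
    extend (inj₂ (b◁p , p◁a)) (inj₂ (a◁d , d◁p)) = contradiction (ℕ.<-trans a◁d d◁p) (ℕ.<-asym p◁a)
  b⊏p : b ⊏[ w ] p
  b⊏p = descendant (ℕ.<-≤-trans b<c c≤p) λ d p<d betw-d → ℕ.<⇒≱ p<d (≤p d (extend betw-p betw-d))
    where
    extend : ∀ {d} → Between w a p b → Between w p d b → Between w a d b
    extend (inj₁ (a◁p , p◁b)) (inj₁ (p◁d , d◁b)) = inj₁ (ℕ.<-trans a◁p p◁d , d◁b)
    extend (inj₁ (a◁p , p◁b)) (inj₂ (b◁d , d◁p)) = contradiction (ℕ.<-trans b◁d d◁p) (ℕ.<-asym p◁b)
    extend (inj₂ (b◁p , p◁a)) (inj₁ (p◁d , d◁b)) = contradiction (ℕ.<-trans p◁d d◁b) (ℕ.<-asym b◁p)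
    extend (inj₂ (b◁p , p◁a)) (inj₂ (b◁d , d◁p)) = inj₂ (b◁d , ℕ.<-trans d◁p p◁a)
  sides : Between w a p b → Peak w p
  sides (inj₁ (a◁p , p◁b)) = (b , b⊏p , p◁b) , (a , a⊏p , a◁p)
  sides (inj₂ (b◁p , p◁a)) = (a , a⊏p , p◁a) , (b , b⊏p , b◁p)

≈⇒⊏ : (u v : 𝕊 n) → u ≈ v → ∀ {a b} → b ⊏[ u ] a → b ⊏[ v ] a
≈⇒⊏ u v u≈v b⊏a = descendant (smaller b⊏a) λ c a<c betw → visible b⊏a c a<c
  ([ (λ (p , q) → inj₁ (back p , back q)) , (λ (p , q) → inj₂ (back p , back q)) ]′ betw)
  where
  back : ∀ {a b} → a ◁[ v ] b → a ◁[ u ] b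
  back = ≈⇒◁ v u (≈-sym u v u≈v) _ _

free-transfer : (u v : 𝕊 n) → ∀ {a} →
  (HasRight u a → HasRight v a) → (HasRight v a → HasRight u a) →
  (HasLeft u a → HasLeft v a) → (HasLeft v a → HasLeft u a) → Free u a → Free v a
free-transfer u v r r⁻¹ l l⁻¹ (inj₁ (p , ¬q)) = inj₁ (r p , ¬q ∘ l⁻¹)
free-transfer u v r r⁻¹ l l⁻¹ (inj₂ (¬p , q)) = inj₂ (¬p ∘ r⁻¹ , l q)

≈⇒hasRight : (u v : 𝕊 n) → u ≈ v → ∀ {a} → HasRight u a → HasRight v a
≈⇒hasRight u v u≈v (b , b⊏a , a◁b) = b , ≈⇒⊏ u v u≈v b⊏a , ≈⇒◁ u v u≈v _ _ a◁b

≈⇒hasLeft : (u v : 𝕊 n) → u ≈ v → ∀ {a} → HasLeft u a → HasLeft v a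
≈⇒hasLeft u v u≈v (b , b⊏a , b◁a) = b , ≈⇒⊏ u v u≈v b⊏a , ≈⇒◁ u v u≈v _ _ b◁a

≈⇒free : (u v : 𝕊 n) → u ≈ v → ∀ {a} → Free u a → Free v a
≈⇒free u v u≈v = free-transfer u v (≈⇒hasRight u v u≈v) (≈⇒hasRight v u v≈u)
                                   (≈⇒hasLeft u v u≈v) (≈⇒hasLeft v u v≈u)
  where
  v≈u = ≈-sym u v u≈v

-- Valley hopping: X tells which of the free letters have their descendants on the right.
data Hop (w : 𝕊 n) (X : Fin n → Bool) (a b : Fin n) : Set where
  over  : b ⊏[ w ] a → Free w a → X a ≡ true → Hop w X a b
  under : a ⊏[ w ] b → Free w b → X b ≡ false → Hop w X a b
  keep  : ¬ (b ⊏[ w ] a × Free w a) → ¬ (a ⊏[ w ] b × Free w b) → a ◁[ w ] b → Hop w X a b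

true≢false : ∀ {x : Bool} → x ≡ true → x ≡ false → ∀ {A : Set} → A
true≢false refl ()

module Hopping (w : 𝕊 n) (X : Fin n → Bool) where

  over⁻¹ : ∀ {a b} → b ⊏[ w ] a → Free w a → Hop w X a b → X a ≡ true
  over⁻¹ b⊏a free (over _ _ eq)   = eq
  over⁻¹ b⊏a free (under a⊏b _ _) = contradiction (smaller b⊏a) (ℕ.<-asym (smaller a⊏b))
  over⁻¹ b⊏a free (keep ¬p _ _)   = contradiction (b⊏a , free) ¬p

  under⁻¹ : ∀ {a b} → b ⊏[ w ] a → Free w a → Hop w X b a → X a ≡ false
  under⁻¹ b⊏a free (over a⊏b _ _)  = contradiction (smaller b⊏a) (ℕ.<-asym (smaller a⊏b))
  under⁻¹ b⊏a free (under _ _ eq)  = eq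
  under⁻¹ b⊏a free (keep _ ¬p _)   = contradiction (b⊏a , free) ¬p

  keep⁻¹ : ∀ {a b} → ¬ (b ⊏[ w ] a × Free w a) → ¬ (a ⊏[ w ] b × Free w b) → Hop w X a b → a ◁[ w ] b
  keep⁻¹ ¬p ¬q (over b⊏a free _)  = contradiction (b⊏a , free) ¬p
  keep⁻¹ ¬p ¬q (under a⊏b free _) = contradiction (a⊏b , free) ¬q
  keep⁻¹ ¬p ¬q (keep _ _ a◁b)     = a◁b

  ≮⇒¬⊏ : ∀ {a b} → a Fin.< b → ¬ (b ⊏[ w ] a × Free w a)
  ≮⇒¬⊏ a<b (b⊏a , _) = ℕ.<-asym a<b (smaller b⊏a)

  keep⁻¹< : ∀ {a b} → a Fin.< b → ¬ (a ⊏[ w ] b × Free w b) → Hop w X a b → a ◁[ w ] b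
  keep⁻¹< a<b ¬p = keep⁻¹ (≮⇒¬⊏ a<b) ¬p

  keep⁻¹> : ∀ {a b} → a Fin.< b → ¬ (a ⊏[ w ] b × Free w b) → Hop w X b a → b ◁[ w ] a
  keep⁻¹> a<b ¬p = keep⁻¹ ¬p (≮⇒¬⊏ a<b)

  -- A larger letter `m` between `a` and `b` makes neither a descendant of the other, and hopping
  -- reverses only a letter and its descendants.
  separated : ∀ {a b m} → a ◁[ w ] m → m ◁[ w ] b → a Fin.< m → b Fin.< m → ¬ Hop w X b a
  separated a◁m m◁b a<m b<m hop = ℕ.<-asym (ℕ.<-trans a◁m m◁b) (keep⁻¹
    (λ (a⊏b , _) → visible a⊏b _ b<m (inj₂ (a◁m , m◁b)))
    (λ (b⊏a , _) → visible b⊏a _ a<m (inj₁ (a◁m , m◁b))) hop)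

  hop⇒≢ : ∀ {a b} → Hop w X a b → a ≢ b
  hop⇒≢ (over b⊏a _ _)  refl = ℕ.<-irrefl refl (smaller b⊏a)
  hop⇒≢ (under a⊏b _ _) refl = ℕ.<-irrefl refl (smaller a⊏b)
  hop⇒≢ (keep _ _ a◁b)  refl = ℕ.<-irrefl refl a◁b

  hop-total : ∀ {a b} → a ≢ b → Hop w X a b ⊎ Hop w X b a
  hop-total {a} {b} a≢b with ⊏? w b a ×-dec free? w a | ⊏? w a b ×-dec free? w b
  ... | yes (b⊏a , free) | _ = choose (X a) refl
    where
    choose : ∀ x → X a ≡ x → Hop w X a b ⊎ Hop w X b a
    choose true  eq = inj₁ (over b⊏a free eq)
    choose false eq = inj₂ (under b⊏a free eq)
  ... | no _ | yes (a⊏b , free) = choose (X b) refl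
    where
    choose : ∀ x → X b ≡ x → Hop w X a b ⊎ Hop w X b a
    choose true  eq = inj₂ (over a⊏b free eq)
    choose false eq = inj₁ (under a⊏b free eq)
  ... | no ¬p | no ¬q with ◁-cmp w a b
  ...   | tri< a◁b _ _ = inj₁ (keep ¬p ¬q a◁b)
  ...   | tri≈ _ eq _  = contradiction eq a≢b
  ...   | tri> _ _ b◁a = inj₂ (keep ¬q ¬p b◁a)

  hop-asym : ∀ {a b} → Hop w X a b → ¬ Hop w X b a
  hop-asym (over b⊏a free eq)  hop = true≢false eq (under⁻¹ b⊏a free hop)
  hop-asym (under a⊏b free eq) hop = true≢false (over⁻¹ a⊏b free hop) eq
  hop-asym (keep ¬p ¬q a◁b)    hop = ℕ.<-asym a◁b (keep⁻¹ ¬q ¬p hop)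

  -- The largest letter `a` of a supposed cycle. If it is free and has `b` and `c` as descendants,
  -- both lie on the same side of it. In every other case `a`, or a larger letter hiding one of them
  -- from `a`, separates `c` from `b` in `w`, unless an order or a visibility is violated at once.
  hop-acyclic-max : ∀ {a b c} → b Fin.< a → c Fin.< a → Hop w X a b → Hop w X b c → ¬ Hop w X c a
  hop-acyclic-max {a} {b} {c} b<a c<a ab bc ca with ⊏? w b a | ⊏? w c a
  ... | no b⋢a | no c⋢a = separated (keep⁻¹< c<a (c⋢a ∘ proj₁) ca) (keep⁻¹> b<a (b⋢a ∘ proj₁) ab)
      c<a b<a bc
  ... | yes b⊏a | no c⋢a with ⋢⇒blocked w c<a c⋢a
  ...   | d , a<d , inj₁ (a◁d , d◁c) = ℕ.<-asym (ℕ.<-trans a◁d d◁c) (keep⁻¹< c<a (c⋢a ∘ proj₁) ca)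
  ...   | d , a<d , inj₂ (c◁d , d◁a) with ◁-cmp w d b
  ...     | tri< d◁b _ _ = separated c◁d d◁b (ℕ.<-trans c<a a<d) (ℕ.<-trans b<a a<d) bc
  ...     | tri≈ _ refl _ = ℕ.<-asym b<a a<d
  ...     | tri> _ _ b◁d = visible b⊏a d a<d (inj₂ (b◁d , d◁a))
  hop-acyclic-max {a} {b} {c} b<a c<a ab bc ca | no b⋢a | yes c⊏a with ⋢⇒blocked w b<a b⋢a
  ...   | d , a<d , inj₂ (b◁d , d◁a) = ℕ.<-asym (ℕ.<-trans b◁d d◁a) (keep⁻¹> b<a (b⋢a ∘ proj₁) ab)
  ...   | d , a<d , inj₁ (a◁d , d◁b) with ◁-cmp w c d
  ...     | tri< c◁d _ _ = separated c◁d d◁b (ℕ.<-trans c<a a<d) (ℕ.<-trans b<a a<d) bc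
  ...     | tri≈ _ refl _ = ℕ.<-asym c<a a<d
  ...     | tri> _ _ d◁c = visible c⊏a d a<d (inj₁ (a◁d , d◁c))
  hop-acyclic-max {a} {b} {c} b<a c<a ab bc ca | yes b⊏a | yes c⊏a with free? w a
  ...   | yes free = true≢false (over⁻¹ b⊏a free ab) (under⁻¹ c⊏a free ca)
  ...   | no ¬free = separated (keep⁻¹< c<a (¬free ∘ proj₂) ca) (keep⁻¹> b<a (¬free ∘ proj₂) ab)
    c<a b<a bc

  -- A cycle can be rotated so that its largest letter comes first. A tournament without cyclic
  -- triples is transitive, which yields `hop-trans`.
  hop-acyclic : ∀ {a b c} → Hop w X a b → Hop w X b c → ¬ Hop w X c a
  hop-acyclic {a} {b} {c} ab bc ca with <⊎≡⊎> a b | <⊎≡⊎> b c | <⊎≡⊎> c a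
  ... | inj₂ (inj₁ eq)  | _               | _               = hop⇒≢ ab eq
  ... | _               | inj₂ (inj₁ eq)  | _               = hop⇒≢ bc eq
  ... | _               | _               | inj₂ (inj₁ eq)  = hop⇒≢ ca eq
  ... | inj₂ (inj₂ b<a) | _               | inj₁ c<a        = hop-acyclic-max b<a c<a ab bc ca
  ... | inj₁ a<b        | inj₂ (inj₂ c<b) | _               = hop-acyclic-max c<b a<b bc ca ab
  ... | _               | inj₁ b<c        | inj₂ (inj₂ a<c) = hop-acyclic-max a<c b<c ca ab bc
  ... | inj₁ a<b        | inj₁ b<c        | inj₁ c<a        = ℕ.<-asym (ℕ.<-trans a<b b<c) c<a
  ... | inj₂ (inj₂ b<a) | inj₂ (inj₂ c<b) | inj₂ (inj₂ a<c) = ℕ.<-asym (ℕ.<-trans c<b b<a) a<c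

  hop-trans : Transitive (Hop w X)
  hop-trans {a} {b} {c} ab bc with a Fin.≟ c
  ... | yes refl = contradiction bc (hop-asym ab)
  ... | no a≢c with hop-total a≢c
  ...   | inj₁ ac = ac
  ...   | inj₂ ca = contradiction ca (hop-acyclic ab bc)

  hop-cmp : Trichotomous _≡_ (Hop w X)
  hop-cmp a b with a Fin.≟ b
  ... | yes refl = tri≈ (λ h → hop⇒≢ h refl) refl (λ h → hop⇒≢ h refl)
  ... | no a≢b with hop-total a≢b
  ...   | inj₁ ab = tri< ab a≢b (hop-asym ab)
  ...   | inj₂ ba = tri> (hop-asym ba) a≢b ba

  abstract

    hopped : 𝕊 n
    hopped = Linear.sorted (Hop w X) hop-trans hop-cmp

    hop⇒◁ : ∀ a b → Hop w X a b → a ◁[ hopped ] b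
    hop⇒◁ = Linear.⊏⇒◁ (Hop w X) hop-trans hop-cmp

    ◁⇒hop : ∀ a b → a ◁[ hopped ] b → Hop w X a b
    ◁⇒hop = Linear.◁⇒⊏ (Hop w X) hop-trans hop-cmp

  unfree-⁻¹< : ∀ {a b} → a Fin.< b → ¬ Free w b → a ◁[ hopped ] b → a ◁[ w ] b
  unfree-⁻¹< a<b ¬free p = keep⁻¹< a<b (¬free ∘ proj₂) (◁⇒hop _ _ p)

  unfree-⁻¹> : ∀ {a b} → a Fin.< b → ¬ Free w b → b ◁[ hopped ] a → b ◁[ w ] a
  unfree-⁻¹> a<b ¬free p = keep⁻¹> a<b (¬free ∘ proj₂) (◁⇒hop _ _ p)

  unfree-< : ∀ {a b} → a Fin.< b → ¬ Free w b → a ◁[ w ] b → a ◁[ hopped ] b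
  unfree-< a<b ¬free p = hop⇒◁ _ _ (keep (≮⇒¬⊏ a<b) (¬free ∘ proj₂) p)

  unfree-> : ∀ {a b} → a Fin.< b → ¬ Free w b → b ◁[ w ] a → b ◁[ hopped ] a
  unfree-> a<b ¬free p = hop⇒◁ _ _ (keep (¬free ∘ proj₂) (≮⇒¬⊏ a<b) p)

  -- A letter `c` above `a` has both `a` and `b` as descendants or neither. So `c` hops over both or
  -- over none, and cannot come to stand between them.
  hopped-⊏ : ∀ {a b} → b ⊏[ w ] a → b ⊏[ hopped ] a
  hopped-⊏ {a} {b} b⊏a = descendant (smaller b⊏a) go
    where
    go : ∀ c → a Fin.< c → ¬ Between hopped a c b
    go c a<c betw with ⊏? w a c
    ... | no a⋢c = visible b⊏a c a<c
      ([ (λ (p , q) → inj₁ (keep⁻¹< a<c (a⋢c ∘ proj₁) (◁⇒hop _ _ p) , keep⁻¹> b<c (b⋢c ∘ proj₁)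
        (◁⇒hop _ _ q)))
       , (λ (p , q) → inj₂ (keep⁻¹< b<c (b⋢c ∘ proj₁) (◁⇒hop _ _ p) , keep⁻¹> a<c (a⋢c ∘ proj₁)
         (◁⇒hop _ _ q)))
       ]′ betw)
      where
      b<c : b Fin.< c
      b<c = ℕ.<-trans (smaller b⊏a) a<c
      b⋢c : ¬ b ⊏[ w ] c
      b⋢c b⊏c = a⋢c (ancestors-chain w b⊏a b⊏c a<c)
    ... | yes a⊏c with free? w c
    ...   | yes free = [ (λ (p , q) → true≢false (over⁻¹ b⊏c free (◁⇒hop _ _ q))
      (under⁻¹ a⊏c free (◁⇒hop _ _ p)))
                       , (λ (p , q) → true≢false (over⁻¹ a⊏c free (◁⇒hop _ _ q))
                         (under⁻¹ b⊏c free (◁⇒hop _ _ p)))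
                       ]′ betw
      where
      b⊏c : b ⊏[ w ] c
      b⊏c = ⊏-trans w b⊏a a⊏c
    ...   | no ¬free = visible b⊏a c a<c
      ([ (λ (p , q) → inj₁ (unfree-⁻¹< a<c ¬free p , unfree-⁻¹> b<c ¬free q))
       , (λ (p , q) → inj₂ (unfree-⁻¹< b<c ¬free p , unfree-⁻¹> a<c ¬free q))
       ]′ betw)
      where
      b<c : b Fin.< c
      b<c = ℕ.<-trans (smaller b⊏a) a<c

  peak-separates : ∀ {a b p} → a Fin.< p → b Fin.< p → Peak w p → Between w a p b → Between hopped a p b
  peak-separates a<p b<p peak =
    [ (λ (x , y) → inj₁ (unfree-< a<p ¬free x , unfree-> b<p ¬free y))
    , (λ (x , y) → inj₂ (unfree-< b<p ¬free x , unfree-> a<p ¬free y)) ]′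
    where
    ¬free : ¬ Free w _
    ¬free = peak⇒¬free w peak

  -- A letter hiding `b` from `a` in `w` may be taken to be a peak, and peaks keep their place
  -- relative to smaller letters.
  hopped-⊏⁻¹ : ∀ {a b} → b ⊏[ hopped ] a → b ⊏[ w ] a
  hopped-⊏⁻¹ {a} {b} b⊏a = descendant (smaller b⊏a) go
    where
    go : ∀ c → a Fin.< c → ¬ Between w a c b
    go c a<c betw with peak-between w a<c (ℕ.<-trans (smaller b⊏a) a<c) betw
    ... | p , c≤p , betw-p , peak = visible b⊏a p a<p
      (peak-separates a<p (ℕ.<-trans (smaller b⊏a) a<p) peak betw-p)
      where
      a<p : a Fin.< p
      a<p = ℕ.<-≤-trans a<c c≤p

  hopped-hasRight : ∀ {a} → Free w a → HasRight hopped a → X a ≡ true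
  hopped-hasRight free (b , b⊏a , a◁b) = over⁻¹ (hopped-⊏⁻¹ b⊏a) free (◁⇒hop _ _ a◁b)

  hopped-hasLeft : ∀ {a} → Free w a → HasLeft hopped a → X a ≡ false
  hopped-hasLeft free (b , b⊏a , b◁a) = under⁻¹ (hopped-⊏⁻¹ b⊏a) free (◁⇒hop _ _ b◁a)

  free⇒descendant : ∀ {a} → Free w a → ∃[ b ] b ⊏[ w ] a
  free⇒descendant (inj₁ ((b , b⊏a , _) , _)) = b , b⊏a
  free⇒descendant (inj₂ (_ , (b , b⊏a , _))) = b , b⊏a

  true⇒hasRight : ∀ {a} → Free w a → X a ≡ true → HasRight hopped a
  true⇒hasRight free eq with free⇒descendant free
  ... | b , b⊏a = b , hopped-⊏ b⊏a , hop⇒◁ _ _ (over b⊏a free eq)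

  false⇒hasLeft : ∀ {a} → Free w a → X a ≡ false → HasLeft hopped a
  false⇒hasLeft free eq with free⇒descendant free
  ... | b , b⊏a = b , hopped-⊏ b⊏a , hop⇒◁ _ _ (under b⊏a free eq)

  hopped-free : ∀ {a} → Free w a → Free hopped a
  hopped-free {a} free = choose (X a) refl
    where
    choose : ∀ x → X a ≡ x → Free hopped a
    choose true  eq = inj₁ (true⇒hasRight free eq , λ l → true≢false eq (hopped-hasLeft free l))
    choose false eq = inj₂ ((λ r → true≢false (hopped-hasRight free r) eq) , false⇒hasLeft free eq)

  module _ {a : Fin n} (¬free : ¬ Free w a) where

    unfree-hasRight : HasRight w a → HasRight hopped a
    unfree-hasRight (b , b⊏a , a◁b) = b , hopped-⊏ b⊏a , unfree-> (smaller b⊏a) ¬free a◁b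

    unfree-hasRight⁻¹ : HasRight hopped a → HasRight w a
    unfree-hasRight⁻¹ (b , b⊏a , a◁b) = b , hopped-⊏⁻¹ b⊏a , unfree-⁻¹> (smaller b⊏a) ¬free a◁b

    unfree-hasLeft : HasLeft w a → HasLeft hopped a
    unfree-hasLeft (b , b⊏a , b◁a) = b , hopped-⊏ b⊏a , unfree-< (smaller b⊏a) ¬free b◁a

    unfree-hasLeft⁻¹ : HasLeft hopped a → HasLeft w a
    unfree-hasLeft⁻¹ (b , b⊏a , b◁a) = b , hopped-⊏⁻¹ b⊏a , unfree-⁻¹< (smaller b⊏a) ¬free b◁a

  hopped-free⁻¹ : ∀ {a} → Free hopped a → Free w a
  hopped-free⁻¹ {a} free with free? w a
  ... | yes p = p
  ... | no ¬p = free-transfer hopped w (unfree-hasRight⁻¹ ¬p) (unfree-hasRight ¬p)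
                  (unfree-hasLeft⁻¹ ¬p) (unfree-hasLeft ¬p) free

  hopped-pattern : Pattern231 w → Pattern231 hopped
  hopped-pattern (a , b , c , a<b , b<c , b◁c , c◁a)
    with peak-between w b<c (ℕ.<-trans a<b b<c) (inj₁ (b◁c , c◁a))
  ... | p , c≤p , inj₂ (a◁p , p◁b) , _ = contradiction (ℕ.<-trans a◁p p◁b) (ℕ.<-asym (ℕ.<-trans b◁c c◁a))
  ... | p , c≤p , inj₁ (b◁p , p◁a) , peak = a , b , p , a<b , b<p ,
    unfree-< b<p (peak⇒¬free w peak) b◁p , unfree-> (ℕ.<-trans a<b b<p) (peak⇒¬free w peak) p◁a
    where
    b<p : b Fin.< p
    b<p = ℕ.<-≤-trans b<c c≤p

open Hopping public using (hopped)

hopped-cong : (u v : 𝕊 n) (X Y : Fin n → Bool) → u ≈ v → (∀ a → Free u a → X a ≡ Y a) →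
              hopped u X ≈ hopped v Y
hopped-cong u v X Y u≈v X≡Y = ◁⊆◁⇒≈ (hopped u X) (hopped v Y) λ a b a◁b →
  HY.hop⇒◁ a b (go (HX.◁⇒hop a b a◁b))
  where
  module HX = Hopping u X
  module HY = Hopping v Y
  v≈u = ≈-sym u v u≈v
  back : ∀ {a b} → ¬ (b ⊏[ u ] a × Free u a) → ¬ (b ⊏[ v ] a × Free v a)
  back ¬p (b⊏a , free) = ¬p (≈⇒⊏ v u v≈u b⊏a , ≈⇒free v u v≈u free)
  go : ∀ {a b} → Hop u X a b → Hop v Y a b
  go (over b⊏a free eq)  = over (≈⇒⊏ u v u≈v b⊏a) (≈⇒free u v u≈v free) (trans (sym (X≡Y _ free)) eq)
  go (under a⊏b free eq) = under (≈⇒⊏ u v u≈v a⊏b) (≈⇒free u v u≈v free) (trans (sym (X≡Y _ free)) eq)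
  go (keep ¬p ¬q a◁b)    = keep (back ¬p) (back ¬q) (≈⇒◁ u v u≈v _ _ a◁b)

-- Descendants and free letters are unchanged by hopping, so the second choice of sides overrides
-- the first.
hopped-hopped : (w : 𝕊 n) (X Y : Fin n → Bool) → hopped (hopped w X) Y ≈ hopped w Y
hopped-hopped w X Y = ◁⊆◁⇒≈ (hopped (hopped w X) Y) (hopped w Y) λ a b a◁b →
  Hopping.hop⇒◁ w Y a b (go (Hopping.◁⇒hop (hopped w X) Y a b a◁b))
  where
  open Hopping w X hiding (hopped)
  back : ∀ {a b} → ¬ (b ⊏[ hopped w X ] a × Free (hopped w X) a) → ¬ (b ⊏[ w ] a × Free w a)
  back ¬p (b⊏a , free) = ¬p (hopped-⊏ b⊏a , hopped-free free)
  go : ∀ {a b} → Hop (hopped w X) Y a b → Hop w Y a b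
  go (over b⊏a free eq)  = over (hopped-⊏⁻¹ b⊏a) (hopped-free⁻¹ free) eq
  go (under a⊏b free eq) = under (hopped-⊏⁻¹ a⊏b) (hopped-free⁻¹ free) eq
  go (keep ¬p ¬q a◁b)    = keep (back ¬p) (back ¬q) (keep⁻¹ (back ¬p) (back ¬q) (◁⇒hop _ _ a◁b))

hopped-self : (w : 𝕊 n) (X : Fin n → Bool) →
              (∀ {a} → Free w a → HasRight w a → X a ≡ true) →
              (∀ {a} → Free w a → ¬ HasRight w a → X a ≡ false) → hopped w X ≈ w
hopped-self w X right left = ≈-sym w (hopped w X) (◁⊆◁⇒≈ w (hopped w X) λ a b a◁b →
  Hopping.hop⇒◁ w X a b (go a b a◁b))
  where
  ¬right : ∀ {a} → Free w a → HasLeft w a → ¬ HasRight w a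
  ¬right free l r = peak⇒¬free w (r , l) free
  go : ∀ a b → a ◁[ w ] b → Hop w X a b
  go a b a◁b with ⊏? w b a ×-dec free? w a | ⊏? w a b ×-dec free? w b
  ... | yes (b⊏a , free) | _ = over b⊏a free (right free (b , b⊏a , a◁b))
  ... | no _ | yes (a⊏b , free) = under a⊏b free (left free (¬right free (a , a⊏b , a◁b)))
  ... | no ¬p | no ¬q = keep ¬p ¬q a◁b

-- Enlarging `X` moves descendants of newly chosen letters from their left to their right, which
-- only creates inversions. For blocks, suppose that a run of `u` from `a` to `b` acquires an ascent
-- `c < d` in `v`. The letter `c` follows `a` in `u` already, since `a` has a right descendant in
-- `u` and so is not newly chosen. Thus `d` must have come from beyond `b`.
hopped-mono : (w : 𝕊 n) (X Y : Fin n → Bool) → (∀ a → X a ≡ true → Y a ≡ true) → hopped w X ⊑ hopped w Y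
hopped-mono {n} w X Y X⊆Y = record { inversion = inv ; block = [ inj₁ ∘ falls , inj₂ ∘ falls ]′ }
  where
  module HX = Hopping w X
  module HY = Hopping w Y
  u v : 𝕊 n
  u = hopped w X
  v = hopped w Y
  inv : ∀ a b → b Fin.< a → a ◁[ u ] b → a ◁[ v ] b
  inv a b b<a a◁b with HX.◁⇒hop a b a◁b
  ... | over b⊏a free eq  = HY.hop⇒◁ a b (over b⊏a free (X⊆Y a eq))
  ... | under a⊏b _ _     = contradiction (smaller a⊏b) (ℕ.<-asym b<a)
  ... | keep ¬p ¬q a◁wb   = HY.hop⇒◁ a b (keep ¬p ¬q a◁wb)
  moved : ∀ {a c} → c ◁[ u ] a → a ◁[ v ] c → c ⊏[ w ] a × Free w a × X a ≡ false × Y a ≡ true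
  moved {a} {c} c◁a a◁c with HX.◁⇒hop c a c◁a
  ... | over a⊏c free eq  = contradiction (HY.hop⇒◁ c a (over a⊏c free (X⊆Y c eq))) (ℕ.<-asym a◁c)
  ... | under c⊏a free eq = c⊏a , free , eq , HY.over⁻¹ c⊏a free (HY.◁⇒hop a c a◁c)
  ... | keep ¬p ¬q c◁wa   = contradiction (HY.hop⇒◁ c a (keep ¬p ¬q c◁wa)) (ℕ.<-asym a◁c)
  falls : ∀ {a b} → Fall u a b → Fall v a b
  falls {a} {b} f with a Fin.≟ b
  ... | yes refl = fall-refl v a
  ... | no a≢b = fall (ℕ.<⇒≤ (inv a b (decreasing f a b ℕ.≤-refl a◁b ℕ.≤-refl) a◁b)) dec
    where
    a◁b : a ◁[ u ] b
    a◁b = ⊴⇒◁ u (start⊴end f) a≢b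
    hasRight : HasRight u a
    hasRight with successor u a◁b
    ... | m , adj , m⊴b = m , adjacent-descendantʳ u adj
      (decreasing f a m ℕ.≤-refl (adjacent⇒◁ u adj) m⊴b) , adjacent⇒◁ u adj
    dec : ∀ c d → a ⊴[ v ] c → c ◁[ v ] d → d ⊴[ v ] b → d Fin.< c
    dec c d a⊴c c◁d d⊴b with <⊎≡⊎> c d
    ... | inj₂ (inj₂ d<c)  = d<c
    ... | inj₂ (inj₁ refl) = contradiction c◁d (ℕ.<-irrefl refl)
    ... | inj₁ c<d = contradiction (⊴⊎▷ d b) no-position
      where
      c◁ud : c ◁[ u ] d
      c◁ud with ◁-cmp u c d
      ... | tri< p _ _ = p
      ... | tri≈ _ eq _ = contradiction eq (Fin.<⇒≢ c<d)
      ... | tri> _ _ p = contradiction (inv d c c<d p) (ℕ.<-asym c◁d)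
      ⊴⊎▷ : ∀ x y → x ⊴[ u ] y ⊎ y ◁[ u ] x
      ⊴⊎▷ x y = ℕ.≤-<-connex (toℕ (pos u x)) (toℕ (pos u y))
      a⊴uc : a ⊴[ u ] c
      a⊴uc = [ (λ p → p) , crossed ]′ (⊴⊎▷ a c)
        where
        crossed : c ◁[ u ] a → a ⊴[ u ] c
        crossed c◁a with moved c◁a (⊴⇒◁ v a⊴c (≢-sym (◁⇒≢ u c◁a)))
        ... | c⊏a , free , Xa≡false , _ = true≢false (HX.hopped-hasRight free hasRight) Xa≡false
      no-position : ¬ (d ⊴[ u ] b ⊎ b ◁[ u ] d)
      no-position (inj₁ d⊴ub) = ℕ.<-asym c<d (decreasing f c d a⊴uc c◁ud d⊴ub)
      -- Now `d` is newly chosen and `b` is its descendant. So is `c`, since a letter hiding it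
      -- would break the run or hide `b`; but then `c` also passes to the right of `d`.
      no-position (inj₂ b◁d) with moved b◁d (⊴⇒◁ v d⊴b (≢-sym (◁⇒≢ u b◁d)))
      ... | b⊏d , free , _ , eq with ⊏? u c d
      ...   | yes c⊏d = ℕ.<-asym c◁d (HY.hop⇒◁ d c (over (HX.hopped-⊏⁻¹ c⊏d) free eq))
      ...   | no c⋢d with ⋢⇒blocked u c<d c⋢d
      ...     | t , d<t , inj₁ (d◁t , t◁c) = ℕ.<-asym c◁ud (ℕ.<-trans d◁t t◁c)
      ...     | t , d<t , inj₂ (c◁t , t◁d) with ⊴⊎▷ t b
      ...       | inj₁ t⊴b = ℕ.<-asym (decreasing f c t a⊴uc c◁t t⊴b) (ℕ.<-trans c<d d<t)
      ...       | inj₂ b◁t = visible (HX.hopped-⊏ b⊏d) t d<t (inj₂ (b◁t , t◁d))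

-- Counting descents and free letters along an orbit

card-⊎ : {P Q R : Pred (Fin n) 0ℓ} (P? : Decidable P) (Q? : Decidable Q) (R? : Decidable R) →
         (∀ {i} → R i → P i ⊎ Q i) → (∀ {i} → P i → R i) → (∀ {i} → Q i → R i) → (∀ {i} → P i → ¬ Q i) →
         card R? ≡ card P? + card Q?
card-⊎ P? Q? R? R⇒ P⇒R Q⇒R disjoint = trans (sum-cong-≗ split) (∑-distrib-+ (𝟙 ∘ P?) (𝟙 ∘ Q?))
  where
  split : ∀ i → 𝟙 (R? i) ≡ 𝟙 (P? i) + 𝟙 (Q? i)
  split i with P? i | Q? i
  ... | yes p | yes q = contradiction q (disjoint p)
  ... | yes p | no _  = 𝟙-true (R? i) (P⇒R p)
  ... | no _  | yes q = 𝟙-true (R? i) (Q⇒R q)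
  ... | no ¬p | no ¬q = 𝟙-false (R? i) ([ ¬p , ¬q ]′ ∘ R⇒)

des≡hasRight : (w : 𝕊 n) → des w ≡ card (hasRight? w)
des≡hasRight w = des≡card w (hasRight? w)
  (λ adj b<a → _ , adjacent-descendantʳ w adj b<a , adjacent⇒◁ w adj) (hasRight⇒descent w)

-- A gap between neighbours is a descent or an ascent, and is counted once, at its larger letter.
adjacent-hasRight+hasLeft : (w : 𝕊 n) → ∀ {a b} → Adjacent w a b →
  𝟙 (hasRight? w a) + 𝟙 (hasLeft? w b) ≡ 1
adjacent-hasRight+hasLeft w {a} {b} adj = go (<⊎≡⊎> a b)
  where
  ¬right : a Fin.< b → ¬ HasRight w a
  ¬right a<b r with hasRight⇒descent w r
  ... | c , adj′ , c<a = ℕ.<-asym a<b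
    (subst (Fin._< a) (pos-injective w (Fin.toℕ-injective (trans adj′ (sym adj)))) c<a)
  ¬left : b Fin.< a → ¬ HasLeft w b
  ¬left b<a l with hasLeft⇒ascent w l
  ... | c , adj′ , c<b = ℕ.<-asym b<a
    (subst (Fin._< b) (pos-injective w (Fin.toℕ-injective (ℕ.suc-injective (trans (sym adj′) adj)))) c<b)
  go : (a Fin.< b) ⊎ (a ≡ b) ⊎ (b Fin.< a) → 𝟙 (hasRight? w a) + 𝟙 (hasLeft? w b) ≡ 1
  go (inj₁ a<b) = cong₂ _+_ (𝟙-false (hasRight? w a) (¬right a<b))
    (𝟙-true (hasLeft? w b) (a , adjacent-descendantˡ w adj a<b , adjacent⇒◁ w adj))
  go (inj₂ (inj₁ a≡b)) = contradiction a≡b (◁⇒≢ w (adjacent⇒◁ w adj))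
  go (inj₂ (inj₂ b<a)) = cong₂ _+_
    (𝟙-true (hasRight? w a) (b , adjacent-descendantʳ w adj b<a , adjacent⇒◁ w adj))
    (𝟙-false (hasLeft? w b) (¬left b<a))

-- Indexed by position, the two counts are shifted by one against each other: the last letter has
-- nothing on its right, the first nothing on its left, and the rest pairs off over the gaps.
hasRight+hasLeft : (w : 𝕊 n) → card (hasRight? w) + card (hasLeft? w) ≡ n ∸ 1
hasRight+hasLeft {ℕ.zero}  w = refl
hasRight+hasLeft {ℕ.suc n} w = begin
  card (hasRight? w) + card (hasLeft? w)
    ≡⟨ cong₂ _+_ (sum-permute (𝟙 ∘ hasRight? w) w) (sum-permute (𝟙 ∘ hasLeft? w) w) ⟩
  sum R + (L zero + sum (L ∘ suc))
    ≡⟨ cong₂ _+_ (sum-init-last R) (cong (_+ sum (L ∘ suc)) (𝟙-false (hasLeft? w _) no-left)) ⟩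
  (sum (R ∘ inject₁) + R (fromℕ n)) + sum (L ∘ suc)
    ≡⟨ cong (λ k → sum (R ∘ inject₁) + k + sum (L ∘ suc)) (𝟙-false (hasRight? w _) no-right) ⟩
  (sum (R ∘ inject₁) + 0) + sum (L ∘ suc)
    ≡⟨ cong (_+ sum (L ∘ suc)) (ℕ.+-identityʳ (sum (R ∘ inject₁))) ⟩
  sum (R ∘ inject₁) + sum (L ∘ suc)
    ≡⟨ ∑-distrib-+ (R ∘ inject₁) (L ∘ suc) ⟨
  sum (λ q → R (inject₁ q) + L (suc q))
    ≡⟨ sum-cong-≗ step ⟩
  sum {n} (λ _ → 1)
    ≡⟨ ones n ⟩
  n ∎
  where
  open ≡-Reasoning
  R L : Fin (ℕ.suc n) → ℕ
  R p = 𝟙 (hasRight? w (w ⟨$⟩ʳ p))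
  L p = 𝟙 (hasLeft? w (w ⟨$⟩ʳ p))
  ones : ∀ n → sum {n} (λ _ → 1) ≡ n
  ones ℕ.zero    = refl
  ones (ℕ.suc n) = cong ℕ.suc (ones n)
  toℕ-pos : ∀ p → toℕ (pos w (w ⟨$⟩ʳ p)) ≡ toℕ p
  toℕ-pos p = cong toℕ (inverseˡ w)
  no-left : ¬ HasLeft w (w ⟨$⟩ʳ zero)
  no-left (b , _ , b◁a) = contradiction (subst (toℕ (pos w b) ℕ.<_) (toℕ-pos zero) b◁a) ℕ.n≮0
  no-right : ¬ HasRight w (w ⟨$⟩ʳ fromℕ n)
  no-right (b , _ , a◁b) = ℕ.<⇒≱ (Fin.toℕ<n (pos w b))
    (subst (ℕ._< toℕ (pos w b)) (trans (toℕ-pos (fromℕ n)) (Fin.toℕ-fromℕ n)) a◁b)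
  step : ∀ q → R (inject₁ q) + L (suc q) ≡ 1
  step q = adjacent-hasRight+hasLeft w
    (trans (toℕ-pos (suc q)) (cong ℕ.suc (sym (trans (toℕ-pos (inject₁ q)) (Fin.toℕ-inject₁ q)))))

2peaks+free : (w : 𝕊 n) → 2 * card (peak? w) + card (free? w) ≡ n ∸ 1
2peaks+free {n} w = begin
  2 * card (peak? w) + card (free? w)
    ≡⟨ cong (λ k → card (peak? w) + k + card (free? w)) (ℕ.+-identityʳ (card (peak? w))) ⟩
  card (peak? w) + card (peak? w) + card (free? w)
    ≡⟨ cong (_+ card (free? w)) (∑-distrib-+ (𝟙 ∘ peak? w) (𝟙 ∘ peak? w)) ⟨
  sum (λ a → 𝟙 (peak? w a) + 𝟙 (peak? w a)) + card (free? w)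
    ≡⟨ ∑-distrib-+ (λ a → 𝟙 (peak? w a) + 𝟙 (peak? w a)) (𝟙 ∘ free? w) ⟨
  sum (λ a → 𝟙 (peak? w a) + 𝟙 (peak? w a) + 𝟙 (free? w a))
    ≡⟨ sum-cong-≗ pointwise ⟩
  sum (λ a → 𝟙 (hasRight? w a) + 𝟙 (hasLeft? w a))
    ≡⟨ ∑-distrib-+ (𝟙 ∘ hasRight? w) (𝟙 ∘ hasLeft? w) ⟩
  card (hasRight? w) + card (hasLeft? w)
    ≡⟨ hasRight+hasLeft w ⟩
  n ∸ 1 ∎
  where
  open ≡-Reasoning
  pointwise : ∀ a → 𝟙 (peak? w a) + 𝟙 (peak? w a) + 𝟙 (free? w a) ≡ 𝟙 (hasRight? w a) + 𝟙 (hasLeft? w a)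
  pointwise a with hasRight? w a | hasLeft? w a
  ... | yes r | yes l rewrite 𝟙-true (peak? w a) (r , l) | 𝟙-false (free? w a)
      (peak⇒¬free w (r , l)) = refl
  ... | yes r | no ¬l rewrite 𝟙-false (peak? w a) (¬l ∘ proj₂) | 𝟙-true (free? w a) (inj₁ (r , ¬l)) = refl
  ... | no ¬r | yes l rewrite 𝟙-false (peak? w a) (¬r ∘ proj₁) | 𝟙-true (free? w a) (inj₂ (¬r , l)) = refl
  ... | no ¬r | no ¬l rewrite 𝟙-false (peak? w a) (¬r ∘ proj₁)
                            | 𝟙-false (free? w a) [ ¬r ∘ proj₁ , ¬l ∘ proj₂ ]′ = refl

des-hopped : (w : 𝕊 n) (X : Fin n → Bool) (FX? : Decidable λ a → Free w a × X a ≡ true) →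
             des (hopped w X) ≡ card (peak? w) + card FX?
des-hopped w X FX? = trans (des≡hasRight (hopped w X))
  (card-⊎ (peak? w) FX? (hasRight? (hopped w X)) split
    (λ p → unfree-hasRight (peak⇒¬free w p) (proj₁ p))
    (λ (free , eq) → true⇒hasRight free eq)
    (λ p (free , _) → peak⇒¬free w p free))
  where
  open Hopping w X hiding (hopped)
  split : ∀ {a} → HasRight (hopped w X) a → Peak w a ⊎ (Free w a × X a ≡ true)
  split {a} r with free? w a | hasLeft? w a
  ... | yes free | _     = inj₂ (free , hopped-hasRight free r)
  ... | no ¬free | yes l = inj₁ (unfree-hasRight⁻¹ ¬free r , l)
  ... | no ¬free | no ¬l = contradiction (inj₁ (unfree-hasRight⁻¹ ¬free r , ¬l)) ¬free

-- Noncrossing partitions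

-- If the blocks differ, the word contains `c`, `d`, `b` or `b`, `c`, `a` as a 231, according to
-- which block comes first.
noncrossing-blocks : (w : 𝕊 n) → Avoids231 w → ∀ {a b c d} → a Fin.< b → b Fin.< c → c Fin.< d →
                     Block w a c → Block w b d → Block w a b
noncrossing-blocks w avoids {a} {b} {c} {d} a<b b<c c<d a~c b~d with block? w a b | ◁-cmp w a b
... | yes a~b | _ = a~b
... | no _    | tri≈ _ refl _ = contradiction a<b (ℕ.<-irrefl refl)
... | no a≁b  | tri< a◁b _ _ = contradiction
  (b , c , d , b<c , c<d , blocks-ordered w a~c b~d a≁b a◁b , block-order w (block-sym w b~d)
    (ℕ.<-trans b<c c<d))
  (avoids⇒¬pattern w avoids)
... | no a≁b  | tri> _ _ b◁a = contradiction
  (a , b , c , a<b , b<c , blocks-ordered w (block-refl w) a~c (a≁b ∘ block-sym w) b◁a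
    , block-order w (block-sym w a~c) (ℕ.<-trans a<b b<c))
  (avoids⇒¬pattern w avoids)

toNC : 𝕊231 n → NC n
toNC (w , avoids) = record
  { _∼_              = Block w
  ; isDecEquivalence = record
    { isEquivalence = record { refl = block-refl w ; sym = block-sym w ; trans = block-trans w }
    ; _≟_           = block? w
    }
  ; noncrossing      = noncrossing-blocks w avoids
  }

-- If a > b is an inversion of u with a ≁ b, avoidance forces the block of a to contain
-- a letter below b.
block⊆⇒⊑ : (u v : 𝕊 n) → Avoids231 u → Avoids231 v → (∀ {a b} → Block u a b → Block v a b) → u ⊑ v
block⊆⇒⊑ u v u-av v-av blk = record { inversion = inv ; block = blk }
  where
  inv : ∀ a b → b Fin.< a → a ◁[ u ] b → a ◁[ v ] b
  inv a b b<a a◁b with block? u a b | blockMin u a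
  ... | yes a~b | _ = block-order v (blk a~b) b<a
  ... | no a≁b  | m , a~m , m-min with <⊎≡⊎> m b
  ...   | inj₂ (inj₁ refl) = contradiction a~m a≁b
  ...   | inj₁ m<b with ◁-cmp v a b
  ...     | tri< p _ _ = p
  ...     | tri≈ _ refl _ = contradiction b<a (ℕ.<-irrefl refl)
  ...     | tri> _ _ b◁a = contradiction
    (m , b , a , m<b , b<a , b◁a , block-order v (blk a~m) (ℕ.<-trans m<b b<a)) (avoids⇒¬pattern v v-av)
  inv a b b<a a◁b | no a≁b | m , a~m , m-min | inj₂ (inj₂ b<m)
    with successor u (outside-block u a~m a≁b a◁b)
  ... | c , adj , c⊴b with <⊎≡⊎> c m
  ...   | inj₁ c<m         = contradiction (descent⇒nonMin u adj c<m) m-min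
  ...   | inj₂ (inj₁ refl) = contradiction (adjacent⇒◁ u {m} {m} adj) (ℕ.<-irrefl refl)
  ...   | inj₂ (inj₂ m<c)  = contradiction
    (b , m , c , b<m , m<c , adjacent⇒◁ u adj , ⊴⇒◁ u c⊴b λ { refl → ℕ.<-asym b<m m<c })
      (avoids⇒¬pattern u u-av)

-- The inverse: list the blocks by increasing minimum, each of them decreasingly.
module FromNC (π : NC n) where

  open NC π using (_∼_; noncrossing)
  open IsDecEquivalence (NC.isDecEquivalence π) using () renaming
    (refl to ∼-refl; sym to ∼-sym; trans to ∼-trans; _≟_ to _∼?_)

  private
    classMin : ∀ a → ∃[ m ] a ∼ m × (∀ b → a ∼ b → m Fin.≤ b)
    classMin a = least (a ∼?_) ∼-refl

  abstract

    bottom : Fin n → Fin n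
    bottom a = proj₁ (classMin a)

    ∼-bottom : ∀ a → a ∼ bottom a
    ∼-bottom a = proj₁ (proj₂ (classMin a))

    bottom-≤ : ∀ {a b} → a ∼ b → bottom a Fin.≤ b
    bottom-≤ {a} {b} = proj₂ (proj₂ (classMin a)) b

  bottom-cong : ∀ {a b} → a ∼ b → bottom a ≡ bottom b
  bottom-cong a∼b = Fin.≤-antisym (bottom-≤ (∼-trans a∼b (∼-bottom _)))
                                  (bottom-≤ (∼-trans (∼-sym a∼b) (∼-bottom _)))

  bottom-cancel : ∀ {a b} → bottom a ≡ bottom b → a ∼ b
  bottom-cancel {a} {b} eq = ∼-trans (∼-bottom a) (subst (_∼ b) (sym eq) (∼-sym (∼-bottom b)))

  key₁ key₂ : Fin n → ℕ
  key₁ a = toℕ (bottom a)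
  key₂ a = n ∸ toℕ a

  key-injective : ∀ {a b} → key₁ a ≡ key₁ b → key₂ a ≡ key₂ b → a ≡ b
  key-injective {a} {b} _ eq = Fin.toℕ-injective
    (ℕ.∸-cancelˡ-≡ (ℕ.<⇒≤ (Fin.toℕ<n a)) (ℕ.<⇒≤ (Fin.toℕ<n b)) eq)

  open Lexicographic key₁ key₂ key-injective using (_≺_)

  abstract

    listing : 𝕊 n
    listing = Lexicographic.sorted key₁ key₂ key-injective

    ≺⇒◁ : ∀ a b → a ≺ b → a ◁[ listing ] b
    ≺⇒◁ = Lexicographic.≺⇒◁ key₁ key₂ key-injective

    ◁⇒≺ : ∀ a b → a ◁[ listing ] b → a ≺ b
    ◁⇒≺ = Lexicographic.◁⇒≺ key₁ key₂ key-injective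

  bottom-mono : ∀ {a b} → a ⊴[ listing ] b → bottom a Fin.≤ bottom b
  bottom-mono {a} {b} a⊴b with a Fin.≟ b
  ... | yes refl = ℕ.≤-refl
  ... | no a≢b with ◁⇒≺ a b (⊴⇒◁ listing a⊴b a≢b)
  ...   | inj₁ p       = ℕ.<⇒≤ p
  ...   | inj₂ (p , _) = ℕ.≤-reflexive p

  class-order : ∀ {a b} → bottom a ≡ bottom b → b Fin.< a → a ◁[ listing ] b
  class-order {a} {b} eq b<a = ≺⇒◁ a b (inj₂ (cong toℕ eq , ℕ.∸-monoʳ-< b<a (ℕ.<⇒≤ (Fin.toℕ<n a))))

  class-decreasing : ∀ {a b} → bottom a ≡ bottom b → a ◁[ listing ] b → b Fin.< a
  class-decreasing {a} {b} eq a◁b with <⊎≡⊎> a b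
  ... | inj₁ a<b         = contradiction (class-order (sym eq) a<b) (ℕ.<-asym a◁b)
  ... | inj₂ (inj₁ refl) = contradiction a◁b (ℕ.<-irrefl refl)
  ... | inj₂ (inj₂ b<a)  = b<a

  ∼⇒block : ∀ {a b} → a ∼ b → Block listing a b
  ∼⇒block {a} {b} a∼b = [ inj₁ ∘ falls (bottom-cong a∼b) , inj₂ ∘ falls (sym (bottom-cong a∼b)) ]′
    (ℕ.≤-total (toℕ (pos listing a)) (toℕ (pos listing b)))
    where
    falls : ∀ {a b} → bottom a ≡ bottom b → a ⊴[ listing ] b → Fall listing a b
    falls {a} {b} eq a⊴b = fall a⊴b λ c d a⊴c c◁d d⊴b → class-decreasing
      (trans (sym (same a⊴c (ℕ.≤-trans (ℕ.<⇒≤ c◁d) d⊴b))) (same (ℕ.≤-trans a⊴c (ℕ.<⇒≤ c◁d)) d⊴b)) c◁d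
      where
      same : ∀ {c} → a ⊴[ listing ] c → c ⊴[ listing ] b → bottom a ≡ bottom c
      same a⊴c c⊴b = Fin.≤-antisym (bottom-mono a⊴c)
        (ℕ.≤-trans (bottom-mono c⊴b) (ℕ.≤-reflexive (cong toℕ (sym eq))))

  -- Otherwise the run from `a` to `b` would pass through `bottom a`, which is smaller than `b`: an
  -- ascent.
  fall⇒∼ : ∀ {a b} → Fall listing a b → a ∼ b
  fall⇒∼ {a} {b} f with bottom a Fin.≟ bottom b
  ... | yes eq = bottom-cancel eq
  ... | no neq = contradiction
    (decreasing f (bottom a) b a⊴bottom (≺⇒◁ _ _
      (inj₁ (subst (ℕ._< _) (cong toℕ (sym bottom²)) lt))) ℕ.≤-refl)
    (ℕ.<-asym (ℕ.<-≤-trans lt (bottom-≤ ∼-refl)))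
    where
    bottom² : bottom (bottom a) ≡ bottom a
    bottom² = sym (bottom-cong (∼-bottom a))
    lt : bottom a Fin.< bottom b
    lt = Fin.≤∧≢⇒< (bottom-mono (start⊴end f)) neq
    a⊴bottom : a ⊴[ listing ] bottom a
    a⊴bottom with a Fin.≟ bottom a
    ... | yes eq = ℕ.≤-reflexive (cong (toℕ ∘ pos listing) eq)
    ... | no neq = ℕ.<⇒≤ (class-order (sym bottom²) (Fin.≤∧≢⇒< (bottom-≤ ∼-refl) (neq ∘ sym)))

  block⇒∼ : ∀ {a b} → Block listing a b → a ∼ b
  block⇒∼ = [ fall⇒∼ , ∼-sym ∘ fall⇒∼ ]′

  -- A pattern `b`, `c`, `a` would give `bottom b < bottom c < b < c`, a crossing of two classes.
  listing-avoids : Avoids231 listing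
  listing-avoids = ¬pattern⇒avoids listing λ (a , b , c , a<b , b<c , b◁c , c◁a) →
    let bb≢bc : bottom b ≢ bottom c
        bb≢bc eq = ℕ.<-asym b<c (class-decreasing eq b◁c)
        bc<b : bottom c Fin.< b
        bc<b = ℕ.≤-<-trans (ℕ.≤-trans (bottom-mono (ℕ.<⇒≤ c◁a)) (bottom-≤ ∼-refl)) a<b
        bb<bc : bottom b Fin.< bottom c
        bb<bc = Fin.≤∧≢⇒< (bottom-mono (ℕ.<⇒≤ b◁c)) bb≢bc
        bb∼bc : bottom b ∼ bottom c
        bb∼bc = noncrossing bb<bc bc<b b<c (∼-sym (∼-bottom b)) (∼-sym (∼-bottom c))
    in bb≢bc (bottom-cong (∼-trans (∼-bottom b) (∼-trans bb∼bc (∼-sym (∼-bottom c)))))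

toNC-isOrderIsomorphism : IsOrderIsomorphism (_≈₂₃₁_ {n}) _≈ᴺ_ _≼₂₃₁_ _≤ᴺ_ toNC
toNC-isOrderIsomorphism {n} = record
  { isOrderMonomorphism = record
    { isOrderHomomorphism = record
      { cong = λ {x} {y} → toNC-cong {x} {y}
      ; mono = λ {x} {y} x≼y → block (≼⇒⊑ (proj₁ x) (proj₁ y) x≼y)
      }
    ; injective = λ {x} {y} (x⊆y , y⊆x) → ⊑-antisym (cancel {x} {y} x⊆y) (cancel {y} {x} y⊆x)
    ; cancel    = λ {x} {y} x⊆y → ⊑⇒≼ (proj₁ x) (proj₁ y) (cancel {x} {y} x⊆y)
    }
  ; surjective = λ π → let open FromNC π in
      (listing , listing-avoids) , λ {z} z≈x →
        let z⊆x , x⊆z = toNC-cong {x = z} {y = listing , listing-avoids} z≈x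
        in (λ p → block⇒∼ (z⊆x p)) , (λ p → x⊆z (∼⇒block p))
  }
  where
  toNC-cong : ∀ {x y : 𝕊231 n} → x ≈₂₃₁ y → toNC x ≈ᴺ toNC y
  toNC-cong {x = u , _} {y = v , _} u≈v = ≈⇒block u v u≈v , ≈⇒block v u (≈-sym u v u≈v)
  cancel : ∀ {x y : 𝕊231 n} → toNC x ≤ᴺ toNC y → proj₁ x ⊑ proj₁ y
  cancel {x = u , u-av} {y = v , v-av} = block⊆⇒⊑ u v u-av v-av

-- The two graded posets

des-identity : ∀ n → des (idₚ {n}) ≡ 0
des-identity n = trans (des≡hasRight (idₚ {n})) (card-none (hasRight? (idₚ {n}))
  λ a (b , b⊏a , a◁b) → ℕ.<-asym (smaller b⊏a) a◁b)

identity-⊑ : (w : 𝕊 n) → idₚ ⊑ w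
identity-⊑ w = record
  { inversion = λ a b b<a a<b → contradiction b<a (ℕ.<-asym a<b)
  ; block     = blk
  }
  where
  blk : ∀ {a b} → Block idₚ a b → Block w a b
  blk {a} {b} a~b with <⊎≡⊎> a b
  ... | inj₁ a<b         = contradiction (block-decreasing idₚ a~b a<b) (ℕ.<-asym a<b)
  ... | inj₂ (inj₁ refl) = block-refl w
  ... | inj₂ (inj₂ b<a)  = contradiction (block-decreasing idₚ (block-sym idₚ a~b) b<a) (ℕ.<-asym b<a)

identity-avoids : Avoids231 (idₚ {n})
identity-avoids (i , j , k , i<j , j<k , k<i , _) = ℕ.<-asym k<i (ℕ.<-trans i<j j<k)

reverse-order : ∀ {a b : Fin n} → b Fin.< a → a ◁[ reverse ] b
reverse-order {n} {a} {b} b<a = subst₂ ℕ._<_ (sym (Fin.opposite-prop a)) (sym (Fin.opposite-prop b))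
  (ℕ.∸-monoʳ-< (s≤s b<a) (Fin.toℕ<n a))

reverse-decreasing : ∀ {a b : Fin n} → a ◁[ reverse ] b → b Fin.< a
reverse-decreasing {n} {a} {b} a◁b with <⊎≡⊎> a b
... | inj₁ a<b         = contradiction (reverse-order a<b) (ℕ.<-asym a◁b)
... | inj₂ (inj₁ refl) = contradiction a◁b (ℕ.<-irrefl refl)
... | inj₂ (inj₂ b<a)  = b<a

⊑-reverse : (w : 𝕊 n) → w ⊑ reverse
⊑-reverse w = record
  { inversion = λ _ _ b<a _ → reverse-order b<a
  ; block     = λ {a} {b} _ → [ inj₁ ∘ falls , inj₂ ∘ falls ]′
    (ℕ.≤-total (toℕ (pos reverse a)) (toℕ (pos reverse b)))
  }
  where
  falls : ∀ {a b} → a ⊴[ reverse ] b → Fall reverse a b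
  falls a⊴b = fall a⊴b λ _ _ _ c◁d _ → reverse-decreasing c◁d

des-reverse : ∀ n → des (reverse {n}) ≡ n ∸ 1
des-reverse n = begin
  des (reverse {n})                                            ≡⟨ des≡hasRight (reverse {n}) ⟩
  card (hasRight? (reverse {n}))                               ≡⟨ ℕ.+-identityʳ _ ⟨
  card (hasRight? (reverse {n})) + 0
    ≡⟨ cong (card (hasRight? (reverse {n})) +_) (card-none (hasLeft? (reverse {n})) no-left) ⟨
  card (hasRight? (reverse {n})) + card (hasLeft? (reverse {n})) ≡⟨ hasRight+hasLeft (reverse {n}) ⟩
  n ∸ 1                                                        ∎
  where
  open ≡-Reasoning
  no-left : ∀ a → ¬ HasLeft reverse a
  no-left a (b , b⊏a , b◁a) = ℕ.<-asym (smaller b⊏a) (reverse-decreasing b◁a)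

reverse-avoids : Avoids231 (reverse {n})
reverse-avoids = ¬pattern⇒avoids reverse λ (_ , _ , _ , _ , b<c , b◁c , _) →
  ℕ.<-asym b<c (reverse-decreasing b◁c)

-- Applied to the identity of 𝕊 n and to the projection from 𝕊231 n.
module _ {A : Set} (f : A → 𝕊 n)
         (⊥ᴬ : ∃[ x ] f x ≡ idₚ) (⊤ᴬ : ∃[ x ] f x ≡ reverse)
         (between : ∀ x y → f x ⊑ f y → ¬ (f x ≈ f y) →
                    ∃[ z ] f x ⊑ f z × f z ⊑ f y × ¬ (f x ≈ f z) × des (f z) ≡ ℕ.suc (des (f x))) where

  private
    _≈ᴬ_ _≼ᴬ_ : Rel A 0ℓ
    _≈ᴬ_ = _≈_ on f
    _≼ᴬ_ = _≼_ on f

    to : ∀ {x y} → x ≼ᴬ y → f x ⊑ f y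
    to {x} {y} = ≼⇒⊑ (f x) (f y)

    from : ∀ {x y} → f x ⊑ f y → x ≼ᴬ y
    from {x} {y} = ⊑⇒≼ (f x) (f y)

  ≼-isPartialOrder : IsPartialOrder _≈ᴬ_ _≼ᴬ_
  ≼-isPartialOrder = record
    { isPreorder = record
      { isEquivalence = record
        { refl  = λ {x} → ≈-refl (f x)
        ; sym   = λ {x} {y} → ≈-sym (f x) (f y)
        ; trans = λ {x} {y} {z} → ≈-trans (f x) (f y) (f z)
        }
      ; reflexive = λ {x} {y} x≈y → from {x} {y} (≈⇒⊑ (f x) (f y) x≈y)
      ; trans     = λ x≼y y≼z cone → x≼y (y≼z cone)
      }
    ; antisym = λ {x} {y} x≼y y≼x → ⊑-antisym (to {x} {y} x≼y) (to {y} {x} y≼x)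
    }

  ≼-isGraded : Order.IsGraded _≈ᴬ_ _≼ᴬ_ (des ∘ f) (n ∸ 1)
  ≼-isGraded = record
    { isPartialOrder = ≼-isPartialOrder
    ; rank-cong      = λ {x} {y} → des-cong (f x) (f y)
    ; rank-mono      = λ {x} {y} (x≼y , x≉y) → des-mono-< (to {x} {y} x≼y) x≉y
    ; rank-cover     = λ {x} {y} → cover x y
    ; rank-minimal   = λ {x} → minimal ⊥ᴬ x
    ; rank-maximal   = λ {x} → maximal ⊤ᴬ x
    }
    where
    open Order _≈ᴬ_ _≼ᴬ_ using (_⋖_) renaming (_<_ to _<ᴬ_)
    strict : ∀ x y → f x ⊑ f y → ¬ (f x ≈ f y) → x <ᴬ y
    strict x y x⊑y x≉y = from {x} {y} x⊑y , x≉y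
    cover : ∀ x y → x ⋖ y → des (f y) ≡ ℕ.suc (des (f x))
    cover x y ((x≼y , x≉y) , none) with between x y (to {x} {y} x≼y) x≉y
    ... | z , x⊑z , z⊑y , x≉z , des-z with ≈? (f z) (f y)
    ...   | yes z≈y = trans (sym (des-cong (f z) (f y) z≈y)) des-z
    ...   | no z≉y  = ⊥-elim (none z (strict x z x⊑z x≉z , strict z y z⊑y z≉y))
    minimal : ∃[ b ] f b ≡ idₚ → ∀ x → (∀ y → ¬ (y <ᴬ x)) → des (f x) ≡ 0
    minimal (b , fb≡id) x none with ≈? (f b) (f x)
    ... | yes b≈x = trans (sym (des-cong (f b) (f x) b≈x)) (trans (cong des fb≡id) (des-identity n))
    ... | no b≉x  = ⊥-elim (none b (strict b x (subst (_⊑ f x) (sym fb≡id) (identity-⊑ (f x))) b≉x))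
    maximal : ∃[ t ] f t ≡ reverse → ∀ x → (∀ y → ¬ (x <ᴬ y)) → des (f x) ≡ n ∸ 1
    maximal (t , ft≡rev) x none with ≈? (f x) (f t)
    ... | yes x≈t = trans (des-cong (f x) (f t) x≈t) (trans (cong des ft≡rev) (des-reverse n))
    ... | no x≉t  = ⊥-elim (none t (strict x t (subst (f x ⊑_) (sym ft≡rev) (⊑-reverse (f x))) x≉t))

𝕊-isGraded : Order.IsGraded (_≈_ {n} {n}) _≼_ des (n ∸ 1)
𝕊-isGraded = ≼-isGraded (λ w → w) (idₚ , refl) (reverse , refl) λ x y x⊑y x≉y →
  let z , x⊑z , z⊑y , x≉z , des-z , _ = interpolate x⊑y x≉y in z , x⊑z , z⊑y , x≉z , des-z

𝕊231-isGraded : Order.IsGraded (_≈₂₃₁_ {n}) _≼₂₃₁_ des₂₃₁ (n ∸ 1)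
𝕊231-isGraded = ≼-isGraded proj₁ ((idₚ , identity-avoids) , refl) ((reverse , reverse-avoids) , refl)
  λ (x , x-av) (y , y-av) x⊑y x≉y →
  let z , x⊑z , z⊑y , x≉z , des-z , av = interpolate x⊑y x≉y in (z , av x-av y-av) , x⊑z , z⊑y , x≉z , des-z

-- Codes of permutations and of hopping orbits

funToFin-cong : ∀ {k m} {f g : Fin k → Fin m} → (∀ i → f i ≡ g i) → funToFin f ≡ funToFin g
funToFin-cong {ℕ.zero}  f≗g = refl
funToFin-cong {ℕ.suc k} f≗g = cong₂ Fin.combine (f≗g zero) (funToFin-cong (f≗g ∘ suc))

abstract

  code : 𝕊 n → Fin (n ℕ.^ n)
  code w = funToFin (pos w)

  decode : Fin (n ℕ.^ n) → 𝕊 n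
  decode {n} c with Fin.all? (λ i → Fin.all? (λ j → (finToFun {n} {n} c i Fin.≟ finToFun c j) →-dec
    (i Fin.≟ j)))
  ... | yes inj = fromPositions (finToFun c) (inj _ _)
  -- No permutation has such a code, so the identity is a mere default. `IsOrbit` discards these
  -- codes, since `orbit` takes only codes of permutations as values.
  ... | no _    = idₚ

  code-cong : (u v : 𝕊 n) → u ≈ v → code u ≡ code v
  code-cong u v u≈v = funToFin-cong (≈⇒pos u v u≈v)

  decode-code : (w : 𝕊 n) → decode (code w) ≈ w
  decode-code {n} w
    with Fin.all? (λ i → Fin.all? (λ j → (finToFun {n} {n} (code w) i Fin.≟ finToFun (code w) j)
      →-dec (i Fin.≟ j)))
  ... | yes inj = pos⇒≈ (fromPositions (finToFun (code w)) (inj _ _)) w (Fin.finToFun-funToFin (pos w))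
  ... | no ¬inj = contradiction (λ i j eq → pos-injective w
    (trans (sym (Fin.finToFun-funToFin (pos w) i)) (trans eq (Fin.finToFun-funToFin (pos w) j)))) ¬inj

code-injective : (u v : 𝕊 n) → code u ≡ code v → u ≈ v
code-injective u v eq = ≈-trans u (decode (code u)) v (≈-sym (decode (code u)) u (decode-code u))
  (subst (λ c → decode c ≈ v) (sym eq) (decode-code v))

hasRightᵇ : 𝕊 n → Fin n → Bool
hasRightᵇ w a = does (hasRight? w a)

hopped-hasRightᵇ : (w : 𝕊 n) → hopped w (hasRightᵇ w) ≈ w
hopped-hasRightᵇ w = hopped-self w (hasRightᵇ w) (λ {a} _ → dec-true (hasRight? w a))
  (λ {a} _ → dec-false (hasRight? w a))

unhopped : 𝕊 n → 𝕊 n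
unhopped w = hopped w (λ _ → false)

-- The code of the member without double descents of the hopping orbit of w.
orbit : 𝕊 n → Fin (n ℕ.^ n)
orbit w = code (unhopped w)

orbit-cong : (u v : 𝕊 n) → u ≈ v → orbit u ≡ orbit v
orbit-cong u v u≈v = code-cong (unhopped u) (unhopped v) (hopped-cong u v _ _ u≈v (λ _ _ → refl))

orbit-hopped : (w : 𝕊 n) (X : Fin n → Bool) → orbit (hopped w X) ≡ orbit w
orbit-hopped w X = code-cong (unhopped (hopped w X)) (unhopped w) (hopped-hopped w X _)

-- Both hop to the same canonical member, and from there the sides of the descendants in `u` lead
-- back to `u`.
same-orbit⇒hopped : (u v : 𝕊 n) → orbit u ≡ orbit v → hopped v (hasRightᵇ u) ≈ u
same-orbit⇒hopped u v eq =
  ≈-trans (hopped v X) (hopped (unhopped v) X) u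
    (≈-sym (hopped (unhopped v) X) (hopped v X) (hopped-hopped v _ X))
  (≈-trans (hopped (unhopped v) X) (hopped (unhopped u) X) u
    (hopped-cong (unhopped v) (unhopped u) X X (code-injective _ _ (sym eq)) (λ _ _ → refl))
  (≈-trans (hopped (unhopped u) X) (hopped u X) u (hopped-hopped u _ X) (hopped-hasRightᵇ u)))
  where
  X = hasRightᵇ u

pattern-cong : (u v : 𝕊 n) → u ≈ v → Pattern231 u → Pattern231 v
pattern-cong u v u≈v (a , b , c , a<b , b<c , b◁c , c◁a) =
  a , b , c , a<b , b<c , ≈⇒◁ u v u≈v b c b◁c , ≈⇒◁ u v u≈v c a c◁a

orbit-pattern : (u v : 𝕊 n) → orbit u ≡ orbit v → Pattern231 v → Pattern231 u
orbit-pattern u v eq p = pattern-cong (hopped v _) u (same-orbit⇒hopped u v eq)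
  (Hopping.hopped-pattern v _ p)

pattern? : (w : 𝕊 n) → Dec (Pattern231 w)
pattern? w = Fin.any? λ a → Fin.any? λ b → Fin.any? λ c →
  (a Fin.<? b) ×-dec ((b Fin.<? c) ×-dec (◁? w b c ×-dec ◁? w c a))

-- Ranks and covers in boolean lattices

∣p∪⁅x⁆∣≤1+∣p∣ : ∀ {m} (p : Subset m) x → ∣ p ∪ ⁅ x ⁆ ∣ ≤ ℕ.suc ∣ p ∣
∣p∪⁅x⁆∣≤1+∣p∣ (inside  ∷ p) zero    rewrite Subset.∪-identityʳ p = ℕ.n≤1+n _
∣p∪⁅x⁆∣≤1+∣p∣ (outside ∷ p) zero    rewrite Subset.∪-identityʳ p = ℕ.≤-refl
∣p∪⁅x⁆∣≤1+∣p∣ (inside  ∷ p) (suc x) = s≤s (∣p∪⁅x⁆∣≤1+∣p∣ p x)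
∣p∪⁅x⁆∣≤1+∣p∣ (outside ∷ p) (suc x) = ∣p∪⁅x⁆∣≤1+∣p∣ p x

-- Adjoining a single new element of `q` to `p` must already give `q`.
⋖⇒∣∣≤ : ∀ {m} {p q : Subset m} → Boolean._⋖_ m p q → ∣ q ∣ ≤ ℕ.suc ∣ p ∣
⋖⇒∣∣≤ {m} {p} {q} ((p⊆q , p≢q) , none) with Fin.any? (λ x → Subset._∈?_ x q ×-dec ¬? (Subset._∈?_ x p))
... | no ¬new = contradiction (Subset.⊆-antisym p⊆q λ {x} x∈q →
  decidable-stable (Subset._∈?_ x p) λ x∉p → ¬new (x , x∈q , x∉p)) p≢q
... | yes (x , x∈q , x∉p) with Vec.≡-dec Bool._≟_ (p ∪ ⁅ x ⁆) q
...   | yes refl = ∣p∪⁅x⁆∣≤1+∣p∣ p x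
...   | no ≢q = ⊥-elim (none (p ∪ ⁅ x ⁆)
  ( (Subset.p⊆p∪q ⁅ x ⁆ , λ eq → x∉p (subst (x ∈_) (sym eq) (Subset.q⊆p∪q p ⁅ x ⁆ (Subset.x∈⁅x⁆ x))))
  , ((λ y∈ → [ p⊆q , (λ y∈⁅x⁆ → subst (_∈ q) (sym (Subset.x∈⁅y⁆⇒x≡y x y∈⁅x⁆)) x∈q) ]′
    (Subset.x∈p∪q⁻ p ⁅ x ⁆ y∈)) , ≢q)))

∣∣≡card : ∀ {m} (p : Subset m) → ∣ p ∣ ≡ card (λ x → Subset._∈?_ x p)
∣∣≡card [] = refl
∣∣≡card (b ∷ p) with ∣∣≡card p | card-cong (λ x → Subset._∈?_ x p) (λ x → Subset._∈?_ (suc x) (b ∷ p))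
                                    (λ _ → there) (λ _ → Subset.drop-there)
∣∣≡card (inside  ∷ p) | ∣p∣ | eq = cong ℕ.suc (trans ∣p∣ eq)
∣∣≡card (outside ∷ p) | ∣p∣ | eq = trans ∣p∣ eq

-- The decomposition

module HoppingOrbit (r : 𝕊 n) where

  #peaks : ℕ
  #peaks = card (peak? r)

  2#peaks≤n∸1 : 2 * #peaks ≤ n ∸ 1
  2#peaks≤n∸1 = subst (2 * #peaks ≤_) (2peaks+free r) (ℕ.m≤m+n (2 * #peaks) (card (free? r)))

  #free : card (free? r) ≡ (n ∸ 1) ∸ 2 * #peaks
  #free = trans (sym (ℕ.m+n∸m≡n (2 * #peaks) (card (free? r)))) (cong (_∸ 2 * #peaks) (2peaks+free r))

  -- The count of free letters is rewritten so that the labels range over exactly the ground set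
  -- demanded by `IsSymmetricBoolean`.
  open Enumeration (subst (Enumeration (Free r)) #free (enumeration (free? r)))

  dim : ℕ
  dim = (n ∸ 1) ∸ 2 * #peaks

  Chosen : Subset dim → Pred (Fin n) 0ℓ
  Chosen Z a = ∃[ t ] (element t ≡ a) × (t ∈ Z)

  abstract

    chosen? : ∀ Z → Decidable (Chosen Z)
    chosen? Z a = Fin.any? λ t → (element t Fin.≟ a) ×-dec Subset._∈?_ t Z

  chosen : Subset dim → Fin n → Bool
  chosen Z a = does (chosen? Z a)

  chosen⇒Chosen : ∀ {Z a} → chosen Z a ≡ true → Chosen Z a
  chosen⇒Chosen {Z} {a} eq with chosen? Z a
  ... | yes p = p

  ∈⇒chosen : ∀ {Z t} → t ∈ Z → chosen Z (element t) ≡ true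
  ∈⇒chosen {Z} {t} t∈Z = dec-true (chosen? Z (element t)) (t , refl , t∈Z)

  chosen⇒∈ : ∀ {Z t} → chosen Z (element t) ≡ true → t ∈ Z
  chosen⇒∈ {Z} eq with chosen⇒Chosen {Z} eq
  ... | t′ , eq′ , t′∈Z = subst (_∈ Z) (injective eq′) t′∈Z

  ρ : Subset dim → 𝕊 n
  ρ Z = hopped r (chosen Z)

  ρ-hasRight : ∀ {Z t} → t ∈ Z → HasRight (ρ Z) (element t)
  ρ-hasRight {Z} {t} t∈Z = Hopping.true⇒hasRight r (chosen Z) (holds t) (∈⇒chosen t∈Z)

  ρ-injective : ∀ {Y Z} → ρ Y ≈ ρ Z → Y ≡ Z
  ρ-injective {Y} {Z} eq = Subset.⊆-antisym (λ {t} → half {Y} {Z} eq)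
    (λ {t} → half {Z} {Y} (≈-sym (ρ Y) (ρ Z) eq))
    where
    half : ∀ {Y Z} → ρ Y ≈ ρ Z → ∀ {t} → t ∈ Y → t ∈ Z
    half {Y} {Z} eq {t} t∈Y = chosen⇒∈ (Hopping.hopped-hasRight r (chosen Z) (holds t)
      (≈⇒hasRight (ρ Y) (ρ Z) eq (ρ-hasRight t∈Y)))

  ρ-surjective : ∀ (w : 𝕊 n) → orbit w ≡ orbit r → ∃[ Z ] ρ Z ≈ w
  ρ-surjective w eq = Z , ≈-trans (ρ Z) (hopped r (hasRightᵇ w)) w
    (hopped-cong r r (chosen Z) (hasRightᵇ w) (≈-refl r) agree) (same-orbit⇒hopped w r eq)
    where
    Z : Subset dim
    Z = Vec.tabulate (hasRightᵇ w ∘ element)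
    ∈Z : ∀ t → hasRightᵇ w (element t) ≡ true → t ∈ Z
    ∈Z t eq = Vec.lookup⇒[]= t Z (trans (Vec.lookup∘tabulate (hasRightᵇ w ∘ element) t) eq)
    ∈Z⁻¹ : ∀ t → t ∈ Z → hasRightᵇ w (element t) ≡ true
    ∈Z⁻¹ t t∈Z = trans (sym (Vec.lookup∘tabulate (hasRightᵇ w ∘ element) t)) (Vec.[]=⇒lookup t∈Z)
    agree-at : ∀ t → chosen Z (element t) ≡ hasRightᵇ w (element t)
    agree-at t = go (chosen Z (element t)) (hasRightᵇ w (element t)) refl refl
      where
      go : ∀ x y → chosen Z (element t) ≡ x → hasRightᵇ w (element t) ≡ y → x ≡ y
      go true  true  _ _ = refl
      go false false _ _ = refl
      go true  false p q = true≢false (∈Z⁻¹ t (chosen⇒∈ p)) q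
      go false true  p q = true≢false (∈⇒chosen (∈Z t q)) p
    agree : ∀ a → Free r a → chosen Z a ≡ hasRightᵇ w a
    agree a free with index free
    ... | t , refl = agree-at t

  ρ-rank : ∀ Z → des (ρ Z) ≡ #peaks + ∣ Z ∣
  ρ-rank Z = trans (des-hopped r (chosen Z) free-chosen?) (cong (#peaks +_)
    (trans (ℕ.≤-antisym
      (card-matching free-chosen? (λ t → Subset._∈?_ t Z) (λ a t → element t Fin.≟ a)
        (λ (_ , eq) → let t , et≡a , t∈Z = chosen⇒Chosen eq in t , et≡a , t∈Z)
        (λ p q → trans (sym p) q))
      (card-matching (λ t → Subset._∈?_ t Z) free-chosen? (λ t a → element t Fin.≟ a)
        (λ {t} t∈Z → element t , refl , holds t , ∈⇒chosen t∈Z)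
        (λ p q → injective (trans p (sym q)))))
      (sym (∣∣≡card Z))))
    where
    free-chosen? : Decidable (λ a → Free r a × chosen Z a ≡ true)
    free-chosen? a = free? r a ×-dec (chosen Z a Bool.≟ true)

  open Order (_≈_ {n} {n}) _≼_ using (_⋖_)

  -- The ranks of the two images differ by at most one, and `des` is strictly monotone, so nothing
  -- fits strictly between.
  ρ-cover : ∀ {Y Z} → Boolean._⋖_ dim Y Z → ρ Y ⋖ ρ Z
  ρ-cover {Y} {Z} Y⋖Z@((Y⊆Z , Y≢Z) , _) = (⊑⇒≼ (ρ Y) (ρ Z) ρY⊑ρZ , Y≢Z ∘ ρ-injective) , none
    where
    ρY⊑ρZ : ρ Y ⊑ ρ Z
    ρY⊑ρZ = hopped-mono r (chosen Y) (chosen Z) λ a eq →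
      let t , et≡a , t∈Y = chosen⇒Chosen {Y} eq in dec-true (chosen? Z a) (t , et≡a , Y⊆Z t∈Y)
    none : ∀ z → ¬ ((ρ Y ≼ z × ¬ (ρ Y ≈ z)) × (z ≼ ρ Z × ¬ (z ≈ ρ Z)))
    none z ((Y≼z , Y≉z) , (z≼Z , z≉Z)) = ℕ.<⇒≱
      (ℕ.≤-<-trans (des-mono-< (≼⇒⊑ (ρ Y) z Y≼z) Y≉z) (des-mono-< (≼⇒⊑ z (ρ Z) z≼Z) z≉Z))
      (subst₂ _≤_ (sym (ρ-rank Z)) (cong ℕ.suc (sym (ρ-rank Y)))
        (ℕ.≤-trans (ℕ.+-monoʳ-≤ #peaks (⋖⇒∣∣≤ Y⋖Z)) (ℕ.≤-reflexive (ℕ.+-suc #peaks ∣ Y ∣))))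

  isSymmetricBoolean : {P : Pred (𝕊 n) 0ℓ} →
    (∀ {w} → P w → orbit w ≡ orbit r) → (∀ {w} → orbit w ≡ orbit r → P w) →
    IsSymmetricBoolean (_≈_ {n} {n}) _≼_ des (n ∸ 1) P
  isSymmetricBoolean P⇒orbit orbit⇒P = record
    { j          = #peaks
    ; j≤N/2      = 2#peaks≤n∸1
    ; ρ          = ρ
    ; into       = λ Z → orbit⇒P (orbit-hopped r (chosen Z))
    ; injective  = ρ-injective
    ; surjective = λ {w} Pw → ρ-surjective w (P⇒orbit Pw)
    ; covers     = ρ-cover
    ; ranks      = ρ-rank
    }

module Decomposition (n : ℕ) where

  -- The image of `orbit`, put in a decidable form that lets the orbits be enumerated without
  -- repetition.
  IsOrbit : Pred (Fin (n ℕ.^ n)) 0ℓ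
  IsOrbit c = orbit (decode {n} c) ≡ c

  isOrbit? : Decidable IsOrbit
  isOrbit? c = orbit (decode {n} c) Fin.≟ c

  open Enumeration (enumeration isOrbit?) public

  Part : Fin (card isOrbit?) → Pred (𝕊 n) 0ℓ
  Part i w = orbit w ≡ element i

  part : ∀ w → ∃[ i ] Part i w
  part w with index {orbit w} (trans
    (orbit-cong (decode (orbit w)) (unhopped w) (decode-code (unhopped w)))
      (orbit-hopped w (λ _ → false)))
  ... | i , eq = i , sym eq

  representative : Fin (card isOrbit?) → 𝕊 n
  representative i = decode (element i)

  part-isSymmetricBoolean : ∀ i → IsSymmetricBoolean (_≈_ {n} {n}) _≼_ des (n ∸ 1) (Part i)
  part-isSymmetricBoolean i = HoppingOrbit.isSymmetricBoolean (representative i)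
    (λ eq → trans eq (sym (holds i))) (λ eq → trans eq (holds i))

  -- Hopping neither creates nor destroys occurrences of 231 within an orbit, so one representative
  -- decides for the whole part.
  part-dichotomy : ∀ i → Part i ⊆ Avoids231 ⊎ Part i ⊥ Avoids231
  part-dichotomy i with pattern? (representative i)
  ... | yes p = inj₂ λ {w} (Pw , w-av) → avoids⇒¬pattern w w-av
    (orbit-pattern w (representative i) (trans Pw (sym (holds i))) p)
  ... | no ¬p = inj₁ λ {w} Pw → ¬pattern⇒avoids w λ p →
    ¬p (orbit-pattern (representative i) w (trans (holds i) (sym Pw)) p)

  avoiding : ∀ {w} → Avoids231 w → ∀ i → Part i w → Part i ⊆ Avoids231
  avoiding w-av i Pw with part-dichotomy i
  ... | inj₁ ⊆Av = ⊆Av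
  ... | inj₂ ⊥Av = ⊥-elim (⊥Av (Pw , w-av))

  𝕊-decomposition : IsSymmetricBooleanDecomposition (_≈_ {n} {n}) _≼_ des (n ∸ 1) U Part
  𝕊-decomposition = record
    { isGraded         = 𝕊-isGraded
    ; respects         = λ {_} {x} {y} _ x≈y Px → trans (sym (orbit-cong x y x≈y)) Px
    ; disjoint         = λ _ _ p q → injective (trans (sym p) q)
    ; exhaustive       = λ w → let i , p = part w in i , tt , p
    ; symmetricBoolean = λ {i} _ → part-isSymmetricBoolean i
    }

  𝕊231-decomposition : IsSymmetricBooleanDecomposition (_≈₂₃₁_ {n}) _≼₂₃₁_ des₂₃₁ (n ∸ 1)
                         (λ i → Part i ⊆ Avoids231) (λ i w → Part i (proj₁ w))
  𝕊231-decomposition = record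
    { isGraded         = 𝕊231-isGraded
    ; respects         = λ {_} {x} {y} _ x≈y Px → trans (sym (orbit-cong (proj₁ x) (proj₁ y) x≈y)) Px
    ; disjoint         = λ _ _ p q → injective (trans (sym p) q)
    ; exhaustive       = λ (w , w-av) → let i , p = part w in
        i , (λ {x} → avoiding w-av i p {x}) , p
    ; symmetricBoolean = λ {i} ⊆Av → let open IsSymmetricBoolean (part-isSymmetricBoolean i) in record
        { j          = j
        ; j≤N/2      = j≤N/2
        ; ρ          = λ Z → ρ Z , ⊆Av (into Z)
        ; into       = into
        ; injective  = λ eq → IsSymmetricBoolean.injective (part-isSymmetricBoolean i) eq
        ; surjective = surjective
        -- A cover in the whole poset remains a cover in the induced subposet, where there are fewer
        -- candidates in between.
        ; covers     = λ Y⋖Z → let ((≼ , ≉) , none) = covers Y⋖Z in (≼ , ≉) , λ z → none (proj₁ z)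
        ; ranks      = ranks
        }
    }

theorem1p2 : (n : ℕ) → n ≥ 1 →
    (∃[ k ] Σ[ P ∈ (Fin k → Pred (𝕊 n) 0ℓ) ]
    IsSymmetricBooleanDecomposition (_≈_ {n} {n}) _≼_ des (n ∸ 1) U P
    × (∀ i → P i ⊆ Avoids231 ⊎ P i ⊥ Avoids231)
    × IsSymmetricBooleanDecomposition (_≈₂₃₁_ {n}) _≼₂₃₁_ des₂₃₁ (n ∸ 1)
    (λ i → P i ⊆ Avoids231) (λ i w → P i (proj₁ w)))
    × (Σ[ f ∈ (𝕊231 n → NC n) ] IsOrderIsomorphism _≈₂₃₁_ _≈ᴺ_ _≼₂₃₁_ _≤ᴺ_ f)
theorem1p2 n _ =
  (card isOrbit? , Part , 𝕊-decomposition , part-dichotomy , 𝕊231-decomposition) , toNC ,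
    toNC-isOrderIsomorphism
  where open Decomposition n
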